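{- Let $\mathcal{R}$ be an integral domain, $\Lambda$ a set of colors, and $\mathcal{R}[\Lambda]=\mathcal{R}[X_\lambda,Y_\lambda,x_\lambda,y_\lambda:\lambda\in\Lambda]$. Let $I$ be an ideal of $\mathcal{R}[\Lambda]$. Then the following are equivalent: (a) for every finite connected graph $G$, every $\mathcal{H}\subseteq E(G)$, every coloring $c:E(G)\setminus\mathcal{H}\to\Lambda$ and every block invariant $\psi$ with values in $\mathcal{R}$, the image of the relative Tutte polynomial $T_\mathcal{H}^\psi(G,\phi)$ in $\mathcal{R}[\Lambda]/I$ is the same for all proper labelings $\phi$; (b) for all $\lambda,\mu\in\Lambda$, $$\det\begin{pmatrix}X_\lambda & y_\lambda\\ X_\mu & y_\mu\end{pmatrix}-\det\begin{pmatrix}x_\lambda & Y_\lambda\\ x_\mu & Y_\mu\end{pmatrix}\in I\quad\text{and}\quad \det\begin{pmatrix}x_\lambda & Y_\lambda\\ x_\mu & Y_\mu\end{pmatrix}-\det\begin{pmatrix}x_\lambda & y_\lambda\\ x_\mu & y_\mu\end{pmatrix}\in I.$$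
   Context: Graphs are finite and may have loops and multiple edges. A cycle is the edge set of a circuit (a loop is a cycle); in a connected graph a cocycle is a minimal set of edges whose removal disconnects the graph. For $\mathcal{H}\subseteq E(G)$ (edges of $\mathcal{H}$ are "zero edges", the others "regular"), a contracting set is a set $\mathcal{C}\subseteq E(G)\setminus\mathcal{H}$ containing no cycle such that $\mathcal{D}:=E(G)\setminus(\mathcal{C}\cup\mathcal{H})$ (the deleting set) contains no cocycle. $\mathcal{H}_\mathcal{C}$ denotes the graph obtained from $G$ by deleting all edges of $\mathcal{D}$ and contracting all edges of $\mathcal{C}$. A proper labeling is a map $\phi:E(G)\to\mathbb{Z}$ with $\phi(e)=0$ for $e\in\mathcal{H}$ and $\phi$ injective from $E(G)\setminus\mathcal{H}$ into the positive integers. With respect to $\mathcal{C}$ and $\phi$: an edge $e\in\mathcal{C}$ is internally active if $\mathcal{D}\cup\{e\}$ contains a cocycle in which $e$ has the smallest label, otherwise internally inactive; an edge $f\in\mathcal{D}$ is externally active if $\mathcal{C}\cup\{f\}$ contains a cycle in which $f$ has the smallest label, otherwise externally inactive. For a regular edge $e$ of color $\lambda=c(e)$, its weight $w(e)$ is $X_\lambda,x_\lambda,Y_\lambda,y_\lambda$ according as $e$ is internally active, internally inactive, externally active, externally inactive. A block invariant is a map $\psi$ from isomorphism classes of finite connected graphs to $\mathcal{R}$ such that for every $n\ge1$ there is a symmetric function $f_n:\mathcal{R}^n\to\mathcal{R}$ with $\psi(G)=f_n(\psi(G_1),\dots,\psi(G_n))$ whenever $G$ is connected with blocks $G_1,\dots,G_n$.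 The relative Tutte polynomial is $T_\mathcal{H}^\psi(G,\phi)=\sum_{\mathcal{C}}\big(\prod_{e\in E(G)\setminus\mathcal{H}}w(e)\big)\psi(\mathcal{H}_\mathcal{C})\in\mathcal{R}[\Lambda]$, the sum over all contracting sets $\mathcal{C}$. -}

module Defs where

open import Level using (Level; _⊔_) renaming (suc to lsuc; zero to lzero)
open import Data.Nat using (ℕ; _≤_; _<_) renaming (zero to nzero; suc to nsuc)
open import Data.Fin using (Fin; zero; suc; inject₁; fromℕ)
open import Data.Fin.Permutation using (Permutation′; _⟨$⟩ʳ_)
open import Data.Bool using (Bool; true; false; not; _∧_)
open import Data.Product using (Σ; ∃; _×_; _,_; proj₁; proj₂)
open import Data.Sum using (_⊎_)
open import Data.Unit using (⊤)
open import Relation.Nullary using (¬_)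
open import Relation.Binary.PropositionalEquality using (_≡_; refl)
open import Algebra.Bundles using (CommutativeRing)

-- Finite multigraphs (loops and parallel edges allowed).
-- Vertices Fin nV, edges Fin nE; an edge has an (unordered) pair of ends,
-- stored as an ordered pair but always compared up to swapping.

record Graph : Set where
  constructor graph
  field
    nV nE : ℕ
    ends  : Fin nE → Fin nV × Fin nV
open Graph public

Joins : {V : Set} → V × V → V → V → Set
Joins (a , b) u v = (a ≡ u × b ≡ v) ⊎ (a ≡ v × b ≡ u)

IsEnd : (G : Graph) → Fin (nE G) → Fin (nV G) → Set
IsEnd G e v = proj₁ (ends G e) ≡ v ⊎ proj₂ (ends G e) ≡ v

ESet : Graph → Set
ESet G = Fin (nE G) → Bool

Sub : (G : Graph) → ESet G → ESet G → Set
Sub G S T = ∀ (e : Fin (nE G)) → S e ≡ true → T e ≡ true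

data Reach (G : Graph) (VP : Fin (nV G) → Set) (EP : Fin (nE G) → Set)
     : Fin (nV G) → Fin (nV G) → Set where
  here : ∀ {u} → VP u → Reach G VP EP u u
  step : ∀ {u w v} (e : Fin (nE G)) → EP e → VP u →
         Joins (ends G e) u w → Reach G VP EP w v → Reach G VP EP u v

ConnectedOn : (G : Graph) → (Fin (nV G) → Set) → (Fin (nE G) → Set) → Set
ConnectedOn G VP EP =
  (∃ λ v → VP v) × (∀ u v → VP u → VP v → Reach G VP EP u v)

ConnectedGraph : Graph → Set
ConnectedGraph G = ConnectedOn G (λ _ → ⊤) (λ _ → ⊤)

record Subgraph (G : Graph) : Set where
  field
    vs : Fin (nV G) → Bool
    es : ESet G
    closed : ∀ e → es e ≡ true →
             (vs (proj₁ (ends G e)) ≡ true) × (vs (proj₂ (ends G e)) ≡ true)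
open Subgraph public

SameSubgraph : {G : Graph} → Subgraph G → Subgraph G → Set
SameSubgraph B B' = (∀ v → vs B v ≡ vs B' v) × (∀ e → es B e ≡ es B' e)

SubgraphLE : {G : Graph} → Subgraph G → Subgraph G → Set
SubgraphLE {G} B B' = (∀ v → vs B v ≡ true → vs B' v ≡ true) × Sub G (es B) (es B')

ConnectedSub : {G : Graph} → Subgraph G → Set
ConnectedSub {G} B = ConnectedOn G (λ v → vs B v ≡ true) (λ e → es B e ≡ true)

EdgeVerts : (G : Graph) → ESet G → Fin (nV G) → Set
EdgeVerts G E1 v = ∃ λ e → E1 e ≡ true × IsEnd G e v

-- A separation (Bondy–Murty): a decomposition of B into two edge-disjoint
-- nonempty connected subgraphs G[E1], G[E2] whose union is B and which
-- have exactly one vertex in common (that vertex is a cut vertex).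
Separation : {G : Graph} → Subgraph G → Set
Separation {G} B = Σ (ESet G) λ E1 → Σ (ESet G) λ E2 →
    (∀ e → es B e ≡ true → (E1 e ≡ true × E2 e ≡ false) ⊎ (E1 e ≡ false × E2 e ≡ true))
  × Sub G E1 (es B) × Sub G E2 (es B)
  × (∃ λ e → E1 e ≡ true) × (∃ λ e → E2 e ≡ true)
  × ConnectedOn G (EdgeVerts G E1) (λ e → E1 e ≡ true)
  × ConnectedOn G (EdgeVerts G E2) (λ e → E2 e ≡ true)
  × (∀ v → vs B v ≡ true → EdgeVerts G E1 v ⊎ EdgeVerts G E2 v)
  × (Σ (Fin (nV G)) λ x → EdgeVerts G E1 x × EdgeVerts G E2 x ×
       (∀ y → EdgeVerts G E1 y → EdgeVerts G E2 y → y ≡ x))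

Nonseparable : {G : Graph} → Subgraph G → Set
Nonseparable B = ConnectedSub B × ¬ Separation B

IsBlock : (G : Graph) → Subgraph G → Set
IsBlock G B = Nonseparable B ×
  (∀ (B' : Subgraph G) → SubgraphLE B B' → Nonseparable B' → SubgraphLE B' B)

record Iso (K L : Graph) : Set where
  field
    fV : Fin (nV K) → Fin (nV L)
    gV : Fin (nV L) → Fin (nV K)
    fE : Fin (nE K) → Fin (nE L)
    gE : Fin (nE L) → Fin (nE K)
    gfV : ∀ v → gV (fV v) ≡ v
    fgV : ∀ v → fV (gV v) ≡ v
    gfE : ∀ e → gE (fE e) ≡ e
    fgE : ∀ e → fE (gE e) ≡ e
    ends-pres : ∀ e → Joins (ends L (fE e)) (fV (proj₁ (ends K e))) (fV (proj₂ (ends K e)))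

record Realizes (G : Graph) (B : Subgraph G) (K : Graph) : Set where
  field
    ιV : Fin (nV K) → Fin (nV G)
    ιE : Fin (nE K) → Fin (nE G)
    ιV-inj : ∀ a b → ιV a ≡ ιV b → a ≡ b
    ιE-inj : ∀ a b → ιE a ≡ ιE b → a ≡ b
    ιV-in  : ∀ a → vs B (ιV a) ≡ true
    ιE-in  : ∀ a → es B (ιE a) ≡ true
    ιV-onto : ∀ v → vs B v ≡ true → ∃ λ a → ιV a ≡ v
    ιE-onto : ∀ e → es B e ≡ true → ∃ λ a → ιE a ≡ e
    ends-ok : ∀ a → Joins (ends G (ιE a)) (ιV (proj₁ (ends K a))) (ιV (proj₂ (ends K a)))

-- K is (isomorphic to) H_C : delete all edges outside C ∪ H, contract the
-- edges of C.  Vertices of K = classes of vertices of G joined by C-edges,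
-- edges of K = the edges of H.
record RealizesContraction (G : Graph) (H C : ESet G) (K : Graph) : Set where
  field
    π : Fin (nV G) → Fin (nV K)
    π-onto : ∀ a → ∃ λ v → π v ≡ a
    π-ker₁ : ∀ u v → π u ≡ π v → Reach G (λ _ → ⊤) (λ e → C e ≡ true) u v
    π-ker₂ : ∀ u v → Reach G (λ _ → ⊤) (λ e → C e ≡ true) u v → π u ≡ π v
    ε : Fin (nE K) → Fin (nE G)
    ε-inj : ∀ a b → ε a ≡ ε b → a ≡ b
    ε-in : ∀ a → H (ε a) ≡ true
    ε-onto : ∀ e → H e ≡ true → ∃ λ a → ε a ≡ e
    ends-ok : ∀ a → Joins (ends K a) (π (proj₁ (ends G (ε a)))) (π (proj₂ (ends G (ε a))))

record BlockDecomposition (G : Graph) (r : ℕ) : Set where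
  field
    block    : Fin r → Subgraph G
    isBlock  : ∀ i → IsBlock G (block i)
    distinct : ∀ i j → SameSubgraph (block i) (block j) → i ≡ j
    complete : ∀ (B : Subgraph G) → IsBlock G B → ∃ λ i → SameSubgraph B (block i)
    graphOf  : Fin r → Graph
    realizes : ∀ i → Realizes G (block i) (graphOf i)
open BlockDecomposition public

record IsBlockInvariant {c ℓ} (A : Set c) (_≈_ : A → A → Set ℓ)
                        (ψ : Graph → A) : Set (c ⊔ ℓ) where
  field
    iso-invariant : ∀ K L → ConnectedGraph K → ConnectedGraph L → Iso K L → ψ K ≈ ψ L
    combine : ∀ (n : ℕ) → 1 ≤ n → Σ ((Fin n → A) → A) λ f →
        (∀ (σ : Permutation′ n) (xs : Fin n → A) → f (λ i → xs (σ ⟨$⟩ʳ i)) ≈ f xs)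
      × (∀ (xs ys : Fin n → A) → (∀ i → xs i ≈ ys i) → f xs ≈ f ys)
      × (∀ (G : Graph) → ConnectedGraph G → (d : BlockDecomposition G n) →
           ψ G ≈ f (λ i → ψ (graphOf d i)))

-- a circuit of length (suc len): distinct vertices vtx 0,…,vtx len,
-- vtx (suc len) = vtx 0, distinct edges, edge i joining vtx i and vtx (i+1)
record Circuit (G : Graph) : Set where
  field
    len : ℕ
    vtx : Fin (nsuc (nsuc len)) → Fin (nV G)
    edg : Fin (nsuc len) → Fin (nE G)
    closes  : vtx (fromℕ (nsuc len)) ≡ vtx zero
    vtx-inj : ∀ i j → vtx (inject₁ i) ≡ vtx (inject₁ j) → i ≡ j
    edg-inj : ∀ i j → edg i ≡ edg j → i ≡ j
    joins   : ∀ i → Joins (ends G (edg i)) (vtx (inject₁ i)) (vtx (suc i))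
open Circuit public

Disconnects : (G : Graph) → ESet G → Set
Disconnects G S = ¬ ConnectedOn G (λ _ → ⊤) (λ e → S e ≡ false)

IsCocycle : (G : Graph) → ESet G → Set
IsCocycle G S = Disconnects G S × (∀ T → Sub G T S → Disconnects G T → Sub G S T)

Del : {G : Graph} → ESet G → ESet G → ESet G
Del H C e = not (C e) ∧ not (H e)

IsContracting : (G : Graph) → ESet G → ESet G → Set
IsContracting G H C =
    (∀ e → C e ≡ true → H e ≡ false)
  × ¬ (Σ (Circuit G) λ γ → ∀ i → C (edg γ i) ≡ true)
  × ¬ (Σ (ESet G) λ S → IsCocycle G S × Sub G S (Del {G} H C))

ProperLabeling : (G : Graph) → ESet G → (Fin (nE G) → ℕ) → Set
ProperLabeling G H φ =
    (∀ e → H e ≡ true → φ e ≡ 0)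
  × (∀ e → H e ≡ false → 0 < φ e)
  × (∀ e f → H e ≡ false → H f ≡ false → φ e ≡ φ f → e ≡ f)

IntActive : (G : Graph) → ESet G → (Fin (nE G) → ℕ) → ESet G → Fin (nE G) → Set
IntActive G H φ C e = Σ (ESet G) λ S → IsCocycle G S
  × (∀ g → S g ≡ true → Del {G} H C g ≡ true ⊎ g ≡ e)
  × S e ≡ true
  × (∀ g → S g ≡ true → φ e ≤ φ g)

ExtActive : (G : Graph) → (Fin (nE G) → ℕ) → ESet G → Fin (nE G) → Set
ExtActive G φ C f = Σ (Circuit G) λ γ →
    (∀ i → C (edg γ i) ≡ true ⊎ edg γ i ≡ f)
  × (∃ λ i → edg γ i ≡ f)
  × (∀ i → φ f ≤ φ (edg γ i))

data Status : Set where
  intAct intInact extAct extInact : Status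

StatusOK : (G : Graph) → ESet G → (Fin (nE G) → ℕ) → ESet G → Fin (nE G) → Status → Set
StatusOK G H φ C e intAct   = C e ≡ true × IntActive G H φ C e
StatusOK G H φ C e intInact = C e ≡ true × ¬ IntActive G H φ C e
StatusOK G H φ C e extAct   = Del {G} H C e ≡ true × ExtActive G φ C e
StatusOK G H φ C e extInact = Del {G} H C e ≡ true × ¬ ExtActive G φ C e

-- The polynomial ring R[Λ] = R[X_λ, Y_λ, x_λ, y_λ : λ ∈ Λ], constructed as
-- the free commutative R-algebra on the variables: formal expressions
-- modulo the commutative-ring laws and the laws making `con` a ring map.

data Kind : Set where
  kX kx kY ky : Kind

kindOf : Status → Kind
kindOf intAct   = kX
kindOf intInact = kx
kindOf extAct   = kY
kindOf extInact = ky

IsIntegralDomain : ∀ {c ℓ} → CommutativeRing c ℓ → Set (c ⊔ ℓ)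
IsIntegralDomain R = ¬ (1# ≈ 0#) × (∀ a b → (a * b) ≈ 0# → a ≈ 0# ⊎ b ≈ 0#)
  where open CommutativeRing R

module Poly {c ℓ a} (R : CommutativeRing c ℓ) (Λ : Set a) where
  open CommutativeRing R using (_≈_; _+_; _*_; 0#; 1#) renaming (Carrier to A)

  infixl 6 _⊕_
  infixl 7 _⊗_

  data Expr : Set (c ⊔ a) where
    con : A → Expr
    var : Kind → Λ → Expr
    _⊕_ : Expr → Expr → Expr
    _⊗_ : Expr → Expr → Expr
    ⊖_  : Expr → Expr

  infix 4 _≋_
  data _≋_ : Expr → Expr → Set (c ⊔ ℓ ⊔ a) where
    ≋-refl  : ∀ {p} → p ≋ p
    ≋-sym   : ∀ {p q} → p ≋ q → q ≋ p
    ≋-trans : ∀ {p q r} → p ≋ q → q ≋ r → p ≋ r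
    ⊕-cong  : ∀ {p p' q q'} → p ≋ p' → q ≋ q' → p ⊕ q ≋ p' ⊕ q'
    ⊗-cong  : ∀ {p p' q q'} → p ≋ p' → q ≋ q' → p ⊗ q ≋ p' ⊗ q'
    ⊖-cong  : ∀ {p q} → p ≋ q → ⊖ p ≋ ⊖ q
    ⊕-assoc : ∀ p q r → (p ⊕ q) ⊕ r ≋ p ⊕ (q ⊕ r)
    ⊕-comm  : ∀ p q → p ⊕ q ≋ q ⊕ p
    ⊕-idˡ   : ∀ p → con 0# ⊕ p ≋ p
    ⊖-invˡ  : ∀ p → (⊖ p) ⊕ p ≋ con 0#
    ⊗-assoc : ∀ p q r → (p ⊗ q) ⊗ r ≋ p ⊗ (q ⊗ r)
    ⊗-comm  : ∀ p q → p ⊗ q ≋ q ⊗ p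
    ⊗-idˡ   : ∀ p → con 1# ⊗ p ≋ p
    distribˡ : ∀ p q r → p ⊗ (q ⊕ r) ≋ (p ⊗ q) ⊕ (p ⊗ r)
    con-cong : ∀ {x y} → x ≈ y → con x ≋ con y
    con-+   : ∀ x y → con (x + y) ≋ con x ⊕ con y
    con-*   : ∀ x y → con (x * y) ≋ con x ⊗ con y

  _⊝_ : Expr → Expr → Expr
  p ⊝ q = p ⊕ (⊖ q)

  record Ideal (i : Level) : Set (c ⊔ ℓ ⊔ a ⊔ lsuc i) where
    field
      member : Expr → Set i
      member-resp : ∀ {p q} → p ≋ q → member p → member q
      member-0 : member (con 0#)
      member-+ : ∀ {p q} → member p → member q → member (p ⊕ q)
      member-* : ∀ r {p} → member p → member (r ⊗ p)
  open Ideal public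

  ∏ : ∀ {m} → (Fin m → Expr) → Expr
  ∏ {nzero} f = con 1#
  ∏ {nsuc m} f = f zero ⊗ ∏ (λ i → f (suc i))

  ∑ : ∀ {m} → (Fin m → Expr) → Expr
  ∑ {nzero} f = con 0#
  ∑ {nsuc m} f = f zero ⊕ ∑ (λ i → f (suc i))

  weight : (h : Bool) → (h ≡ false → Λ) → Status → Expr
  weight true  col s = con 1#
  weight false col s = var (kindOf s) (col refl)

  record TermData (G : Graph) (H : ESet G) (φ : Fin (nE G) → ℕ) (C : ESet G) : Set where
    field
      status    : Fin (nE G) → Status
      status-ok : ∀ e → H e ≡ false → StatusOK G H φ C e (status e)
      contracted : Graph
      realizes  : RealizesContraction G H C contracted
  open TermData public

  termValue : {G : Graph} {H : ESet G} → ((e : Fin (nE G)) → H e ≡ false → Λ) →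
              (Graph → A) → {φ : Fin (nE G) → ℕ} {C : ESet G} → TermData G H φ C → Expr
  termValue {G} {H} col ψ t =
    ∏ (λ e → weight (H e) (col e) (status t e)) ⊗ con (ψ (contracted t))

  -- an enumeration (without repetition) of all contracting sets together with
  -- the summand data: this determines T_H^ψ(G, φ)
  record TutteData (G : Graph) (H : ESet G) (φ : Fin (nE G) → ℕ) : Set where
    field
      count : ℕ
      cset  : Fin count → ESet G
      cset-contracting : ∀ i → IsContracting G H (cset i)
      cset-distinct : ∀ i j → (∀ e → cset i e ≡ cset j e) → i ≡ j
      cset-complete : ∀ C → IsContracting G H C → ∃ λ i → ∀ e → C e ≡ cset i e
      term : ∀ i → TermData G H φ (cset i)
  open TutteData public

  tutte : {G : Graph} {H : ESet G} → ((e : Fin (nE G)) → H e ≡ false → Λ) →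
          (Graph → A) → {φ : Fin (nE G) → ℕ} → TutteData G H φ → Expr
  tutte col ψ T = ∑ (λ i → termValue col ψ (term T i))

  CondA : ∀ {i} → Ideal i → Set (c ⊔ ℓ ⊔ a ⊔ i)
  CondA I = ∀ (G : Graph) → ConnectedGraph G → (H : ESet G) →
    (col : (e : Fin (nE G)) → H e ≡ false → Λ) →
    (ψ : Graph → A) → IsBlockInvariant A _≈_ ψ →
    (φ φ' : Fin (nE G) → ℕ) → ProperLabeling G H φ → ProperLabeling G H φ' →
    (T : TutteData G H φ) → (T' : TutteData G H φ') →
    member I (tutte col ψ T ⊝ tutte col ψ T')

  det : Expr → Expr → Expr → Expr → Expr
  det p q r s = (p ⊗ s) ⊝ (q ⊗ r)

  CondB : ∀ {i} → Ideal i → Set (a ⊔ i)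
  CondB I = ∀ (l m : Λ) →
      member I (det (var kX l) (var ky l) (var kX m) (var ky m)
                ⊝ det (var kx l) (var kY l) (var kx m) (var kY m))
    × member I (det (var kx l) (var kY l) (var kx m) (var kY m)
                ⊝ det (var kx l) (var ky l) (var kx m) (var ky m))

{-# OPTIONS --safe #-}

-- (b) ⇒ (a).  A contracted edge e is internally active iff it is not spanned by the zero edges, the other
-- contracted edges and the deleted edges of smaller label; a deleted edge is externally active iff it is
-- spanned by the contracted edges of larger label.  Hence, if the regular edges are decided one after the
-- other, the largest label first, the weight of each decision depends only on the earlier ones, and T is
-- given by a recursion along the list of regular edges.  It suffices to exchange two consecutive edges e, f
-- of this list.  In the minor reached so far, the two orders give formally the same result unless e and f
-- are parallel or coparallel.  In these cases contracting e instead of f changes nothing: the contractions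
-- are equal if e and f are parallel, and if they are coparallel, both contractions glue the same two graphs
-- at one vertex, so they have the same blocks.  The two sums then differ by a multiple of a relation in (b).
--
-- (a) ⇒ (b).  Take ψ = 1 and compare the two labelings of two parallel regular edges, once on their own and
-- once with a zero edge parallel to them.

module Submission where

open import Defs
open import Algebra.Bundles using (CommutativeRing)
open import Data.Bool using (true; false; not; _∨_; _∧_; if_then_else_; Bool)
open import Data.Bool.Properties using (not-injective; ¬-not)
open import Data.Empty using (⊥; ⊥-elim)
open import Data.Fin using (Fin; zero; suc; inject₁; fromℕ; toℕ; punchIn; finToFun; funToFin)
open import Data.List using (List; []; _∷_; filter; allFin; tabulate)
open import Data.List.Membership.Propositional using (_∈_; _∉_)
open import Data.List.Membership.Propositional.Properties using (∈-filter⁺; ∈-filter⁻; ∈-allFin)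
open import Data.List.Properties using (filter-accept; filter-reject)
open import Data.List.Relation.Binary.Permutation.Propositional using (_↭_; ↭-sym; ↭-trans; ↭⇒↭ₛ)
open import Data.List.Relation.Binary.Permutation.Propositional.Properties using (∈-resp-↭)
open import Data.List.Relation.Unary.All using (All; []; _∷_)
open import Data.List.Relation.Unary.AllPairs using (AllPairs; []; _∷_)
open import Data.List.Relation.Unary.Any using (here; there)
open import Data.List.Relation.Unary.Sorted.TotalOrder.Properties using (Sorted⇒AllPairs)
open import Data.List.Relation.Unary.Unique.Propositional using (Unique)
open import Data.Nat using (ℕ; zero; suc; _≤_; _<_; _<?_; _≤?_; z≤n; s≤s)
open import Data.Product using (Σ; ∃; _×_; _,_; proj₁; proj₂)
open import Data.Sum using (_⊎_; inj₁; inj₂; [_,_]′; swap)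
open import Data.Unit using (⊤; tt)
open import Function using (_∘_; id)
open import Function.Bundles using (Inverse)
open import Level using (_⊔_)
open import Relation.Binary.Bundles using (Setoid; DecTotalOrder)
open import Relation.Binary.PropositionalEquality using (_≡_; _≢_; refl; sym; trans; cong; subst; subst₂; _≗_; cong₂)
open import Relation.Nullary using (¬_; Dec; yes; no; contradiction)
open import Relation.Nullary.Decidable using (_×-dec_; _⊎-dec_; map′; ¬?; ⌊_⌋; dec-true; dec-false; isYes≗does; _→-dec_)
open import Relation.Unary using (Decidable)
import Algebra.Properties.AbelianGroup as AbelianGroupProperties
import Algebra.Properties.Group as GroupProperties
import Algebra.Properties.Ring as RingProperties
import Algebra.Properties.Semiring.Sum as Sum
import Algebra.Solver.Ring.NaturalCoefficients.Default as NaturalSolver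
import Data.Bool as Bool
import Data.Fin.Properties as Fin
import Data.Fin.Subset as Subset
import Data.Fin.Subset.Properties as Subset
import Data.List.Relation.Binary.Permutation.Propositional as Perm
import Data.List.Relation.Binary.Permutation.Setoid.Properties as PermSetoid
import Data.List.Relation.Unary.All as All
import Data.List.Relation.Unary.Unique.Propositional.Properties as Unique
import Data.List.Sort as Sort
import Data.Nat as ℕ
import Data.Nat.Properties as ℕ
import Data.Vec as Vec
import Data.Vec.Properties as Vec
import Relation.Binary.Construct.Flip.EqAndOrd as Flip
import Relation.Binary.Construct.On as On
import Relation.Binary.PropositionalEquality as ≡
import Relation.Binary.Reasoning.Setoid as SetoidReasoning

-- `combine` speaks only of graphs given with a block decomposition, so in the coparallel case it
-- does not suffice to see that both contractions consist of the same pieces. A decomposition of one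
-- contraction must be built, by a search over all edge sets with decidable nonseparability, and
-- carried over to the other with the very same graphs as blocks. For this both contractions are
-- written as quotients of the vertex set of `G` with one common set of edges: a nonseparable edge
-- set stays on one side of the glue vertex, and on one side the two quotients identify the same
-- vertices. In the recursion, a parallel or coparallel pair must stay comparable through all later
-- decisions. Two relations between sets of contracted edges survive these: equal spans (`Z-span`),
-- and a common part with one further edge each that nothing else available spans (`Z-twin`). All
-- activity tests are put in the form "an edge is spanned by a set", which is decidable and to which
-- matroid exchange applies.

-- Walks inside an edge set, and the span of an edge set

module Connectivity (G : Graph) where

  V E : Set
  V = Fin (nV G)
  E = Fin (nE G)

  src tgt : E → V
  src e = proj₁ (ends G e)
  tgt e = proj₂ (ends G e)

  Conn : (E → Set) → V → V → Set
  Conn P = Reach G (λ _ → ⊤) P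

  Spanned : (E → Set) → E → Set
  Spanned P e = Conn P (src e) (tgt e)

  Connected : (E → Set) → Set
  Connected P = ∀ u v → Conn P u v

  private variable
    P Q P′ : E → Set
    u v w : V
    e f : E

  conn-refl : Conn P u u
  conn-refl = here tt

  conn-trans : Conn P u v → Conn P v w → Conn P u w
  conn-trans (here _) q = q
  conn-trans (step e p t j r) q = step e p t j (conn-trans r q)

  edge⇒spanned : P e → Spanned P e
  edge⇒spanned {e = e} p = step e p tt (inj₁ (refl , refl)) conn-refl

  edge⇒spannedʳ : P e → Conn P (tgt e) (src e)
  edge⇒spannedʳ {e = e} p = step e p tt (inj₂ (refl , refl)) conn-refl

  conn-sym : Conn P u v → Conn P v u
  conn-sym (here _) = here tt
  conn-sym (step e p t (inj₁ (refl , refl)) r) = conn-trans (conn-sym r) (edge⇒spannedʳ p)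
  conn-sym (step e p t (inj₂ (refl , refl)) r) = conn-trans (conn-sym r) (edge⇒spanned p)

  conn-bind : (∀ g → P g → Spanned Q g) → Conn P u v → Conn Q u v
  conn-bind h (here _) = here tt
  conn-bind h (step e p t (inj₁ (refl , refl)) r) = conn-trans (h e p) (conn-bind h r)
  conn-bind h (step e p t (inj₂ (refl , refl)) r) = conn-trans (conn-sym (h e p)) (conn-bind h r)

  conn-mono : (∀ g → P g → Q g) → Conn P u v → Conn Q u v
  conn-mono h = conn-bind (λ g p → edge⇒spanned (h g p))

  -- A walk can be shortened until it uses `e` at most once: whatever lies between two passages
  -- through `e` is dropped. The three outcomes are no passage and the two directions of a single
  -- one.
  conn-split : (∀ g → Q g → g ≡ e ⊎ P g) → Conn Q u v →
    Conn P u v ⊎ (Conn P u (src e) × Conn P (tgt e) v) ⊎ (Conn P u (tgt e) × Conn P (src e) v)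
  conn-split h (here _) = inj₁ (here tt)
  conn-split h (step g q t j r) with h g q | conn-split h r
  ... | inj₂ p | inj₁ a = inj₁ (step g p tt j a)
  ... | inj₂ p | inj₂ (inj₁ (a , b)) = inj₂ (inj₁ (step g p tt j a , b))
  ... | inj₂ p | inj₂ (inj₂ (a , b)) = inj₂ (inj₂ (step g p tt j a , b))
  conn-split h (step g q t (inj₁ (refl , refl)) r) | inj₁ refl | inj₁ a = inj₂ (inj₁ (conn-refl , a))
  conn-split h (step g q t (inj₁ (refl , refl)) r) | inj₁ refl | inj₂ (inj₁ (a , b)) = inj₂ (inj₁ (conn-refl , b))
  conn-split h (step g q t (inj₁ (refl , refl)) r) | inj₁ refl | inj₂ (inj₂ (a , b)) = inj₁ b
  conn-split h (step g q t (inj₂ (refl , refl)) r) | inj₁ refl | inj₁ a = inj₂ (inj₂ (conn-refl , a))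
  conn-split h (step g q t (inj₂ (refl , refl)) r) | inj₁ refl | inj₂ (inj₁ (a , b)) = inj₁ b
  conn-split h (step g q t (inj₂ (refl , refl)) r) | inj₁ refl | inj₂ (inj₂ (a , b)) = inj₂ (inj₂ (conn-refl , b))

  -- Matroid exchange, for P′ ⊆ P ∪ {e} and P ∪ {f} ⊆ Q.
  exchange : (∀ g → P′ g → g ≡ e ⊎ P g) → (∀ g → P g → Q g) → Q f →
    Spanned P′ f → Spanned P f ⊎ Spanned Q e
  exchange {f = f} h k qf r with conn-split h r
  ... | inj₁ a = inj₁ a
  ... | inj₂ (inj₁ (a , b)) =
    inj₂ (conn-trans (conn-sym (conn-mono k a)) (conn-trans (edge⇒spanned qf) (conn-sym (conn-mono k b))))
  ... | inj₂ (inj₂ (a , b)) =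
    inj₂ (conn-trans (conn-mono k b) (conn-trans (edge⇒spannedʳ qf) (conn-mono k a)))

  -- By `conn-split`, a question about `e ∷ L` reduces to five questions about `L`.
  connList? : (L : List E) → ∀ u v → Dec (Conn (_∈ L) u v)
  connList? [] u v = map′ (λ { refl → conn-refl }) (λ { (here _) → refl ; (step _ () _ _ _) }) (u Fin.≟ v)
  connList? (e ∷ L) u v =
    map′ [ up , [ (λ (a , b) → conn-trans (up a) (conn-trans (edge⇒spanned (here refl)) (up b)))
                , (λ (a , b) → conn-trans (up a) (conn-trans (edge⇒spannedʳ (here refl)) (up b))) ]′ ]′
         (conn-split λ { g (here p) → inj₁ p ; g (there p) → inj₂ p })
      (connList? L u v ⊎-dec
        ((connList? L u (src e) ×-dec connList? L (tgt e) v) ⊎-dec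
         (connList? L u (tgt e) ×-dec connList? L (src e) v)))
    where
    up : ∀ {u v} → Conn (_∈ L) u v → Conn (_∈ (e ∷ L)) u v
    up = conn-mono (λ _ → there)

  conn? : Decidable P → ∀ u v → Dec (Conn P u v)
  conn? P? u v = map′ (conn-mono λ g m → proj₂ (∈-filter⁻ P? {xs = allFin _} m)) (conn-mono λ g p → ∈-filter⁺ P? (∈-allFin g) p)
    (connList? (filter P? (allFin _)) u v)

  spanned? : Decidable P → Decidable (Spanned P)
  spanned? P? e = conn? P? (src e) (tgt e)

dec-true⁻ : ∀ {a} {A : Set a} (a? : Dec A) → ⌊ a? ⌋ ≡ true → A
dec-true⁻ (yes p) _ = p

dec-false⁻ : ∀ {a} {A : Set a} (a? : Dec A) → ⌊ a? ⌋ ≡ false → ¬ A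
dec-false⁻ (no p) _ = p

true≢false : ∀ {b} → b ≡ true → b ≡ false → ⊥
true≢false refl ()

-- Circuits, cocycles and activities expressed by spans

module CircuitsCocycles (G : Graph) where
  open Connectivity G

  private variable
    P Q : E → Set
    u v : V
    e f : E
    n : ℕ

  JoinsAlong : (Fin (suc n) → V) → (Fin n → E) → Set
  JoinsAlong vt ed = ∀ i → Joins (ends G (ed i)) (vt (inject₁ i)) (vt (suc i))

  walk : (vt : Fin (suc n) → V) (ed : Fin n → E) → JoinsAlong vt ed →
    (∀ j → Q (ed j)) → Conn Q (vt zero) (vt (fromℕ n))
  walk {zero} vt ed js q = conn-refl
  walk {suc n} vt ed js q = step (ed zero) (q zero) tt (js zero) (walk (vt ∘ suc) (ed ∘ suc) (js ∘ suc) (q ∘ suc))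

  walk-before : (vt : Fin (suc n) → V) (ed : Fin n → E) → JoinsAlong vt ed →
    ∀ i → (∀ j → j ≢ i → Q (ed j)) → Conn Q (vt zero) (vt (inject₁ i))
  walk-before vt ed js zero q = conn-refl
  walk-before vt ed js (suc i) q = step (ed zero) (q zero λ ()) tt (js zero)
    (walk-before (vt ∘ suc) (ed ∘ suc) (js ∘ suc) i (λ j j≢i → q (suc j) (j≢i ∘ Fin.suc-injective)))

  walk-after : (vt : Fin (suc n) → V) (ed : Fin n → E) → JoinsAlong vt ed →
    ∀ i → (∀ j → j ≢ i → Q (ed j)) → Conn Q (vt (suc i)) (vt (fromℕ n))
  walk-after {suc n} vt ed js zero q = walk (vt ∘ suc) (ed ∘ suc) (js ∘ suc) (λ j → q (suc j) λ ())
  walk-after {suc n} vt ed js (suc i) q =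
    walk-after (vt ∘ suc) (ed ∘ suc) (js ∘ suc) i (λ j j≢i → q (suc j) (j≢i ∘ Fin.suc-injective))

  -- From the far end of edge `i` the circuit runs on to its closing vertex and from the start back
  -- to `i`, without using `i`.
  circuit⇒spanned : (γ : Circuit G) → ∀ i → (∀ j → j ≢ i → Q (edg γ j)) → Spanned Q (edg γ i)
  circuit⇒spanned {Q = Q} γ i q = go (joins γ i)
    where
    around : Conn Q (vtx γ (suc i)) (vtx γ (inject₁ i))
    around = conn-trans (walk-after (vtx γ) (edg γ) (joins γ) i q)
      (subst (λ z → Conn Q z (vtx γ (inject₁ i))) (sym (closes γ)) (walk-before (vtx γ) (edg γ) (joins γ) i q))
    go : Joins (ends G (edg γ i)) (vtx γ (inject₁ i)) (vtx γ (suc i)) → Spanned Q (edg γ i)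
    go (inj₁ (p , q)) = subst₂ (Conn Q) (sym p) (sym q) (conn-sym around)
    go (inj₂ (p , q)) = subst₂ (Conn Q) (sym p) (sym q) around

  record SimplePath (P : E → Set) (n : ℕ) (u v : V) : Set where
    field
      vt : Fin (suc n) → V
      ed : Fin n → E
      first : vt zero ≡ u
      last : vt (fromℕ n) ≡ v
      vt-inj : ∀ i j → vt i ≡ vt j → i ≡ j
      js : JoinsAlong vt ed
      inP : ∀ i → P (ed i)
  open SimplePath

  suffix : (p : SimplePath P n u v) → (k : Fin (suc n)) → ∃ λ m → SimplePath P m (vt p k) v
  suffix p zero = _ , record { vt = vt p ; ed = ed p ; first = refl ; last = last p ; vt-inj = vt-inj p ; js = js p ; inP = inP p }
  suffix {n = suc n} p (suc k) = suffix (record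
    { vt = vt p ∘ suc ; ed = ed p ∘ suc ; first = refl ; last = last p
    ; vt-inj = λ i j eq → Fin.suc-injective (vt-inj p _ _ eq) ; js = js p ∘ suc ; inP = inP p ∘ suc }) k

  -- If the new first vertex already lies on the path obtained for the rest of the walk, the suffix
  -- from that occurrence is taken instead.
  simplePath : Conn P u v → ∃ λ n → SimplePath P n u v
  simplePath {u = u} (here _) = 0 , record
    { vt = λ _ → u ; ed = λ () ; first = refl ; last = refl ; vt-inj = λ { zero zero _ → refl } ; js = λ () ; inP = λ () }
  simplePath {P = P} {u = u} {v = v} (step {w = w} e pe _ j r) with simplePath r
  ... | n , p with Fin.any? (λ k → vt p k Fin.≟ u)
  ... | yes (k , refl) = suffix p k
  ... | no fresh = suc n , record
    { vt = λ { zero → u ; (suc k) → vt p k }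
    ; ed = λ { zero → e ; (suc k) → ed p k }
    ; first = refl
    ; last = last p
    ; vt-inj = λ { zero zero _ → refl ; zero (suc k) eq → ⊥-elim (fresh (k , sym eq))
                 ; (suc k) zero eq → ⊥-elim (fresh (k , eq)) ; (suc k) (suc l) eq → cong suc (vt-inj p k l eq) }
    ; js = λ { zero → subst (Joins (ends G e) u) (sym (first p)) j ; (suc k) → js p k }
    ; inP = λ { zero → pe ; (suc k) → inP p k }
    }

  inject₁≢fromℕ : (i : Fin n) → inject₁ i ≢ fromℕ n
  inject₁≢fromℕ {suc n} zero ()
  inject₁≢fromℕ {suc n} (suc i) eq = inject₁≢fromℕ i (Fin.suc-injective eq)

  inject₁-suc-asym : (i j : Fin n) → inject₁ i ≡ suc j → suc i ≡ inject₁ j → ⊥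
  inject₁-suc-asym i j p q = ℕ.<-asym
    (ℕ.≤-reflexive (trans (sym (cong toℕ p)) (Fin.toℕ-inject₁ i)))
    (ℕ.≤-reflexive (trans (cong toℕ q) (Fin.toℕ-inject₁ j)))

  -- An edge occurring at `i` and `j` has the same two ends at both places. In equal direction this
  -- gives `i ≡ j` by distinctness of the vertices; in opposite direction each position would be the
  -- successor of the other.
  ed-inj : (p : SimplePath P n u v) → ∀ i j → ed p i ≡ ed p j → i ≡ j
  ed-inj p i j eq = go (js p i) (subst (λ e → Joins (ends G e) (vt p (inject₁ j)) (vt p (suc j))) (sym eq) (js p j))
    where
    go : Joins (ends G (ed p i)) (vt p (inject₁ i)) (vt p (suc i)) →
         Joins (ends G (ed p i)) (vt p (inject₁ j)) (vt p (suc j)) → i ≡ j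
    go (inj₁ (a , b)) (inj₁ (c , d)) = Fin.suc-injective (vt-inj p _ _ (trans (sym b) d))
    go (inj₂ (a , b)) (inj₂ (c , d)) = Fin.suc-injective (vt-inj p _ _ (trans (sym a) c))
    go (inj₁ (a , b)) (inj₂ (c , d)) =
      ⊥-elim (inject₁-suc-asym i j (vt-inj p _ _ (trans (sym a) c)) (vt-inj p _ _ (trans (sym b) d)))
    go (inj₂ (a , b)) (inj₁ (c , d)) =
      ⊥-elim (inject₁-suc-asym i j (vt-inj p _ _ (trans (sym b) d)) (vt-inj p _ _ (trans (sym a) c)))

  -- `f` is put in front of a simple path from its target back to its source. For a loop that path
  -- is trivial and the circuit has length one; `¬ P f` keeps `f` different from the edges of the
  -- path.
  spanned⇒circuit : Spanned P f → ¬ P f →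
    Σ (Circuit G) λ γ → (∀ i → P (edg γ i) ⊎ edg γ i ≡ f) × ∃ λ i → edg γ i ≡ f
  spanned⇒circuit {P = P} {f = f} r ¬pf with simplePath (conn-sym r)
  ... | n , p = record
    { len = n
    ; vtx = λ { zero → src f ; (suc k) → vt p k }
    ; edg = λ { zero → f ; (suc k) → ed p k }
    ; closes = last p
    ; vtx-inj = λ { zero zero _ → refl
                  ; zero (suc k) eq → ⊥-elim (inject₁≢fromℕ k (vt-inj p _ _ (trans (sym eq) (sym (last p)))))
                  ; (suc k) zero eq → ⊥-elim (inject₁≢fromℕ k (vt-inj p _ _ (trans eq (sym (last p)))))
                  ; (suc k) (suc l) eq → cong suc (Fin.inject₁-injective (vt-inj p _ _ eq)) }
    ; edg-inj = λ { zero zero _ → refl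
                  ; zero (suc k) eq → ⊥-elim (¬pf (subst P (sym eq) (inP p k)))
                  ; (suc k) zero eq → ⊥-elim (¬pf (subst P eq (inP p k)))
                  ; (suc k) (suc l) eq → cong suc (ed-inj p k l eq) }
    ; joins = λ { zero → inj₁ (refl , sym (first p)) ; (suc k) → js p k }
    } , (λ { zero → inj₂ refl ; (suc k) → inj₁ (inP p k) }) , zero , refl

  -- Otherwise `S` without `e` would still disconnect the graph, against minimality.
  cocycle⇒¬spanned : ∀ {S} → IsCocycle G S → S e ≡ true → ¬ Spanned (λ g → S g ≡ false) e
  cocycle⇒¬spanned {e = e} {S} (disc , minimal) Se r =
    true≢false (minimal T (λ g → proj₁ ∘ T⊆) T-disc e Se) T-misses-e
    where
    T : ESet G
    T g = if ⌊ g Fin.≟ e ⌋ then false else S g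
    T⊆ : ∀ {g} → T g ≡ true → S g ≡ true × g ≢ e
    T⊆ {g} p with g Fin.≟ e
    ... | no q = p , q
    T-misses-e : T e ≡ false
    T-misses-e with e Fin.≟ e
    ... | yes _ = refl
    ... | no q = contradiction refl q
    T-cover : ∀ g → T g ≡ false → Spanned (λ g → S g ≡ false) g
    T-cover g p with g Fin.≟ e
    ... | yes refl = r
    ... | no _ = edge⇒spanned p
    T-disc : Disconnects G T
    T-disc (ne , c) = disc (ne , λ u v _ _ → conn-bind T-cover (c u v tt tt))

  private
    _∪₁_ : ESet G → E → E → Set
    (F ∪₁ g) h = h ≡ g ⊎ F h ≡ true

    insert : ESet G → E → ESet G
    insert F g h = ⌊ h Fin.≟ g ⌋ ∨ F h

    insert⁺ : ∀ F {g h} → (F ∪₁ g) h → insert F g h ≡ true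
    insert⁺ F {g} {h} p with h Fin.≟ g
    ... | yes _ = refl
    insert⁺ F (inj₁ p) | no q = contradiction p q
    insert⁺ F (inj₂ p) | no _ = p

    insert⁻ : ∀ F {g h} → insert F g h ≡ true → (F ∪₁ g) h
    insert⁻ F {g} {h} p with h Fin.≟ g
    ... | yes q = inj₁ q
    ... | no _ = inj₂ p

    ∪₁-dec : ∀ F g → Decidable (F ∪₁ g)
    ∪₁-dec F g h = (h Fin.≟ g) ⊎-dec (F h Bool.≟ true)

    -- Greedy choice: each edge of `L` in turn is added unless it would connect `u` to `v`. A
    -- rejected edge still connects them when added to the larger final set.
    saturate : ∀ (L : List E) F → ¬ Conn (λ g → F g ≡ true) u v →
      Σ (ESet G) λ F′ → Sub G F F′ × ¬ Conn (λ g → F′ g ≡ true) u v ×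
        (∀ g → g ∈ L → F′ g ≡ true ⊎ Conn (F′ ∪₁ g) u v)
    saturate [] F ¬c = F , (λ _ p → p) , ¬c , λ _ ()
    saturate {u} {v} (g ∷ L) F ¬c with conn? (∪₁-dec F g) u v
    ... | yes c with saturate L F ¬c
    ...   | F′ , sub , ¬c′ , sat = F′ , sub , ¬c′ , λ
      { h (here refl) → inj₂ (conn-mono (λ { k (inj₁ p) → inj₁ p ; k (inj₂ p) → inj₂ (sub k p) }) c)
      ; h (there m) → sat h m }
    saturate {u} {v} (g ∷ L) F ¬c | no ¬c⁺ with saturate L (insert F g) (λ c → ¬c⁺ (conn-mono (λ _ → insert⁻ F) c))
    ... | F′ , sub , ¬c′ , sat = F′ , (λ h p → sub h (insert⁺ F (inj₂ p))) , ¬c′ , λ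
      { h (here refl) → inj₁ (sub g (insert⁺ F (inj₁ refl)))
      ; h (there m) → sat h m }

  -- The complement of a maximal edge set that does not connect u to v is a cocycle.
  disconnected⇒cocycle : ConnectedGraph G → ∀ F → ¬ Conn (λ g → F g ≡ true) u v →
    Σ (ESet G) λ S → IsCocycle G S × (∀ g → S g ≡ true → F g ≡ false) × ¬ Conn (λ g → S g ≡ false) u v
  disconnected⇒cocycle {u} {v} (ne , conG) F ¬c with saturate (allFin _) F ¬c
  ... | F′ , sub , ¬c′ , sat = (not ∘ F′) , (disc , minimal) , disj , ¬c-S
    where
    from-S : ∀ {g} → not (F′ g) ≡ false → F′ g ≡ true
    from-S = not-injective
    ¬c-S : ¬ Conn (λ g → not (F′ g) ≡ false) u v
    ¬c-S c = ¬c′ (conn-mono (λ _ → from-S) c)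
    disc : Disconnects G (not ∘ F′)
    disc (_ , c) = ¬c-S (c u v tt tt)
    disj : ∀ g → not (F′ g) ≡ true → F g ≡ false
    disj g p with F g in eq
    ... | false = refl
    ... | true = ⊥-elim (true≢false (sub g eq) (not-injective p))
    -- Every edge outside `F′` joins the component of `u` to that of `v`, so by connectedness of `G`
    -- these are the only components of `F′`, and any single omitted edge reconnects the graph.
    Near : V → Set
    Near w = Conn (λ g → F′ g ≡ true) w u ⊎ Conn (λ g → F′ g ≡ true) w v
    near-edge : ∀ g → (Near (src g) × Near (tgt g)) ⊎ F′ g ≡ true
    near-edge g with sat g (∈-allFin g)
    ... | inj₁ p = inj₂ p
    ... | inj₂ c with conn-split (λ _ p → p) c
    ...   | inj₁ c′ = contradiction c′ ¬c′
    ...   | inj₂ (inj₁ (a , b)) = inj₁ (inj₁ (conn-sym a) , inj₂ b)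
    ...   | inj₂ (inj₂ (a , b)) = inj₁ (inj₂ b , inj₁ (conn-sym a))
    near-back : ∀ {w x} → Conn (λ g → F′ g ≡ true) w x → Near x → Near w
    near-back c = [ inj₁ ∘ conn-trans c , inj₂ ∘ conn-trans c ]′
    near : ∀ {w} → Conn (λ _ → ⊤) w u → Near w
    near (here _) = inj₁ conn-refl
    near (step g _ _ j r) with near-edge g | near r
    near (step g _ _ (inj₁ (refl , refl)) r) | inj₁ (a , b) | _ = a
    near (step g _ _ (inj₂ (refl , refl)) r) | inj₁ (a , b) | _ = b
    ... | inj₂ p | n = near-back (step g p tt j conn-refl) n
    minimal : ∀ T → Sub G T (not ∘ F′) → Disconnects G T → Sub G (not ∘ F′) T
    minimal T T⊆ T-disc g Sg with T g in Tg
    ... | true = refl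
    ... | false = ⊥-elim (T-disc (ne , λ x y _ _ → conn-trans (to-u x) (conn-sym (to-u y))))
      where
      keep : ∀ h → F′ h ≡ true → T h ≡ false
      keep h p with T h in Th
      ... | false = refl
      ... | true = ⊥-elim (true≢false p (not-injective (T⊆ h Th)))
      u~v : Conn (λ h → T h ≡ false) u v
      u~v with sat g (∈-allFin g)
      ... | inj₁ p = ⊥-elim (true≢false p (not-injective Sg))
      ... | inj₂ c = conn-mono (λ { h (inj₁ refl) → Tg ; h (inj₂ p) → keep h p }) c
      to-u : ∀ x → Conn (λ h → T h ≡ false) x u
      to-u x with near (conG x u tt tt)
      ... | inj₁ c = conn-mono keep c
      ... | inj₂ c = conn-trans (conn-mono keep c) (conn-sym u~v)

  module _ {H C : ESet G} where

    del⁺ : ∀ {g} → C g ≡ false → H g ≡ false → Del {G} H C g ≡ true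
    del⁺ p q rewrite p | q = refl

    del⁻ : ∀ {g} → Del {G} H C g ≡ true → C g ≡ false × H g ≡ false
    del⁻ {g} p with C g | H g
    ... | false | false = refl , refl

    contracting⇒acyclic : IsContracting G H C → C e ≡ true → ¬ Spanned (λ h → C h ≡ true × h ≢ e) e
    contracting⇒acyclic {e} (_ , ¬circ , _) Ce r with spanned⇒circuit r (λ (_ , q) → q refl)
    ... | γ , inside , _ = ¬circ (γ , λ i → [ proj₁ , (λ { refl → Ce }) ]′ (inside i))

    -- If `C ∪ H` left `u` and `v` apart, the cocycle obtained from `C ∪ H` would lie in the
    -- deleting set. With `contracting⇒acyclic` this gives the two properties of contracting sets on
    -- which the recursion relies.
    contracting⇒connected : ConnectedGraph G → IsContracting G H C → Connected (λ h → C h ≡ true ⊎ H h ≡ true)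
    contracting⇒connected conG (_ , _ , ¬coc) u v
      with conn? (λ h → (C h Bool.≟ true) ⊎-dec (H h Bool.≟ true)) u v
    ... | yes c = c
    ... | no ¬c with disconnected⇒cocycle conG (λ h → C h ∨ H h) (λ c → ¬c (conn-mono (λ _ → split) c))
      where
      split : ∀ {a b} → a ∨ b ≡ true → a ≡ true ⊎ b ≡ true
      split {true} p = inj₁ refl
      split {false} p = inj₂ p
    ...   | S , isC , disj , _ = contradiction (S , isC , λ g Sg → del⁺ (proj₁ (split (disj g Sg))) (proj₂ (split (disj g Sg)))) ¬coc
      where
      split : ∀ {a b} → a ∨ b ≡ false → a ≡ false × b ≡ false
      split {false} p = refl , p

    connected⇒contracting : ConnectedGraph G → (∀ e → C e ≡ true → H e ≡ false) →
      ¬ (Σ (Circuit G) λ γ → ∀ i → C (edg γ i) ≡ true) →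
      Connected (λ h → C h ≡ true ⊎ H h ≡ true) → IsContracting G H C
    connected⇒contracting (ne , _) reg ¬circ con = reg , ¬circ , λ (S , (disc , _) , S⊆) →
      disc (ne , λ u v _ _ → conn-mono (keep S S⊆) (con u v))
      where
      keep : ∀ S → Sub G S (Del {G} H C) → ∀ g → C g ≡ true ⊎ H g ≡ true → S g ≡ false
      keep S S⊆ g p with S g in eq
      ... | false = refl
      keep S S⊆ g (inj₁ p) | true = ⊥-elim (true≢false p (proj₁ (del⁻ (S⊆ g eq))))
      keep S S⊆ g (inj₂ p) | true = ⊥-elim (true≢false p (proj₂ (del⁻ (S⊆ g eq))))

    module _ (φ : E → ℕ) where

      Below : E → E → Set
      Below e h = h ≢ e × (C h ≡ true ⊎ H h ≡ true ⊎ φ h < φ e)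

      below? : ∀ e → Decidable (Below e)
      below? e h = ¬? (h Fin.≟ e) ×-dec ((C h Bool.≟ true) ⊎-dec (H h Bool.≟ true) ⊎-dec (φ h <? φ e))

      Above : E → E → Set
      Above f h = C h ≡ true × φ f ≤ φ h

      -- The witnessing cocycle is disjoint from `Below e`: apart from `e` it consists of deleted
      -- edges whose labels are not smaller than that of `e`.
      intActive⇒¬spanned : IntActive G H φ C e → ¬ Spanned (Below e) e
      intActive⇒¬spanned {e} (S , isC , S⊆ , Se , min) r = cocycle⇒¬spanned isC Se (conn-mono keep r)
        where
        keep : ∀ g → Below e g → S g ≡ false
        keep g (g≢e , p) with S g in eq
        ... | false = refl
        ... | true with S⊆ g eq
        ...   | inj₂ g≡e = contradiction g≡e g≢e
        ...   | inj₁ d with p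
        ...     | inj₁ Cg = ⊥-elim (true≢false Cg (proj₁ (del⁻ d)))
        ...     | inj₂ (inj₁ Hg) = ⊥-elim (true≢false Hg (proj₂ (del⁻ d)))
        ...     | inj₂ (inj₂ lt) = contradiction (min g eq) (ℕ.<⇒≱ lt)

      -- The cocycle is obtained from `Below e`. It contains `e`, since otherwise `e` would connect
      -- its own ends in the complement; being disjoint from `Below e`, it lies in the deleting set
      -- plus `e` and has `e` as smallest edge.
      ¬spanned⇒intActive : ConnectedGraph G → ¬ Spanned (Below e) e → IntActive G H φ C e
      ¬spanned⇒intActive {e} conG ¬r
        with disconnected⇒cocycle conG (λ g → ⌊ below? e g ⌋) (λ c → ¬r (conn-mono (λ g → dec-true⁻ (below? e g)) c))
      ... | S , isC , disj , ¬c = S , isC , S⊆ , Se , min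
        where
        Se : S e ≡ true
        Se with S e in eq
        ... | true = refl
        ... | false = contradiction (edge⇒spanned eq) ¬c
        out : ∀ {g} → S g ≡ true → ¬ Below e g
        out {g} Sg = dec-false⁻ (below? e g) (disj g Sg)
        S⊆ : ∀ g → S g ≡ true → Del {G} H C g ≡ true ⊎ g ≡ e
        S⊆ g Sg with g Fin.≟ e
        ... | yes p = inj₂ p
        ... | no p = inj₁ (del⁺ (¬-not λ q → out Sg (p , inj₁ q)) (¬-not λ q → out Sg (p , inj₂ (inj₁ q))))
        min : ∀ g → S g ≡ true → φ e ≤ φ g
        min g Sg with g Fin.≟ e
        ... | yes refl = ℕ.≤-refl
        ... | no p = ℕ.≮⇒≥ (λ q → out Sg (p , inj₂ (inj₂ q)))

      extActive⇒spanned : ExtActive G φ C f → Spanned (Above f) f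
      extActive⇒spanned {f} (γ , inside , (i , refl) , min) = circuit⇒spanned γ i λ j j≢i →
        [ (λ p → p , min j) , (λ eq → contradiction (edg-inj γ j i eq) j≢i) ]′ (inside j)

      spanned⇒extActive : C f ≡ false → Spanned (Above f) f → ExtActive G φ C f
      spanned⇒extActive Cf r with spanned⇒circuit r (λ (p , _) → true≢false p Cf)
      ... | γ , inside , on = γ , (λ i → [ inj₁ ∘ proj₁ , inj₂ ]′ (inside i)) , on ,
        λ i → [ proj₂ , (λ { refl → ℕ.≤-refl }) ]′ (inside i)

      contracted-status : ConnectedGraph G → C e ≡ true → ∀ {s} → StatusOK G H φ C e s →
        (s ≡ intAct × ¬ Spanned (Below e) e) ⊎ (s ≡ intInact × Spanned (Below e) e)
      contracted-status conG Ce {intAct} (_ , act) = inj₁ (refl , intActive⇒¬spanned act)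
      contracted-status {e} conG Ce {intInact} (_ , ¬act) with spanned? (below? e) e
      ... | yes r = inj₂ (refl , r)
      ... | no ¬r = contradiction (¬spanned⇒intActive conG ¬r) ¬act
      contracted-status conG Ce {extAct} (d , _) = ⊥-elim (true≢false Ce (proj₁ (del⁻ d)))
      contracted-status conG Ce {extInact} (d , _) = ⊥-elim (true≢false Ce (proj₁ (del⁻ d)))

      deleted-status : C f ≡ false → ∀ {s} → StatusOK G H φ C f s →
        (s ≡ extAct × Spanned (Above f) f) ⊎ (s ≡ extInact × ¬ Spanned (Above f) f)
      deleted-status Cf {intAct} (p , _) = ⊥-elim (true≢false p Cf)
      deleted-status Cf {intInact} (p , _) = ⊥-elim (true≢false p Cf)
      deleted-status Cf {extAct} (_ , act) = inj₁ (refl , extActive⇒spanned act)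
      deleted-status Cf {extInact} (_ , ¬act) = inj₂ (refl , ¬act ∘ spanned⇒extActive Cf)

      above? : ∀ f → Decidable (Above f)
      above? f h = (C h Bool.≟ true) ×-dec (φ f ≤? φ h)

      -- For (a) ⇒ (b), where summands have to be exhibited and evaluated. On zero edges the value
      -- is arbitrary, as `status-ok` constrains regular edges only.
      statusOf : E → Status
      statusOf e = if C e
        then (if ⌊ spanned? (below? e) e ⌋ then intInact else intAct)
        else (if ⌊ spanned? (above? e) e ⌋ then extAct else extInact)

      statusOf-ok : ConnectedGraph G → ∀ e → H e ≡ false → StatusOK G H φ C e (statusOf e)
      statusOf-ok conG e He = go (C e) refl (spanned? (below? e) e) (spanned? (above? e) e)
        where
        go : ∀ b → C e ≡ b → (r : Dec (Spanned (Below e) e)) (s : Dec (Spanned (Above e) e)) →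
          StatusOK G H φ C e (if b then (if ⌊ r ⌋ then intInact else intAct) else (if ⌊ s ⌋ then extAct else extInact))
        go true Ce (yes r) _ = Ce , λ act → intActive⇒¬spanned act r
        go true Ce (no ¬r) _ = Ce , ¬spanned⇒intActive conG ¬r
        go false Ce _ (yes s) = del⁺ Ce He , spanned⇒extActive Ce s
        go false Ce _ (no ¬s) = del⁺ Ce He , ¬s ∘ extActive⇒spanned

-- The recursion along the list of regular edges, and its invariance under permutations

module Expansion {q ℓq} (G : Graph) (H : ESet G) (Q : CommutativeRing q ℓq)
  (w : Fin (nE G) → Status → CommutativeRing.Carrier Q) where

  open Connectivity G
  open CircuitsCocycles G using (circuit⇒spanned)
  open CommutativeRing Q
    using (Carrier; _≈_; _+_; _*_; 1#; setoid; +-cong; +-congˡ; +-congʳ; *-congˡ; *-congʳ; commutativeSemiring; +-group)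
    renaming (refl to ≈-refl; sym to ≈-sym; trans to ≈-trans)
  open SetoidReasoning setoid
  open NaturalSolver commutativeSemiring using (solve; _:=_; _:+_; _:*_)

  private variable
    e f g : E
    l l′ X X′ N : List E
    p₁ p₂ p₁′ p₂′ : Carrier

  weights : (E → Status) → List E → Carrier
  weights s [] = 1#
  weights s (e ∷ l) = w e (s e) * weights s l

  weights-↭ : ∀ s → l ↭ l′ → weights s l ≈ weights s l′
  weights-↭ s Perm.refl = ≈-refl
  weights-↭ s (Perm.prep x p) = *-congˡ (weights-↭ s p)
  weights-↭ s (Perm.swap x y p) = ≈-trans (*-congˡ (*-congˡ (weights-↭ s p)))
    (solve 3 (λ a b c → a :* (b :* c) := b :* (a :* c)) ≈-refl (w x (s x)) (w y (s y)) _)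
  weights-↭ s (Perm.trans p p′) = ≈-trans (weights-↭ s p) (weights-↭ s p′)

  wX wx wY wy : E → Carrier
  wX e = w e intAct
  wx e = w e intInact
  wY e = w e extAct
  wy e = w e extInact

  -- Independence recorded in the order of contraction: an edge is not spanned by those contracted
  -- before it, which stand behind it in the list.
  data Acyclic : List E → Set where
    []  : Acyclic []
    _∷_ : ¬ Spanned (_∈ X) e → Acyclic X → Acyclic (e ∷ X)

  -- The edge of a circuit that was contracted last would be spanned by the others, all contracted
  -- earlier.
  acyclic⇒no-circuit : Acyclic X → (γ : Circuit G) → ¬ (∀ i → edg γ i ∈ X)
  acyclic⇒no-circuit [] γ inX with () ← inX zero
  acyclic⇒no-circuit {e ∷ X} (¬r ∷ ac) γ inX with Fin.any? (λ i → edg γ i Fin.≟ e)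
  ... | yes (i , refl) = ¬r (circuit⇒spanned γ i λ j j≢i → other (inX j) (j≢i ∘ edg-inj γ j i))
    where
    other : ∀ {g h} → g ∈ (h ∷ X) → g ≢ h → g ∈ X
    other (here p) q = contradiction p q
    other (there m) q = m
  ... | no off = acyclic⇒no-circuit ac γ λ i → other i (inX i)
    where
    other : ∀ i → edg γ i ∈ (e ∷ X) → edg γ i ∈ X
    other i (here p) = contradiction (i , p) off
    other i (there m) = m

  Avail : List E → List E → E → Set
  Avail l X g = H g ≡ true ⊎ g ∈ X ⊎ g ∈ l

  mem? : (X : List E) → Decidable (_∈ X)
  mem? X g = g ∈? X
    where open import Data.List.Membership.DecPropositional Fin._≟_ using (_∈?_)

  avail? : (l X : List E) → Decidable (Avail l X)
  avail? l X g = (H g Bool.≟ true) ⊎-dec (mem? X g ⊎-dec mem? l g)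

  -- In the minor reached so far, `A` says that `e` is a loop and `B` that `e` is not a bridge. A
  -- loop can only be deleted, a bridge only contracted.
  branch : ∀ {A B : Set} → Dec A → Dec B → E → Carrier → Carrier → Carrier
  branch (yes _) _       e zc zd = wY e * zd
  branch (no _)  (no _)  e zc zd = wX e * zc
  branch (no _)  (yes _) e zc zd = wx e * zc + wy e * zd

  -- The edges of l are decided in turn, the largest label first.  X is the set of the edges contracted
  -- so far, so an edge is externally active when deleted iff X spans it, and internally active when
  -- contracted iff the edges still available do not span it.
  Z : (List E → Carrier) → List E → List E → Carrier
  Z Ψ [] X = Ψ X
  Z Ψ (e ∷ l) X = branch (spanned? (mem? X) e) (spanned? (avail? l X) e) e (Z Ψ l (e ∷ X)) (Z Ψ l X)

  -- The invariant under which `X` can still be completed to a contracting set by edges of `l`; for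
  -- empty `l` it makes `X` itself contracting (`leaf-contracting`).
  record Feasible (l X : List E) : Set where
    field
      X-regular : ∀ {g} → g ∈ X → H g ≡ false
      l-regular : ∀ {g} → g ∈ l → H g ≡ false
      acyclic   : Acyclic X
      connected : Connected (Avail l X)
  open Feasible

  avail-weaken : ∀ g → Avail l X g → Avail (e ∷ l) X g
  avail-weaken g (inj₁ p) = inj₁ p
  avail-weaken g (inj₂ (inj₁ p)) = inj₂ (inj₁ p)
  avail-weaken g (inj₂ (inj₂ p)) = inj₂ (inj₂ (there p))

  avail-split : ∀ g → Avail (e ∷ l) X g → g ≡ e ⊎ Avail l X g
  avail-split g (inj₁ p) = inj₂ (inj₁ p)
  avail-split g (inj₂ (inj₁ p)) = inj₂ (inj₂ (inj₁ p))
  avail-split g (inj₂ (inj₂ (here p))) = inj₁ p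
  avail-split g (inj₂ (inj₂ (there p))) = inj₂ (inj₂ (inj₂ p))

  avail-shift : ∀ g → Avail (e ∷ l) X g → Avail l (e ∷ X) g
  avail-shift g (inj₁ p) = inj₁ p
  avail-shift g (inj₂ (inj₁ p)) = inj₂ (inj₁ (there p))
  avail-shift g (inj₂ (inj₂ (here p))) = inj₂ (inj₁ (here p))
  avail-shift g (inj₂ (inj₂ (there p))) = inj₂ (inj₂ p)

  avail-unshift : ∀ g → Avail l (e ∷ X) g → Avail (e ∷ l) X g
  avail-unshift g (inj₁ p) = inj₁ p
  avail-unshift g (inj₂ (inj₁ (here p))) = inj₂ (inj₂ (here p))
  avail-unshift g (inj₂ (inj₁ (there p))) = inj₂ (inj₁ p)
  avail-unshift g (inj₂ (inj₂ p)) = inj₂ (inj₂ (there p))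

  avail-↭ : l ↭ l′ → ∀ g → Avail l X g → Avail l′ X g
  avail-↭ p g (inj₂ (inj₂ m)) = inj₂ (inj₂ (∈-resp-↭ p m))
  avail-↭ p g (inj₂ (inj₁ m)) = inj₂ (inj₁ m)
  avail-↭ p g (inj₁ m) = inj₁ m

  X⊆avail : ∀ g → g ∈ X → Avail l X g
  X⊆avail g m = inj₂ (inj₁ m)

  ∷-split : ∀ g → g ∈ (e ∷ X) → g ≡ e ⊎ g ∈ X
  ∷-split g (here p) = inj₁ p
  ∷-split g (there m) = inj₂ m

  feasible-contract : Feasible (e ∷ l) X → ¬ Spanned (_∈ X) e → Feasible l (e ∷ X)
  feasible-contract F ¬r = record
    { X-regular = λ { (here refl) → l-regular F (here refl) ; (there m) → X-regular F m }
    ; l-regular = l-regular F ∘ there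
    ; acyclic = ¬r ∷ acyclic F
    ; connected = λ u v → conn-mono avail-shift (connected F u v) }

  feasible-delete : Feasible (e ∷ l) X → Spanned (Avail l X) e → Feasible l X
  feasible-delete F r = record
    { X-regular = X-regular F
    ; l-regular = l-regular F ∘ there
    ; acyclic = acyclic F
    ; connected = λ u v → conn-bind (λ g p → [ (λ { refl → r }) , edge⇒spanned ]′ (avail-split g p)) (connected F u v) }

  feasible-↭ : l ↭ l′ → Feasible l X → Feasible l′ X
  feasible-↭ p F = record
    { X-regular = X-regular F
    ; l-regular = l-regular F ∘ ∈-resp-↭ (↭-sym p)
    ; acyclic = acyclic F
    ; connected = λ u v → conn-mono (avail-↭ p) (connected F u v) }

  feasible-delete′ : Feasible (e ∷ l) X → Spanned (_∈ X) e ⊎ Spanned (Avail l X) e → Feasible l X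
  feasible-delete′ F = [ feasible-delete F ∘ conn-mono X⊆avail , feasible-delete F ]′

  -- The equations between values are conditional because each minor is feasible only in the
  -- branches that reach it.
  branch-cong : ∀ {A A′ B B′ : Set} (a : Dec A) (a′ : Dec A′) (b : Dec B) (b′ : Dec B′) →
    (A → A′) → (A′ → A) → (B → B′) → (B′ → B) → (¬ A → p₁ ≈ p₁′) → (A ⊎ B → p₂ ≈ p₂′) →
    branch a b e p₁ p₂ ≈ branch a′ b′ e p₁′ p₂′
  branch-cong (yes a) (yes _) _ _ _ _ _ _ _ d = *-congˡ (d (inj₁ a))
  branch-cong (yes a) (no ¬a) _ _ p _ _ _ _ _ = contradiction (p a) ¬a
  branch-cong (no ¬a) (yes a) _ _ _ p _ _ _ _ = contradiction (p a) ¬a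
  branch-cong (no ¬a) (no _) (yes b) (yes _) _ _ _ _ c d = +-cong (*-congˡ (c ¬a)) (*-congˡ (d (inj₂ b)))
  branch-cong (no ¬a) (no _) (no ¬b) (no _) _ _ _ _ c _ = *-congˡ (c ¬a)
  branch-cong (no _) (no _) (yes b) (no ¬b) _ _ p _ _ _ = contradiction (p b) ¬b
  branch-cong (no _) (no _) (no ¬b) (yes b) _ _ _ p _ _ = contradiction (p b) ¬b

  _⊑_ : List E → List E → Set
  X ⊑ X′ = ∀ g → g ∈ X → Spanned (_∈ X′) g

  ⊑-∷ : X ⊑ X′ → (e ∷ X) ⊑ (e ∷ X′)
  ⊑-∷ h g (here p) = edge⇒spanned (here p)
  ⊑-∷ h g (there m) = conn-mono (λ _ → there) (h g m)

  ⊑-avail : X ⊑ X′ → ∀ g → Avail l X g → Spanned (Avail l X′) g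
  ⊑-avail h g (inj₁ p) = edge⇒spanned (inj₁ p)
  ⊑-avail h g (inj₂ (inj₁ m)) = conn-mono X⊆avail (h g m)
  ⊑-avail h g (inj₂ (inj₂ m)) = edge⇒spanned (inj₂ (inj₂ m))

  -- There are two leaf functions because each `TutteData` brings its own choice of contracted
  -- graphs.
  Agree : (Ψ Ψ′ : List E → Carrier) → Set ℓq
  Agree Ψ Ψ′ = ∀ {X X′} → Feasible [] X → Feasible [] X′ → X ⊑ X′ → X′ ⊑ X → Ψ X ≈ Ψ′ X′

  -- Both tests of a step ask for spans, so the recursion sees the contracted edges only through
  -- what they span.
  Z-span : ∀ {Ψ Ψ′} → Agree Ψ Ψ′ → Feasible l X → Feasible l X′ → X ⊑ X′ → X′ ⊑ X → Z Ψ l X ≈ Z Ψ′ l X′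
  Z-span {[]} agree F F′ s s′ = agree F F′ s s′
  Z-span {e ∷ l} {X} {X′} agree F F′ s s′ = branch-cong (spanned? (mem? X) e) (spanned? (mem? X′) e) (spanned? (avail? l X) e) (spanned? (avail? l X′) e)
    (conn-bind s) (conn-bind s′) (conn-bind (⊑-avail s)) (conn-bind (⊑-avail s′))
    (λ ¬a → Z-span agree (feasible-contract F ¬a) (feasible-contract F′ (¬a ∘ conn-bind s′)) (⊑-∷ s) (⊑-∷ s′))
    (λ ab → Z-span agree (feasible-delete′ F ab)
      (feasible-delete′ F′ ([ inj₁ ∘ conn-bind s , inj₂ ∘ conn-bind (⊑-avail s) ]′ ab)) s s′)

  -- The coparallel situation: `X` is `N` with `e` added, and `e` crosses between components of
  -- `Avail l N`. Two states are compared that share `N` and differ in this one edge.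
  record Twin (l N X : List E) (e : E) : Set where
    field
      to     : ∀ g → g ∈ X → g ≡ e ⊎ g ∈ N
      from   : ∀ g → g ∈ N → g ∈ X
      e∈X    : e ∈ X
      coloop : ¬ Spanned (Avail l N) e
  open Twin

  twin-contract : Twin (g ∷ l) N X e → Twin l (g ∷ N) (g ∷ X) e
  twin-contract t = record
    { to = λ { h (here p) → inj₂ (here p) ; h (there m) → [ inj₁ , inj₂ ∘ there ]′ (to t h m) }
    ; from = λ { h (here p) → here p ; h (there m) → there (from t h m) }
    ; e∈X = there (e∈X t)
    ; coloop = λ r → coloop t (conn-mono avail-unshift r) }

  twin-delete : Twin (g ∷ l) N X e → Twin l N X e
  twin-delete t = record { to = to t ; from = from t ; e∈X = e∈X t ; coloop = coloop t ∘ conn-mono avail-weaken }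

  twin-from-avail : Twin l N X e → ∀ g → Avail l N g → Avail l X g
  twin-from-avail t g (inj₁ p) = inj₁ p
  twin-from-avail t g (inj₂ (inj₁ m)) = inj₂ (inj₁ (from t g m))
  twin-from-avail t g (inj₂ (inj₂ m)) = inj₂ (inj₂ m)

  -- If `e` were needed to span `g`, exchange would span `e` by `N` and `g`, all of them available.
  -- So the outcome of the test depends on `N` alone.
  twin-spanned : Twin (g ∷ l) N X e → Spanned (_∈ X) g → Spanned (_∈ N) g
  twin-spanned t r with exchange (to t) X⊆avail (inj₂ (inj₂ (here refl))) r
  ... | inj₁ r′ = r′
  ... | inj₂ s = contradiction s (coloop t)

  twin-spanned-avail : Twin (g ∷ l) N X e → Spanned (Avail l X) g → Spanned (Avail l N) g
  twin-spanned-avail {g} {l} {N} {X} {e} t r with exchange split avail-weaken (inj₂ (inj₂ (here refl))) r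
    where
    split : ∀ h → Avail l X h → h ≡ e ⊎ Avail l N h
    split h (inj₁ p) = inj₂ (inj₁ p)
    split h (inj₂ (inj₁ m)) = [ inj₁ , inj₂ ∘ inj₂ ∘ inj₁ ]′ (to t h m)
    split h (inj₂ (inj₂ m)) = inj₂ (inj₂ (inj₂ m))
  ... | inj₁ r′ = r′
  ... | inj₂ s = contradiction s (coloop t)

  TwinInvariant : (List E → Carrier) → Set ℓq
  TwinInvariant Ψ = ∀ {X X′ N e f} → Feasible [] X → Feasible [] X′ → Twin [] N X e → Twin [] N X′ f → Ψ X ≈ Ψ X′

  -- Every test has the same outcome in both states, since each outcome is determined by `N`; only
  -- the leaves remain to be compared.
  Z-twin : ∀ {Ψ} → TwinInvariant Ψ → Feasible l X → Feasible l X′ → Twin l N X e → Twin l N X′ f → Z Ψ l X ≈ Z Ψ l X′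
  Z-twin {[]} inv F F′ t t′ = inv F F′ t t′
  Z-twin {g ∷ l} {X} {X′} inv F F′ t t′ =
    branch-cong (spanned? (mem? X) g) (spanned? (mem? X′) g) (spanned? (avail? l X) g) (spanned? (avail? l X′) g)
      (over t t′) (over t′ t) (over-avail t t′) (over-avail t′ t)
      (λ ¬a → Z-twin inv (feasible-contract F ¬a) (feasible-contract F′ (¬a ∘ over t′ t)) (twin-contract t) (twin-contract t′))
      (λ ab → Z-twin inv (feasible-delete′ F ab)
        (feasible-delete′ F′ ([ inj₁ ∘ over t t′ , inj₂ ∘ over-avail t t′ ]′ ab)) (twin-delete t) (twin-delete t′))
    where
    over : ∀ {e f X X′} → Twin (g ∷ l) N X e → Twin (g ∷ l) N X′ f → Spanned (_∈ X) g → Spanned (_∈ X′) g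
    over t t′ r = conn-mono (from t′) (twin-spanned t r)
    over-avail : ∀ {e f X X′} → Twin (g ∷ l) N X e → Twin (g ∷ l) N X′ f → Spanned (Avail l X) g → Spanned (Avail l X′) g
    over-avail t t′ r = conn-mono (twin-from-avail (twin-delete t′)) (twin-spanned-avail t r)

  module _ {Ψ : List E → Carrier} (agree : Agree Ψ Ψ) (inv : TwinInvariant Ψ)
    -- The relations of (b) with the negative terms moved across, which makes the rest of the
    -- computation a matter of semirings.
    (det-Xy-xY : ∀ e f → H e ≡ false → H f ≡ false →
      wX e * wy f + wY e * wx f ≈ wx e * wY f + wy e * wX f)
    (det-xY-xy : ∀ e f → H e ≡ false → H f ≡ false →
      wx e * wY f + wy e * wx f ≈ wx e * wy f + wY e * wx f)
    where

    -- The sum of the two given relations, after cancelling their common terms. It serves pairs that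
    -- are coparallel but not parallel.
    det-Xy-xy : ∀ e f → H e ≡ false → H f ≡ false →
      wx e * wy f + wy e * wX f ≈ wX e * wy f + wy e * wx f
    det-Xy-xy e f p q = ∙-cancelʳ (wY e * wx f + wx e * wY f) _ _ (begin
      (xe * yf + ye * Xf) + (Ye * xf + xe * Yf)
        ≈⟨ shuffle₁ xe yf ye Xf Ye xf Yf ⟩
      (xe * Yf + ye * Xf) + (xe * yf + Ye * xf)
        ≈⟨ +-cong (det-Xy-xY e f p q) (det-xY-xy e f p q) ⟨
      (Xe * yf + Ye * xf) + (xe * Yf + ye * xf)
        ≈⟨ shuffle₂ Xe yf ye xe Ye xf Yf ⟩
      (Xe * yf + ye * xf) + (Ye * xf + xe * Yf) ∎)
      where
      open GroupProperties +-group using (∙-cancelʳ)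
      Xe = wX e ; xe = wx e ; Ye = wY e ; ye = wy e
      Xf = wX f ; xf = wx f ; Yf = wY f ; yf = wy f
      shuffle₁ : ∀ xe yf ye Xf Ye xf Yf →
        (xe * yf + ye * Xf) + (Ye * xf + xe * Yf) ≈ (xe * Yf + ye * Xf) + (xe * yf + Ye * xf)
      shuffle₁ = solve 7 (λ xe yf ye Xf Ye xf Yf →
        (xe :* yf :+ ye :* Xf) :+ (Ye :* xf :+ xe :* Yf) := (xe :* Yf :+ ye :* Xf) :+ (xe :* yf :+ Ye :* xf)) ≈-refl
      shuffle₂ : ∀ Xe yf ye xe Ye xf Yf →
        (Xe * yf + Ye * xf) + (xe * Yf + ye * xf) ≈ (Xe * yf + ye * xf) + (Ye * xf + xe * Yf)
      shuffle₂ = solve 7 (λ Xe yf ye xe Ye xf Yf →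
        (Xe :* yf :+ Ye :* xf) :+ (xe :* Yf :+ ye :* xf) := (Xe :* yf :+ ye :* xf) :+ (Ye :* xf :+ xe :* Yf)) ≈-refl

    module Swap (l X : List E) where

      ζ : List E → Carrier
      ζ = Z Ψ l

      -- The value of two steps with its tests as arguments, so that they can be matched on. `a`:
      -- spanned by `X`; `b`: spanned by the available edges, the other edge being undecided or
      -- contracted; `c`: spanned by `X` and the other edge; `d`: spanned by the available edges
      -- without the other.
      after : ∀ e f → Dec (Spanned (_∈ (e ∷ X)) f) → Dec (Spanned (Avail l (e ∷ X)) f) →
        Dec (Spanned (_∈ X) f) → Dec (Spanned (Avail l X) f) →
        Dec (Spanned (_∈ X) e) → Dec (Spanned (Avail (f ∷ l) X) e) → Carrier
      after e f cF bF aF dF aE bE =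
        branch aE bE e (branch cF bF f (ζ (f ∷ e ∷ X)) (ζ (e ∷ X))) (branch aF dF f (ζ (f ∷ X)) (ζ X))

      Swaps : E → E → Set ℓq
      Swaps e f = ∀ cF bF aF dF aE bE cE bE′ dE bF′ →
        after e f cF bF aF dF aE bE ≈ after f e cE bE′ aE dE aF bF′

      absorb : Spanned (Avail l X) e → Spanned (Avail l (e ∷ X)) f → Spanned (Avail l X) f
      absorb r = conn-bind λ g p → [ (λ { refl → r }) , edge⇒spanned ]′ (avail-split g (avail-unshift g p))

      to-∷X : Spanned (Avail (e ∷ l) X) f → Spanned (Avail l (e ∷ X)) f
      to-∷X = conn-mono avail-shift

      from-∷X : Spanned (Avail l (e ∷ X)) f → Spanned (Avail (e ∷ l) X) f
      from-∷X = conn-mono avail-unshift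

      widen : Spanned (Avail l X) f → Spanned (Avail l (e ∷ X)) f
      widen = to-∷X ∘ conn-mono avail-weaken

      -- Parallelism is symmetric once loops are excluded.
      exchange-X : ¬ Spanned (_∈ X) f → Spanned (_∈ (e ∷ X)) f → Spanned (_∈ (f ∷ X)) e
      exchange-X ¬a r with exchange ∷-split (λ _ → there) (here refl) r
      ... | inj₁ a = contradiction a ¬a
      ... | inj₂ c = c

      X⇒avail : Spanned (_∈ X) f → Spanned (Avail l X) f
      X⇒avail = conn-mono X⊆avail

      feasible-swap : Feasible (e ∷ f ∷ l) X → Feasible (f ∷ e ∷ l) X
      feasible-swap = feasible-↭ (Perm.swap _ _ Perm.refl)

      feasible-one : Feasible (e ∷ f ∷ l) X → ¬ Spanned (_∈ X) e → Spanned (Avail l (e ∷ X)) f → Feasible l (e ∷ X)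
      feasible-one F ¬a = feasible-delete (feasible-contract F ¬a)

      ζ-comm : Feasible (e ∷ f ∷ l) X → ¬ Spanned (_∈ X) e → ¬ Spanned (_∈ X) f → ¬ Spanned (_∈ (e ∷ X)) f →
        ζ (f ∷ e ∷ X) ≈ ζ (e ∷ f ∷ X)
      ζ-comm {e} {f} F ¬a ¬a′ ¬c = Z-span agree
        (feasible-contract (feasible-contract F ¬a) ¬c)
        (feasible-contract (feasible-contract (feasible-swap F) ¬a′) (¬c ∘ exchange-X ¬a))
        flip flip
        where
        flip : ∀ {e f} → (e ∷ f ∷ X) ⊑ (f ∷ e ∷ X)
        flip g m = edge⇒spanned (∈-resp-↭ (Perm.swap _ _ Perm.refl) m)

      ζ-parallel : Feasible (e ∷ f ∷ l) X → ¬ Spanned (_∈ X) e → ¬ Spanned (_∈ X) f →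
        Spanned (Avail l (e ∷ X)) f → Spanned (Avail l (f ∷ X)) e →
        Spanned (_∈ (e ∷ X)) f → Spanned (_∈ (f ∷ X)) e → ζ (e ∷ X) ≈ ζ (f ∷ X)
      ζ-parallel F ¬a ¬a′ b b′ c c′ = Z-span agree (feasible-one F ¬a b) (feasible-one (feasible-swap F) ¬a′ b′)
        (subset c′) (subset c)
        where
        subset : ∀ {e f} → Spanned (_∈ (f ∷ X)) e → (e ∷ X) ⊑ (f ∷ X)
        subset r g (here refl) = r
        subset r g (there m) = edge⇒spanned (there m)

      ζ-coparallel : Feasible (e ∷ f ∷ l) X → ¬ Spanned (_∈ X) e → ¬ Spanned (_∈ X) f →
        Spanned (Avail l (e ∷ X)) f → Spanned (Avail l (f ∷ X)) e →
        ¬ Spanned (Avail l X) e → ¬ Spanned (Avail l X) f → ζ (e ∷ X) ≈ ζ (f ∷ X)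
      ζ-coparallel F ¬a ¬a′ b b′ ¬d ¬d′ = Z-twin inv (feasible-one F ¬a b) (feasible-one (feasible-swap F) ¬a′ b′)
        (twin ¬d) (twin ¬d′)
        where
        twin : ∀ {e} → ¬ Spanned (Avail l X) e → Twin l X (e ∷ X) e
        twin ¬d = record { to = ∷-split ; from = λ _ → there ; e∈X = here refl ; coloop = ¬d }

      -- A loop remains a loop after either decision on `f`, is always deleted, and does not
      -- influence whether `f` is a loop or a bridge.
      swap-loop : Spanned (_∈ X) e → Swaps e f
      swap-loop {e} {f} a cF bF aF dF aE bE cE bE′ dE bF′ with aE
      ... | no ¬a = contradiction a ¬a
      ... | yes _ with aF
      ... | yes _ = solve 3 (λ a b z → a :* (b :* z) := b :* (a :* z)) ≈-refl (wY e) (wY f) (ζ X)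
      ... | no _ with cE
      ...   | no ¬c = contradiction (conn-mono (λ _ → there) a) ¬c
      ...   | yes _ with dF | bF′
      ...     | yes _ | yes _ =
        solve 5 (λ Y x y z z′ → Y :* (x :* z :+ y :* z′) := x :* (Y :* z) :+ y :* (Y :* z′)) ≈-refl
          (wY e) (wx f) (wy f) (ζ (f ∷ X)) (ζ X)
      ...     | no _ | no _ = solve 3 (λ Y x z → Y :* (x :* z) := x :* (Y :* z)) ≈-refl (wY e) (wX f) (ζ (f ∷ X))
      ...     | yes d | no ¬b = contradiction (from-∷X (widen d)) ¬b
      ...     | no ¬d | yes b = contradiction (absorb (X⇒avail a) (to-∷X b)) ¬d

      -- A bridge remains a bridge after either decision on `f` and is always contracted, which
      -- changes neither test on `f`.
      swap-bridge : Feasible (e ∷ f ∷ l) X → ¬ Spanned (_∈ X) e → ¬ Spanned (_∈ X) f → ¬ Spanned (Avail (f ∷ l) X) e →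
        Swaps e f
      swap-bridge {e} {f} F ¬a ¬a′ ¬b cF bF aF dF aE bE cE bE′ dE bF′ with aE | aF | bE
      ... | yes a | _ | _ = contradiction a ¬a
      ... | no _ | yes a | _ = contradiction a ¬a′
      ... | no _ | no _ | yes b = contradiction b ¬b
      ... | no _ | no _ | no _ with cF | cE | bE′ | dE
      ...   | yes c | _ | _ | _ = contradiction (from-∷X (conn-mono X⊆avail (exchange-X ¬a′ c))) ¬b
      ...   | no _ | yes c | _ | _ = contradiction (from-∷X (conn-mono X⊆avail c)) ¬b
      ...   | no _ | no _ | yes b | _ = contradiction (from-∷X b) ¬b
      ...   | no _ | no _ | no _ | yes d = contradiction (from-∷X (widen d)) ¬b
      ...   | no ¬c | no _ | no _ | no _ with bF | bF′
      ...     | yes b | no ¬b′ = contradiction (from-∷X b) ¬b′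
      ...     | no ¬b′ | yes b = contradiction (to-∷X b) ¬b′
      ...     | no _ | no _ = begin
        wX e * (wX f * ζ (f ∷ e ∷ X)) ≈⟨ *-congˡ (*-congˡ (ζ-comm F ¬a ¬a′ ¬c)) ⟩
        wX e * (wX f * ζ (e ∷ f ∷ X))
          ≈⟨ solve 3 (λ a b z → a :* (b :* z) := b :* (a :* z)) ≈-refl (wX e) (wX f) (ζ (e ∷ f ∷ X)) ⟩
        wX f * (wX e * ζ (e ∷ f ∷ X)) ∎
      ...     | yes _ | yes _ = begin
        wX e * (wx f * ζ (f ∷ e ∷ X) + wy f * ζ (e ∷ X)) ≈⟨ *-congˡ (+-congʳ (*-congˡ (ζ-comm F ¬a ¬a′ ¬c))) ⟩
        wX e * (wx f * ζ (e ∷ f ∷ X) + wy f * ζ (e ∷ X))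
          ≈⟨ solve 5 (λ X x y z z′ → X :* (x :* z :+ y :* z′) := x :* (X :* z) :+ y :* (X :* z′)) ≈-refl
               (wX e) (wx f) (wy f) (ζ (e ∷ f ∷ X)) (ζ (e ∷ X)) ⟩
        wx f * (wX e * ζ (e ∷ f ∷ X)) + wy f * (wX e * ζ (e ∷ X)) ∎

      -- In the minor left after X is contracted, e and f are parallel, coparallel, both or neither.
      swap-generic : Feasible (e ∷ f ∷ l) X → ¬ Spanned (_∈ X) e → ¬ Spanned (_∈ X) f →
        Spanned (Avail (f ∷ l) X) e → Spanned (Avail (e ∷ l) X) f → Swaps e f
      swap-generic {e} {f} F ¬a ¬a′ b b′ cF bF aF dF aE bE cE bE′ dE bF′ with aE | aF | bE | bF′ | bF | bE′
      ... | yes a | _ | _ | _ | _ | _ = contradiction a ¬a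
      ... | no _ | yes a | _ | _ | _ | _ = contradiction a ¬a′
      ... | no _ | no _ | no ¬b | _ | _ | _ = contradiction b ¬b
      ... | no _ | no _ | yes _ | no ¬b | _ | _ = contradiction b′ ¬b
      ... | no _ | no _ | yes _ | yes _ | no ¬b | _ = contradiction (to-∷X b′) ¬b
      ... | no _ | no _ | yes _ | yes _ | yes _ | no ¬b = contradiction (to-∷X b) ¬b
      ... | no _ | no _ | yes _ | yes _ | yes β | yes β′ with cF | cE | dF | dE
      ...   | yes c | no ¬c | _ | _ = contradiction (exchange-X ¬a′ c) ¬c
      ...   | no ¬c | yes c | _ | _ = contradiction (exchange-X ¬a c) ¬c
      ...   | yes _ | yes _ | yes d | no ¬d = contradiction (absorb d (to-∷X b)) ¬d
      ...   | yes _ | yes _ | no ¬d | yes d = contradiction (absorb d (to-∷X b′)) ¬d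
      ...   | no _ | no _ | yes d | no ¬d = contradiction (absorb d (to-∷X b)) ¬d
      ...   | no _ | no _ | no ¬d | yes d = contradiction (absorb d (to-∷X b′)) ¬d
      -- Parallel but not coparallel: the terms with both edges deleted agree already, and the
      -- second relation of (b) settles the terms with one edge contracted.
      ...   | yes c | yes c′ | yes _ | yes _ = begin
        wx e * (wY f * z) + wy e * (wx f * ζ (f ∷ X) + wy f * ζ X)
          ≈⟨ +-congˡ (*-congˡ (+-congʳ (*-congˡ same))) ⟨
        wx e * (wY f * z) + wy e * (wx f * z + wy f * ζ X)
          ≈⟨ solve 7 (λ xe ye xf yf Yf z z′ →
               xe :* (Yf :* z) :+ ye :* (xf :* z :+ yf :* z′) := (xe :* Yf :+ ye :* xf) :* z :+ ye :* (yf :* z′))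
               ≈-refl (wx e) (wy e) (wx f) (wy f) (wY f) z (ζ X) ⟩
        (wx e * wY f + wy e * wx f) * z + wy e * (wy f * ζ X)
          ≈⟨ +-congʳ (*-congʳ (det-xY-xy e f (l-regular F (here refl)) (l-regular F (there (here refl))))) ⟩
        (wx e * wy f + wY e * wx f) * z + wy e * (wy f * ζ X)
          ≈⟨ solve 7 (λ xe ye Ye xf yf z z′ →
               (xe :* yf :+ Ye :* xf) :* z :+ ye :* (yf :* z′) := xf :* (Ye :* z) :+ yf :* (xe :* z :+ ye :* z′))
               ≈-refl (wx e) (wy e) (wY e) (wx f) (wy f) z (ζ X) ⟩
        wx f * (wY e * z) + wy f * (wx e * z + wy e * ζ X)
          ≈⟨ +-congʳ (*-congˡ (*-congˡ same)) ⟩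
        wx f * (wY e * ζ (f ∷ X)) + wy f * (wx e * z + wy e * ζ X) ∎
        where
        z = ζ (e ∷ X)
        same = ζ-parallel F ¬a ¬a′ β β′ c c′
      -- Parallel and coparallel: exactly one of the two edges is contracted, and the first relation
      -- of (b) applies.
      ...   | yes c | yes c′ | no _ | no _ = begin
        wx e * (wY f * z) + wy e * (wX f * ζ (f ∷ X))
          ≈⟨ +-congˡ (*-congˡ (*-congˡ same)) ⟨
        wx e * (wY f * z) + wy e * (wX f * z)
          ≈⟨ solve 5 (λ xe ye Xf Yf z → xe :* (Yf :* z) :+ ye :* (Xf :* z) := (xe :* Yf :+ ye :* Xf) :* z)
               ≈-refl (wx e) (wy e) (wX f) (wY f) z ⟩
        (wx e * wY f + wy e * wX f) * z
          ≈⟨ *-congʳ (det-Xy-xY e f (l-regular F (here refl)) (l-regular F (there (here refl)))) ⟨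
        (wX e * wy f + wY e * wx f) * z
          ≈⟨ solve 5 (λ Xe Ye xf yf z → (Xe :* yf :+ Ye :* xf) :* z := xf :* (Ye :* z) :+ yf :* (Xe :* z))
               ≈-refl (wX e) (wY e) (wx f) (wy f) z ⟩
        wx f * (wY e * z) + wy f * (wX e * z)
          ≈⟨ +-congʳ (*-congˡ (*-congˡ same)) ⟩
        wx f * (wY e * ζ (f ∷ X)) + wy f * (wX e * z) ∎
        where
        z = ζ (e ∷ X)
        same = ζ-parallel F ¬a ¬a′ β β′ c c′
      -- Coparallel but not parallel: the terms with both edges contracted agree already, and the
      -- derived relation settles the others.
      ...   | no ¬c | no _ | no ¬d′ | no ¬d = begin
        wx e * (wx f * ζ (f ∷ e ∷ X) + wy f * z) + wy e * (wX f * ζ (f ∷ X))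
          ≈⟨ +-cong (*-congˡ (+-congʳ (*-congˡ (ζ-comm F ¬a ¬a′ ¬c)))) (*-congˡ (*-congˡ (≈-sym same))) ⟩
        wx e * (wx f * z₂ + wy f * z) + wy e * (wX f * z)
          ≈⟨ solve 7 (λ xe ye xf yf Xf z z₂ →
               xe :* (xf :* z₂ :+ yf :* z) :+ ye :* (Xf :* z) := xe :* (xf :* z₂) :+ (xe :* yf :+ ye :* Xf) :* z)
               ≈-refl (wx e) (wy e) (wx f) (wy f) (wX f) z z₂ ⟩
        wx e * (wx f * z₂) + (wx e * wy f + wy e * wX f) * z
          ≈⟨ +-congˡ (*-congʳ (det-Xy-xy e f (l-regular F (here refl)) (l-regular F (there (here refl))))) ⟩
        wx e * (wx f * z₂) + (wX e * wy f + wy e * wx f) * z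
          ≈⟨ solve 7 (λ xe ye Xe xf yf z z₂ →
               xe :* (xf :* z₂) :+ (Xe :* yf :+ ye :* xf) :* z := xf :* (xe :* z₂ :+ ye :* z) :+ yf :* (Xe :* z))
               ≈-refl (wx e) (wy e) (wX e) (wx f) (wy f) z z₂ ⟩
        wx f * (wx e * z₂ + wy e * z) + wy f * (wX e * z)
          ≈⟨ +-congʳ (*-congˡ (+-congˡ (*-congˡ same))) ⟩
        wx f * (wx e * z₂ + wy e * ζ (f ∷ X)) + wy f * (wX e * z) ∎
        where
        z = ζ (e ∷ X)
        z₂ = ζ (e ∷ f ∷ X)
        same = ζ-coparallel F ¬a ¬a′ β β′ ¬d ¬d′
      -- Neither parallel nor coparallel: all four combinations occur, with the same inactive
      -- weights in both orders.
      ...   | no ¬c | no _ | yes _ | yes _ = begin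
        wx e * (wx f * ζ (f ∷ e ∷ X) + wy f * z) + wy e * (wx f * z′ + wy f * ζ X)
          ≈⟨ +-congʳ (*-congˡ (+-congʳ (*-congˡ (ζ-comm F ¬a ¬a′ ¬c)))) ⟩
        wx e * (wx f * z₂ + wy f * z) + wy e * (wx f * z′ + wy f * ζ X)
          ≈⟨ solve 8 (λ xe ye xf yf z z′ z₂ z₀ →
               xe :* (xf :* z₂ :+ yf :* z) :+ ye :* (xf :* z′ :+ yf :* z₀) := xf :* (xe :* z₂ :+ ye :* z′) :+ yf :* (xe :* z :+ ye :* z₀))
               ≈-refl (wx e) (wy e) (wx f) (wy f) z z′ z₂ (ζ X) ⟩
        wx f * (wx e * z₂ + wy e * z′) + wy f * (wx e * z + wy e * ζ X) ∎
        where
        z = ζ (e ∷ X)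
        z′ = ζ (f ∷ X)
        z₂ = ζ (e ∷ f ∷ X)

      swap-any : Feasible (e ∷ f ∷ l) X → Swaps e f
      swap-any {e} {f} F cF bF aF dF aE bE cE bE′ dE bF′ = go aE aF bE bF′
        where
        go : Dec (Spanned (_∈ X) e) → Dec (Spanned (_∈ X) f) → Dec (Spanned (Avail (f ∷ l) X) e) →
          Dec (Spanned (Avail (e ∷ l) X) f) → after e f cF bF aF dF aE bE ≈ after f e cE bE′ aE dE aF bF′
        go (yes a) _ _ _ = swap-loop a cF bF aF dF aE bE cE bE′ dE bF′
        go (no _) (yes a) _ _ = ≈-sym (swap-loop a cE bE′ aE dE aF bF′ cF bF dF bE)
        go (no ¬a) (no ¬a′) (no ¬b) _ = swap-bridge F ¬a ¬a′ ¬b cF bF aF dF aE bE cE bE′ dE bF′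
        go (no ¬a) (no ¬a′) (yes _) (no ¬b) =
          ≈-sym (swap-bridge (feasible-swap F) ¬a′ ¬a ¬b cE bE′ aE dE aF bF′ cF bF dF bE)
        go (no ¬a) (no ¬a′) (yes b) (yes b′) = swap-generic F ¬a ¬a′ b b′ cF bF aF dF aE bE cE bE′ dE bF′

    Z-swap : Feasible (e ∷ f ∷ l) X → Z Ψ (e ∷ f ∷ l) X ≈ Z Ψ (f ∷ e ∷ l) X
    Z-swap {e} {f} {l} {X} F = Swap.swap-any l X F
      (spanned? (mem? (e ∷ X)) f) (spanned? (avail? l (e ∷ X)) f) (spanned? (mem? X) f) (spanned? (avail? l X) f)
      (spanned? (mem? X) e) (spanned? (avail? (f ∷ l) X) e)
      (spanned? (mem? (f ∷ X)) e) (spanned? (avail? l (f ∷ X)) e) (spanned? (avail? l X) e) (spanned? (avail? (e ∷ l) X) f)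

    Z-prep : (∀ {X} → Feasible l X → Z Ψ l X ≈ Z Ψ l′ X) → l ↭ l′ → Feasible (e ∷ l) X → Z Ψ (e ∷ l) X ≈ Z Ψ (e ∷ l′) X
    Z-prep {l} {l′} {e} {X} ih p F =
      branch-cong (spanned? (mem? X) e) (spanned? (mem? X) e) (spanned? (avail? l X) e) (spanned? (avail? l′ X) e)
        (λ r → r) (λ r → r) (conn-mono (avail-↭ p)) (conn-mono (avail-↭ (↭-sym p)))
        (λ ¬a → ih (feasible-contract F ¬a)) (λ ab → ih (feasible-delete′ F ab))

    Z-↭ : l ↭ l′ → Feasible l X → Z Ψ l X ≈ Z Ψ l′ X
    Z-↭ Perm.refl F = ≈-refl
    Z-↭ (Perm.prep x p) F = Z-prep (Z-↭ p) p F
    Z-↭ (Perm.swap x y p) F = ≈-trans (Z-swap F)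
      (Z-prep (Z-prep (Z-↭ p) p) (Perm.prep x p) (feasible-↭ (Perm.swap x y Perm.refl) F))
    Z-↭ (Perm.trans p p′) F = ≈-trans (Z-↭ p F) (Z-↭ p′ (feasible-↭ p F))

true-⇔⇒≡ : ∀ {a b} → (a ≡ true → b ≡ true) → (b ≡ true → a ≡ true) → a ≡ b
true-⇔⇒≡ {true} f g = sym (f refl)
true-⇔⇒≡ {false} {true} f g = g refl
true-⇔⇒≡ {false} {false} f g = refl

⌊⌋-true : ∀ {a} {A : Set a} (a? : Dec A) → A → ⌊ a? ⌋ ≡ true
⌊⌋-true a? p = trans (isYes≗does a?) (dec-true a? p)

⌊⌋-false : ∀ {a} {A : Set a} (a? : Dec A) → ¬ A → ⌊ a? ⌋ ≡ false
⌊⌋-false a? p = trans (isYes≗does a?) (dec-false a? p)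

∧-true⁻ : ∀ {a b} → a ∧ b ≡ true → a ≡ true × b ≡ true
∧-true⁻ {true} p = refl , p

∧-true⁺ : ∀ {a b} → a ≡ true → b ≡ true → a ∧ b ≡ true
∧-true⁺ refl p = p

not-true⁻ : ∀ {a} → not a ≡ true → a ≡ false
not-true⁻ {false} p = refl

not-true⁺ : ∀ {a} → a ≡ false → not a ≡ true
not-true⁺ refl = refl

-- The sum over contracting sets satisfies the recursion

module StateSum {q ℓq} (G : Graph) (H : ESet G) (Q : CommutativeRing q ℓq)
  (w : Fin (nE G) → Status → CommutativeRing.Carrier Q)
  (conG : ConnectedGraph G)
  (n : ℕ) (C : Fin n → ESet G) (contracting : ∀ i → IsContracting G H (C i))
  (φ : Fin (nE G) → ℕ)
  (st : Fin n → Fin (nE G) → Status) (st-ok : ∀ i e → H e ≡ false → StatusOK G H φ (C i) e (st i e))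
  (ψ : Fin n → CommutativeRing.Carrier Q) where

  open Connectivity G
  open CircuitsCocycles G
  open Expansion G H Q w
  open CommutativeRing Q
    using (Carrier; _≈_; _+_; _*_; 0#; 1#; setoid; semiring; +-cong; +-congˡ; *-congˡ; *-congʳ; *-assoc; *-identityˡ; zeroʳ; +-identityˡ; +-identityʳ)
    renaming (refl to ≈-refl; sym to ≈-sym; trans to ≈-trans; reflexive to ≈-reflexive)
  open SetoidReasoning setoid
  open Sum semiring using (sum; sum-cong-≋; sum-remove; sum-replicate-zero; ∑-distrib-+; *-distribˡ-sum)

  pick : Bool → Carrier → Carrier
  pick b x = if b then x else 0#

  -- The share of the sum that belongs to one state of the recursion: the weights of the edges
  -- outside `l` have already been factored out.
  restricted : List E → (Fin n → Bool) → Carrier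
  restricted l sel = sum (λ i → pick (sel i) (weights (st i) l * ψ i))

  mem : List E → E → Bool
  mem X g = ⌊ mem? X g ⌋

  agrees? : ∀ X i → Dec (∀ g → C i g ≡ mem X g)
  agrees? X i = Fin.all? λ g → C i g Bool.≟ mem X g

  -- Written as a sum in order to be defined for every `X`; at a feasible leaf exactly one term
  -- survives (`leaf-value`).
  Ψ : List E → Carrier
  Ψ X = sum (λ i → pick ⌊ agrees? X i ⌋ (ψ i))

  record Selects (l X : List E) (sel : Fin n → Bool) : Set where
    field
      sorted   : AllPairs (λ e h → φ h < φ e) l
      regular  : ∀ {g} → g ∈ l → H g ≡ false
      above    : ∀ {g h} → g ∉ l → H g ≡ false → h ∈ l → φ h < φ g
      disjoint : ∀ {g} → g ∈ X → g ∉ l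
      sound    : ∀ i → sel i ≡ true → ∀ g → g ∉ l → C i g ≡ mem X g
      complete : ∀ i → (∀ g → g ∉ l → C i g ≡ mem X g) → sel i ≡ true
  open Selects

  module _ {g l X sel} (S : Selects (g ∷ l) X sel) where

    private
      below-g : ∀ {h} → h ∈ l → φ h < φ g
      below-g m with sorted S
      ... | ps ∷ _ = All.lookup ps m

      g∉l : g ∉ l
      g∉l m = ℕ.<-irrefl refl (below-g m)

      g∉X : g ∉ X
      g∉X m = disjoint S m (here refl)

      ∉-∷ : ∀ {h} → h ≢ g → h ∉ l → h ∉ (g ∷ l)
      ∉-∷ p q (here r) = p r
      ∉-∷ p q (there m) = q m

      above′ : ∀ {k h} → k ∉ l → H k ≡ false → h ∈ l → φ h < φ k
      above′ {k} k∉l p m with k Fin.≟ g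
      ... | yes refl = below-g m
      ... | no k≢g = above S (∉-∷ k≢g k∉l) p (there m)

      sorted′ : AllPairs (λ e h → φ h < φ e) l
      sorted′ with sorted S
      ... | _ ∷ s = s

      mem-∷ : ∀ {k} → k ≢ g → mem (g ∷ X) k ≡ mem X k
      mem-∷ {k} k≢g = true-⇔⇒≡
        (λ p → ⌊⌋-true (mem? X k) (drop (dec-true⁻ (mem? (g ∷ X) k) p)))
        (λ p → ⌊⌋-true (mem? (g ∷ X) k) (there (dec-true⁻ (mem? X k) p)))
        where
        drop : k ∈ (g ∷ X) → k ∈ X
        drop (here p) = contradiction p k≢g
        drop (there m) = m

    with-g without-g : Fin n → Bool
    with-g i = sel i ∧ C i g
    without-g i = sel i ∧ not (C i g)

    selects-with : Selects l (g ∷ X) with-g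
    selects-with = record
      { sorted = sorted′ ; regular = regular S ∘ there ; above = above′
      ; disjoint = λ { (here refl) → g∉l ; (there m) → disjoint S m ∘ there }
      ; sound = λ i p → snd i (∧-true⁻ p)
      ; complete = λ i p → ∧-true⁺
          (complete S i λ k k∉ → trans (p k (k∉ ∘ there)) (mem-∷ (k∉ ∘ here)))
          (trans (p g g∉l) (⌊⌋-true (mem? (g ∷ X) g) (here refl)))
      }
      where
      snd : ∀ i → sel i ≡ true × C i g ≡ true → ∀ k → k ∉ l → C i k ≡ mem (g ∷ X) k
      snd i (p , q) k k∉l = go (k Fin.≟ g)
        where
        go : Dec (k ≡ g) → C i k ≡ mem (g ∷ X) k
        go (yes refl) = trans q (sym (⌊⌋-true (mem? (g ∷ X) g) (here refl)))
        go (no k≢g) = trans (sound S i p k (∉-∷ k≢g k∉l)) (sym (mem-∷ k≢g))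

    selects-without : Selects l X without-g
    selects-without = record
      { sorted = sorted′ ; regular = regular S ∘ there ; above = above′
      ; disjoint = λ m → disjoint S m ∘ there
      ; sound = λ i p → snd i (∧-true⁻ p)
      ; complete = λ i p → ∧-true⁺
          (complete S i λ k k∉ → p k (k∉ ∘ there))
          (not-true⁺ (trans (p g g∉l) (⌊⌋-false (mem? X g) g∉X)))
      }
      where
      snd : ∀ i → sel i ≡ true × not (C i g) ≡ true → ∀ k → k ∉ l → C i k ≡ mem X k
      snd i (p , q) k k∉l = go (k Fin.≟ g)
        where
        go : Dec (k ≡ g) → C i k ≡ mem X k
        go (yes refl) = trans (not-true⁻ q) (sym (⌊⌋-false (mem? X g) g∉X))
        go (no k≢g) = sound S i p k (∉-∷ k≢g k∉l)

    module _ {i : Fin n} (sel-i : sel i ≡ true) where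

      private
        in-X : ∀ {h} → C i h ≡ true → h ∉ (g ∷ l) → h ∈ X
        in-X {h} p q = dec-true⁻ (mem? X h) (trans (sym (sound S i sel-i h q)) p)

        X⇒C : ∀ {h} → h ∈ X → C i h ≡ true
        X⇒C {h} m = trans (sound S i sel-i h (disjoint S m)) (⌊⌋-true (mem? X h) m)

        C⇒avail : ∀ h → h ≢ g → C i h ≡ true → Avail l X h
        C⇒avail h h≢g p with mem? l h
        ... | yes m = inj₂ (inj₂ m)
        ... | no m = inj₂ (inj₁ (in-X p (∉-∷ h≢g m)))

        -- Here the comparison of labels turns into the state of the recursion: for the next edge
        -- `g`, `Below` amounts to `Avail l X`, and for a deleted `g`, `Above` amounts to `X`.
        below⇒avail : ∀ h → Below {H} {C i} φ g h → Avail l X h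
        below⇒avail h (h≢g , inj₁ p) = C⇒avail h h≢g p
        below⇒avail h (h≢g , inj₂ (inj₁ p)) = inj₁ p
        below⇒avail h (h≢g , inj₂ (inj₂ lt)) with mem? l h | H h in Hh
        ... | yes m | _ = inj₂ (inj₂ m)
        ... | no m | true = inj₁ refl
        -- A regular edge off the list is already decided, hence has a larger label than `g`.
        ... | no m | false = contradiction lt (ℕ.<-asym (above S (∉-∷ h≢g m) Hh (here refl)))

        avail⇒below : ∀ h → Avail l X h → Below {H} {C i} φ g h
        avail⇒below h (inj₁ p) = (λ { refl → true≢false p (regular S (here refl)) }) , inj₂ (inj₁ p)
        avail⇒below h (inj₂ (inj₁ m)) = (λ { refl → g∉X m }) , inj₁ (X⇒C m)
        avail⇒below h (inj₂ (inj₂ m)) = (λ { refl → g∉l m }) , inj₂ (inj₂ (below-g m))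

        X⇒above : ∀ h → h ∈ X → Above {H} {C i} φ g h
        X⇒above h m = X⇒C m , ℕ.<⇒≤ (above S (disjoint S m) (proj₁ (contracting i) h (X⇒C m)) (here refl))

        above⇒X : C i g ≡ false → ∀ h → Above {H} {C i} φ g h → h ∈ X
        above⇒X q h (p , le) = in-X p λ
          { (here refl) → true≢false p q ; (there m) → ℕ.<⇒≱ (below-g m) le }

        ok = st-ok i g (regular S (here refl))

      loop-deleted : Spanned (_∈ X) g → C i g ≡ false
      loop-deleted r = ¬-not λ p → contracting⇒acyclic {H} {C i} (contracting i) p
        (conn-mono (λ h m → X⇒C m , λ { refl → g∉X m }) r)

      -- If the contracting set omitted `g`, its union with the zero edges would connect the graph
      -- inside `Avail l X` and so span `g`.
      bridge-contracted : ¬ Spanned (Avail l X) g → C i g ≡ true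
      bridge-contracted ¬r = ¬-not λ p → ¬r
        (conn-mono (λ h → [ (λ q → C⇒avail h (λ { refl → true≢false q p }) q) , inj₁ ]′)
          (contracting⇒connected {H} {C i} conG (contracting i) (src g) (tgt g)))

      status-intAct : C i g ≡ true → ¬ Spanned (Avail l X) g → st i g ≡ intAct
      status-intAct p ¬r with contracted-status {H} {C i} φ conG p ok
      ... | inj₁ (s , _) = s
      ... | inj₂ (_ , r) = contradiction (conn-mono below⇒avail r) ¬r

      status-intInact : C i g ≡ true → Spanned (Avail l X) g → st i g ≡ intInact
      status-intInact p r with contracted-status {H} {C i} φ conG p ok
      ... | inj₁ (_ , ¬r) = contradiction (conn-mono avail⇒below r) ¬r
      ... | inj₂ (s , _) = s

      status-extAct : C i g ≡ false → Spanned (_∈ X) g → st i g ≡ extAct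
      status-extAct p r with deleted-status {H} {C i} φ p ok
      ... | inj₁ (s , _) = s
      ... | inj₂ (_ , ¬r) = contradiction (conn-mono X⇒above r) ¬r

      status-extInact : C i g ≡ false → ¬ Spanned (_∈ X) g → st i g ≡ extInact
      status-extInact p ¬r with deleted-status {H} {C i} φ p ok
      ... | inj₁ (_ , r) = contradiction (conn-mono (above⇒X p) r) ¬r
      ... | inj₂ (s , _) = s

    private
      pick-split : ∀ s c x → pick s x ≈ pick (s ∧ c) x + pick (s ∧ not c) x
      pick-split false c x = ≈-sym (+-identityˡ 0#)
      pick-split true true x = ≈-sym (+-identityʳ x)
      pick-split true false x = ≈-sym (+-identityˡ x)

    restricted-split : restricted (g ∷ l) sel ≈ restricted (g ∷ l) with-g + restricted (g ∷ l) without-g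
    restricted-split = ≈-trans (sum-cong-≋ λ i → pick-split (sel i) (C i g) _) (∑-distrib-+ {n} _ _)

    restricted-pull : ∀ (s : Fin n → Bool) σ → (∀ i → s i ≡ true → st i g ≡ σ) →
      restricted (g ∷ l) s ≈ w g σ * restricted l s
    restricted-pull s σ h = ≈-trans (sum-cong-≋ λ i → pull i (s i) (h i)) (≈-sym (*-distribˡ-sum {n} (w g σ) _))
      where
      pull : ∀ i b → (b ≡ true → st i g ≡ σ) →
        pick b (weights (st i) (g ∷ l) * ψ i) ≈ w g σ * pick b (weights (st i) l * ψ i)
      pull i false p = ≈-sym (zeroʳ _)
      pull i true p = ≈-trans (*-assoc _ _ _) (*-congʳ (≈-reflexive (cong (w g) (p refl))))

    restricted-none : ∀ (s : Fin n → Bool) → (∀ i → s i ≡ false) → restricted (g ∷ l) s ≈ 0#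
    restricted-none s h = ≈-trans
      (sum-cong-≋ λ i → ≈-reflexive (cong (λ b → pick b (weights (st i) (g ∷ l) * ψ i)) (h i))) (sum-replicate-zero n)

  -- The selected sets are split by whether they contain `g`. In each half the status of `g` is
  -- constant, so its weight factors out; if `g` is a loop the first half is empty, if a bridge the
  -- second.
  restricted-Z : ∀ {l X sel} → Selects l X sel → restricted l sel ≈ Z Ψ l X
  restricted-Z {[]} {X} {sel} S = sum-cong-≋ λ i → begin
    pick (sel i) (1# * ψ i)           ≈⟨ pick-1 (sel i) i ⟩
    pick (sel i) (ψ i)                ≡⟨ cong (λ b → pick b (ψ i)) (true-⇔⇒≡
      (λ p → ⌊⌋-true (agrees? X i) λ g → sound S i p g λ ())
      (λ p → complete S i λ g _ → dec-true⁻ (agrees? X i) p g)) ⟩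
    pick ⌊ agrees? X i ⌋ (ψ i)        ∎
    where
    pick-1 : ∀ b i → pick b (1# * ψ i) ≈ pick b (ψ i)
    pick-1 true i = *-identityˡ _
    pick-1 false i = ≈-refl
  restricted-Z {g ∷ l} {X} {sel} S = ≈-trans (restricted-split S) step-Z
    where
    none-with : (∀ {i} → sel i ≡ true → C i g ≡ false) → ∀ i → with-g S i ≡ false
    none-with h i with sel i | h {i}
    ... | false | _ = refl
    ... | true | p = p refl
    none-without : (∀ {i} → sel i ≡ true → C i g ≡ true) → ∀ i → without-g S i ≡ false
    none-without h i with sel i | h {i}
    ... | false | _ = refl
    ... | true | p = cong not (p refl)
    contract : ∀ σ → (∀ i → with-g S i ≡ true → st i g ≡ σ) →
      restricted (g ∷ l) (with-g S) ≈ w g σ * Z Ψ l (g ∷ X)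
    contract σ h = ≈-trans (restricted-pull S (with-g S) σ h) (*-congˡ (restricted-Z (selects-with S)))
    delete : ∀ σ → (∀ i → without-g S i ≡ true → st i g ≡ σ) →
      restricted (g ∷ l) (without-g S) ≈ w g σ * Z Ψ l X
    delete σ h = ≈-trans (restricted-pull S (without-g S) σ h) (*-congˡ (restricted-Z (selects-without S)))
    sel-with : ∀ i → with-g S i ≡ true → sel i ≡ true × C i g ≡ true
    sel-with i p = ∧-true⁻ p
    sel-without : ∀ i → without-g S i ≡ true → sel i ≡ true × C i g ≡ false
    sel-without i p = proj₁ (∧-true⁻ p) , not-true⁻ (proj₂ (∧-true⁻ {sel i} p))
    step-Z : restricted (g ∷ l) (with-g S) + restricted (g ∷ l) (without-g S) ≈ Z Ψ (g ∷ l) X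
    step-Z with spanned? (mem? X) g | spanned? (avail? l X) g
    ... | yes r | _ = ≈-trans
      (+-cong (restricted-none S (with-g S) (none-with λ p → loop-deleted S p r))
              (delete extAct λ i p → let q , c = sel-without i p in status-extAct S q c r))
      (+-identityˡ _)
    ... | no ¬r | no ¬b = ≈-trans
      (+-cong (contract intAct λ i p → let q , c = sel-with i p in status-intAct S q c ¬b)
              (restricted-none S (without-g S) (none-without λ p → bridge-contracted S p ¬b)))
      (+-identityʳ _)
    ... | no ¬r | yes b = +-cong
      (contract intInact λ i p → let q , c = sel-with i p in status-intInact S q c b)
      (delete extInact λ i p → let q , c = sel-without i p in status-extInact S q c ¬r)

  all-select : ∀ {l} → AllPairs (λ e h → φ h < φ e) l → (∀ {g} → g ∈ l → H g ≡ false) → (∀ g → H g ≡ false → g ∈ l) →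
    Selects l [] (λ _ → true)
  all-select {l} sorted reg all = record
    { sorted = sorted ; regular = reg ; above = λ g∉l p _ → contradiction (all _ p) g∉l ; disjoint = λ ()
    ; sound = λ i _ g g∉l → ¬-not λ p → g∉l (all g (proj₁ (contracting i) g p))
    ; complete = λ _ _ → refl }

  sum-single : ∀ {k} (f : Fin k → Carrier) i → (∀ j → j ≢ i → f j ≈ 0#) → sum f ≈ f i
  sum-single {suc k} f i zeros = begin
    sum f                              ≈⟨ sum-remove {i = i} f ⟩
    f i + sum (λ j → f (punchIn i j))  ≈⟨ +-congˡ (sum-cong-≋ λ j → zeros _ (Fin.punchInᵢ≢i i j)) ⟩
    f i + sum {k} (λ _ → 0#)           ≈⟨ +-congˡ (sum-replicate-zero k) ⟩
    f i + 0#                           ≈⟨ +-identityʳ (f i) ⟩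
    f i                                ∎

  leaf-contracting : ∀ {X} → Feasible [] X → IsContracting G H (mem X)
  leaf-contracting {X} F = connected⇒contracting {H} {mem X} conG
    (λ e p → Feasible.X-regular F (dec-true⁻ (mem? X e) p))
    (λ (γ , on) → acyclic⇒no-circuit (Feasible.acyclic F) γ λ i → dec-true⁻ (mem? X _) (on i))
    (λ u v → conn-mono (λ { g (inj₁ p) → inj₂ p ; g (inj₂ (inj₁ m)) → inj₁ (⌊⌋-true (mem? X g) m) }) (Feasible.connected F u v))

  module _ (distinct : ∀ i j → (∀ e → C i e ≡ C j e) → i ≡ j)
    (exhaustive : ∀ D → IsContracting G H D → ∃ λ i → ∀ e → D e ≡ C i e) where

    leaf-value : ∀ {X} → Feasible [] X → ∃ λ i → (∀ g → C i g ≡ mem X g) × Ψ X ≈ ψ i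
    leaf-value {X} F with exhaustive (mem X) (leaf-contracting F)
    ... | i , eq = i , (λ g → sym (eq g)) , (begin
      Ψ X                         ≈⟨ sum-single _ i (λ j j≢i → ≈-reflexive (cong (λ b → pick b (ψ j))
                                       (⌊⌋-false (agrees? X j) λ p → j≢i (distinct j i λ g → trans (p g) (eq g))))) ⟩
      pick ⌊ agrees? X i ⌋ (ψ i)  ≡⟨ cong (λ b → pick b (ψ i)) (⌊⌋-true (agrees? X i) λ g → sym (eq g)) ⟩
      ψ i                         ∎)

-- Enumeration of finite sets and search over edge sets

record Enumeration {N : ℕ} (P : Fin N → Set) : Set where
  field
    size : ℕ
    at : Fin size → Fin N
    at-injective : ∀ i j → at i ≡ at j → i ≡ j
    at-sound : ∀ i → P (at i)
    at-complete : ∀ k → P k → ∃ λ i → at i ≡ k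

enumerate : ∀ {N} {P : Fin N → Set} → Decidable P → Enumeration P
enumerate {zero} P? = record
  { size = 0 ; at = λ () ; at-injective = λ () ; at-sound = λ () ; at-complete = λ () }
enumerate {suc N} {P} P? with P? zero | enumerate (P? ∘ suc)
... | yes p | en = record
  { size = suc size
  ; at = λ { zero → zero ; (suc i) → suc (at i) }
  ; at-injective = λ { zero zero _ → refl ; (suc i) (suc j) eq → cong suc (at-injective i j (Fin.suc-injective eq)) }
  ; at-sound = λ { zero → p ; (suc i) → at-sound i }
  ; at-complete = λ { zero _ → zero , refl ; (suc k) q → let i , eq = at-complete k q in suc i , cong suc eq }
  }
  where open Enumeration en
... | no ¬p | en = record
  { size = size
  ; at = suc ∘ at
  ; at-injective = λ i j eq → at-injective i j (Fin.suc-injective eq)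
  ; at-sound = at-sound
  ; at-complete = λ { zero q → contradiction q ¬p ; (suc k) q → let i , eq = at-complete k q in i , cong suc eq }
  }
  where open Enumeration en

private
  open Inverse Fin.2↔Bool using () renaming (to to toBool; from to fromBool; strictlyInverseˡ to toBool-fromBool; strictlyInverseʳ to fromBool-toBool)

  funToFin-cong : ∀ {m n} {f g : Fin m → Fin n} → f ≗ g → funToFin f ≡ funToFin g
  funToFin-cong {zero} h = refl
  funToFin-cong {suc m} h = cong₂ Data.Fin.combine (h zero) (funToFin-cong (h ∘ suc))

-- Edge sets are compared pointwise; numbers below `2 ^ m` represent each of them exactly once up to
-- this, which permits search and enumeration without repetition.
decode : ∀ {m} → Fin (2 ℕ.^ m) → Fin m → Bool
decode k = toBool ∘ finToFun k

encode : ∀ {m} → (Fin m → Bool) → Fin (2 ℕ.^ m)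
encode S = funToFin (fromBool ∘ S)

decode-encode : ∀ {m} (S : Fin m → Bool) → decode (encode S) ≗ S
decode-encode S e = trans (cong toBool (Fin.finToFun-funToFin (fromBool ∘ S) e)) (toBool-fromBool (S e))

decode-injective : ∀ {m} {k l : Fin (2 ℕ.^ m)} → decode k ≗ decode {m} l → k ≡ l
decode-injective {m} {k} {l} h = trans (sym (Fin.funToFin-finToFin {m} {2} k))
  (trans (funToFin-cong λ e → trans (sym (fromBool-toBool _)) (trans (cong fromBool (h e)) (fromBool-toBool _)))
    (Fin.funToFin-finToFin {m} {2} l))

anySet? : ∀ {m} {P : (Fin m → Bool) → Set} → (∀ {S S′} → S ≗ S′ → P S → P S′) → Decidable P → Dec (∃ P)
anySet? resp P? = map′ (λ (k , p) → decode k , p) (λ (S , p) → encode S , resp (sym ∘ decode-encode S) p)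
  (Fin.any? (P? ∘ decode))

-- Blocks as edge sets, and the existence of a block decomposition

module Blocks (K : Graph) where
  open Connectivity K

  private variable
    S S′ : ESet K
    u v : V
    e f : E

  Touches : ESet K → V → Set
  Touches = EdgeVerts K

  reach-map : {VP VP′ : V → Set} {EP EP′ : E → Set} → (∀ v → VP v → VP′ v) → (∀ e → EP e → EP′ e) →
    Reach K VP EP u v → Reach K VP′ EP′ u v
  reach-map h k (here p) = here (h _ p)
  reach-map h k (step e p q j r) = step e (k e p) (h _ q) j (reach-map h k r)

  Connects : ESet K → (V → Set) → Set
  Connects S VP = ConnectedOn K VP (λ e → S e ≡ true)

  connects-map : {VP VP′ : V → Set} → S ≗ S′ → (∀ v → VP v → VP′ v) → (∀ v → VP′ v → VP v) →
    Connects S VP → Connects S′ VP′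
  connects-map eq h k ((v , p) , c) = (v , h v p) , λ u v p q →
    reach-map h (λ e → trans (sym (eq e))) (c u v (k u p) (k v q))

  Closed : (V → Set) → ESet K → Set
  Closed VP S = ∀ e → S e ≡ true → VP (src e) × VP (tgt e)

  -- Since the ends of all edges of `S` satisfy `VP`, a walk in `S` starting in `VP` never leaves
  -- it, so unrestricted reachability decides the question.
  connects? : {VP : V → Set} → Decidable VP → ∀ S → Closed VP S → Dec (Connects S VP)
  connects? {VP} VP? S cl = Fin.any? VP? ×-dec
    Fin.all? λ u → Fin.all? λ v → map′ (λ f p q → f p q) (λ f p q → f p q) (VP? u →-dec (VP? v →-dec reach? u v))
    where
    forward : ∀ {u v} → VP u → Conn (λ e → S e ≡ true) u v → Reach K VP (λ e → S e ≡ true) u v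
    forward p (here _) = here p
    forward p (step e s _ (inj₁ (refl , refl)) r) = step e s p (inj₁ (refl , refl)) (forward (proj₂ (cl e s)) r)
    forward p (step e s _ (inj₂ (refl , refl)) r) = step e s p (inj₂ (refl , refl)) (forward (proj₁ (cl e s)) r)
    start : ∀ {u v} → Reach K VP (λ e → S e ≡ true) u v → VP u
    start (here p) = p
    start (step _ _ p _ _) = p
    reach? : ∀ u v → Dec (Reach K VP (λ e → S e ≡ true) u v)
    reach? u v = map′ (λ (p , c) → forward p c) (λ r → start r , reach-map (λ _ _ → tt) (λ _ s → s) r)
      (VP? u ×-dec conn? (λ e → S e Bool.≟ true) u v)

  touches? : ∀ S → Decidable (Touches S)
  touches? S v = Fin.any? λ e → (S e Bool.≟ true) ×-dec ((src e Fin.≟ v) ⊎-dec (tgt e Fin.≟ v))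

  touches-closed : Closed (Touches S) S
  touches-closed e s = (e , s , inj₁ refl) , (e , s , inj₂ refl)

  touches-mono : Sub K S S′ → ∀ v → Touches S v → Touches S′ v
  touches-mono h v (e , s , i) = e , h e s , i

  ≗⇒sub : S ≗ S′ → Sub K S S′
  ≗⇒sub eq e p = trans (sym (eq e)) p

  touches-cong : S ≗ S′ → ∀ v → Touches S v → Touches S′ v
  touches-cong eq = touches-mono (≗⇒sub eq)

  -- Blocks are treated through their edge sets: in a connected graph with an edge every block has
  -- an edge (`block-has-edge`) and is therefore of this form.
  induced : ESet K → Subgraph K
  induced S = record
    { vs = λ v → ⌊ touches? S v ⌋
    ; es = S
    ; closed = λ e s → ⌊⌋-true (touches? S _) (e , s , inj₁ refl) , ⌊⌋-true (touches? S _) (e , s , inj₂ refl) }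

  induced⇒touches : vs (induced S) v ≡ true → Touches S v
  induced⇒touches {S} {v} = dec-true⁻ (touches? S v)

  touches⇒induced : Touches S v → vs (induced S) v ≡ true
  touches⇒induced {S} {v} = ⌊⌋-true (touches? S v)

  -- The body of `Separation` with its two edge sets as parameters, so that they can be searched for
  -- and replaced by pointwise equal ones.
  SeparatedBy : Subgraph K → ESet K → ESet K → Set
  SeparatedBy B E₁ E₂ =
      (∀ e → es B e ≡ true → (E₁ e ≡ true × E₂ e ≡ false) ⊎ (E₁ e ≡ false × E₂ e ≡ true))
    × Sub K E₁ (es B) × Sub K E₂ (es B)
    × (∃ λ e → E₁ e ≡ true) × (∃ λ e → E₂ e ≡ true)
    × ConnectedOn K (EdgeVerts K E₁) (λ e → E₁ e ≡ true)
    × ConnectedOn K (EdgeVerts K E₂) (λ e → E₂ e ≡ true)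
    × (∀ v → vs B v ≡ true → EdgeVerts K E₁ v ⊎ EdgeVerts K E₂ v)
    × (Σ (Fin (nV K)) λ x → EdgeVerts K E₁ x × EdgeVerts K E₂ x ×
         (∀ y → EdgeVerts K E₁ y → EdgeVerts K E₂ y → y ≡ x))

  separatedBy-cong : ∀ {B B′ E₁ E₁′ E₂ E₂′} → SameSubgraph B B′ → E₁ ≗ E₁′ → E₂ ≗ E₂′ →
    SeparatedBy B E₁ E₂ → SeparatedBy B′ E₁′ E₂′
  separatedBy-cong (sv , se) q₁ q₂ (part , sub₁ , sub₂ , (e₁ , p₁) , (e₂ , p₂) , c₁ , c₂ , cover , x , x₁ , x₂ , uniq) =
      (λ e p → [ (λ (a , b) → inj₁ (trans (sym (q₁ e)) a , trans (sym (q₂ e)) b))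
               , (λ (a , b) → inj₂ (trans (sym (q₁ e)) a , trans (sym (q₂ e)) b)) ]′ (part e (trans (se e) p)))
    , (λ e p → trans (sym (se e)) (sub₁ e (trans (q₁ e) p)))
    , (λ e p → trans (sym (se e)) (sub₂ e (trans (q₂ e) p)))
    , (e₁ , trans (sym (q₁ e₁)) p₁) , (e₂ , trans (sym (q₂ e₂)) p₂)
    , connects-map q₁ (touches-cong q₁) (touches-cong (sym ∘ q₁)) c₁
    , connects-map q₂ (touches-cong q₂) (touches-cong (sym ∘ q₂)) c₂
    , (λ v p → [ inj₁ ∘ touches-cong q₁ v , inj₂ ∘ touches-cong q₂ v ]′ (cover v (trans (sv v) p)))
    , x , touches-cong q₁ x x₁ , touches-cong q₂ x x₂
    , λ y y₁ y₂ → uniq y (touches-cong (sym ∘ q₁) y y₁) (touches-cong (sym ∘ q₂) y y₂)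

  same-refl : ∀ B → SameSubgraph {K} B B
  same-refl B = (λ _ → refl) , (λ _ → refl)

  separation? : ∀ B → Dec (Separation B)
  separation? B = anySet?
    (λ q (E₂ , s) → E₂ , separatedBy-cong {B} {B} (same-refl B) q (λ _ → refl) s)
    λ E₁ → anySet? (separatedBy-cong {B} {B} (same-refl B) (λ _ → refl)) λ E₂ →
      Fin.all? (λ e → (es B e Bool.≟ true) →-dec
        (((E₁ e Bool.≟ true) ×-dec (E₂ e Bool.≟ false)) ⊎-dec ((E₁ e Bool.≟ false) ×-dec (E₂ e Bool.≟ true))))
      ×-dec sub? E₁ (es B) ×-dec sub? E₂ (es B)
      ×-dec Fin.any? (λ e → E₁ e Bool.≟ true) ×-dec Fin.any? (λ e → E₂ e Bool.≟ true)
      ×-dec connects? (touches? E₁) E₁ touches-closed ×-dec connects? (touches? E₂) E₂ touches-closed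
      ×-dec Fin.all? (λ v → (vs B v Bool.≟ true) →-dec (touches? E₁ v ⊎-dec touches? E₂ v))
      ×-dec Fin.any? (λ x → touches? E₁ x ×-dec touches? E₂ x ×-dec
        Fin.all? (λ y → touches? E₁ y →-dec (touches? E₂ y →-dec (y Fin.≟ x))))
    where
    sub? : ∀ S T → Dec (Sub K S T)
    sub? S T = Fin.all? λ e → (S e Bool.≟ true) →-dec (T e Bool.≟ true)

  same-sym : ∀ {B B′} → SameSubgraph {K} B B′ → SameSubgraph B′ B
  same-sym (sv , se) = (sym ∘ sv) , (sym ∘ se)

  same⇒le : ∀ {B B′} → SameSubgraph {K} B B′ → SubgraphLE B B′
  same⇒le (sv , se) = (λ v p → trans (sym (sv v)) p) , (λ e p → trans (sym (se e)) p)

  le-antisym : ∀ {B B′} → SubgraphLE {K} B B′ → SubgraphLE B′ B → SameSubgraph B B′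
  le-antisym (a , b) (c , d) = (λ v → true-⇔⇒≡ (a v) (c v)) , (λ e → true-⇔⇒≡ (b e) (d e))

  le-trans : ∀ {B B′ B″} → SubgraphLE {K} B B′ → SubgraphLE B′ B″ → SubgraphLE B B″
  le-trans (a , b) (c , d) = (λ v → c v ∘ a v) , (λ e → d e ∘ b e)

  nonseparable-cong : ∀ {B B′} → SameSubgraph B B′ → Nonseparable B → Nonseparable B′
  nonseparable-cong {B} {B′} s@(sv , se) (c , ¬sep) =
    connects-map se (λ v p → trans (sym (sv v)) p) (λ v p → trans (sv v) p) c ,
    λ (E₁ , E₂ , sep) → ¬sep (E₁ , E₂ , separatedBy-cong {B′} {B} (same-sym {B} {B′} s) (λ _ → refl) (λ _ → refl) sep)

  induced-mono : Sub K S S′ → SubgraphLE (induced S) (induced S′)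
  induced-mono {S} {S′} h =
    (λ v p → touches⇒induced {S′} (touches-mono h v (induced⇒touches {S} p))) , h

  induced-cong : S ≗ S′ → SameSubgraph (induced S) (induced S′)
  induced-cong {S} {S′} eq = le-antisym {induced S} {induced S′} (induced-mono (≗⇒sub eq)) (induced-mono (≗⇒sub (sym ∘ eq)))

  nonseparable? : ∀ S → Dec (Nonseparable (induced S))
  nonseparable? S = connects? (λ v → vs (induced S) v Bool.≟ true) S (closed (induced S)) ×-dec ¬? (separation? (induced S))

  connected⇒touches : ∀ {B} → ConnectedSub B → es B e ≡ true → vs B v ≡ true → Touches (es B) v
  connected⇒touches {e = e} {v = v} {B = B} (_ , c) p q with c v (src e) q (proj₁ (closed B e p))
  ... | here _ = e , p , inj₁ refl
  ... | step g s _ (inj₁ (a , b)) _ = g , s , inj₁ a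
  ... | step g s _ (inj₂ (a , b)) _ = g , s , inj₂ b

  induced-least : ∀ {B} → Sub K S (es B) → SubgraphLE (induced S) B
  induced-least {S} {B} h = (λ v p → go (induced⇒touches {S} p)) , h
    where
    go : ∀ {v} → Touches S v → vs B v ≡ true
    go (e , s , inj₁ refl) = proj₁ (closed B e (h e s))
    go (e , s , inj₂ refl) = proj₂ (closed B e (h e s))

  connected⇒induced : ∀ {B} → ConnectedSub B → es B e ≡ true → SameSubgraph B (induced (es B))
  connected⇒induced {B = B} c p = le-antisym {B} {induced (es B)}
    ((λ v q → touches⇒induced {es B} (connected⇒touches {B = B} c p q)) , (λ _ q → q)) (induced-least {B = B} (λ _ q → q))

  single-nonseparable : (∀ g → S g ≡ true → g ≡ e) → S e ≡ true → Nonseparable (induced S)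
  single-nonseparable {S} {e} only Se = ((src e , proj₁ (closed (induced S) e Se)) , con) , ¬sep
    where
    VP = λ v → vs (induced S) v ≡ true
    ends-of : ∀ {v} → VP v → src e ≡ v ⊎ tgt e ≡ v
    ends-of p with induced⇒touches {S} p
    ... | g , s , i with refl ← only g s = i
    con : ∀ u v → VP u → VP v → Reach K VP (λ e → S e ≡ true) u v
    con u v p q with ends-of p | ends-of q
    ... | inj₁ refl | inj₁ refl = here p
    ... | inj₂ refl | inj₂ refl = here p
    ... | inj₁ refl | inj₂ refl = step e Se p (inj₁ (refl , refl)) (here q)
    ... | inj₂ refl | inj₁ refl = step e Se p (inj₂ (refl , refl)) (here q)
    ¬sep : ¬ Separation (induced S)
    ¬sep (E₁ , E₂ , part , sub₁ , sub₂ , (e₁ , p₁) , (e₂ , p₂) , _)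
      with refl ← only e₁ (sub₁ e₁ p₁) | refl ← only e₂ (sub₂ e₂ p₂) with part e Se
    ... | inj₁ (_ , q) = true≢false p₂ q
    ... | inj₂ (q , _) = true≢false p₁ q

  BlockSet : ESet K → Set
  BlockSet S = (∃ λ e → S e ≡ true) × Nonseparable (induced S) ×
    (∀ S′ → Nonseparable (induced S′) → Sub K S S′ → Sub K S′ S)

  Larger : ESet K → ESet K → Set
  Larger S S′ = Nonseparable (induced S′) × Sub K S S′ × ∃ λ e → S′ e ≡ true × S e ≡ false

  larger? : ∀ S → Dec (∃ (Larger S))
  larger? S = anySet?
    (λ {T} {T′} eq (ns , sub , e , p , q) → nonseparable-cong {induced T} {induced T′} (induced-cong eq) ns ,
      (λ e s → trans (sym (eq e)) (sub e s)) , e , trans (sym (eq e)) p , q)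
    λ S′ → nonseparable? S′ ×-dec Fin.all? (λ e → (S e Bool.≟ true) →-dec (S′ e Bool.≟ true))
      ×-dec Fin.any? (λ e → (S′ e Bool.≟ true) ×-dec (S e Bool.≟ false))

  no-larger⇒maximal : ¬ ∃ (Larger S) → ∀ S′ → Nonseparable (induced S′) → Sub K S S′ → Sub K S′ S
  no-larger⇒maximal {S} ¬l S′ ns sub e p with S e in eq
  ... | true = refl
  ... | false = contradiction (S′ , ns , sub , e , p , eq) ¬l

  maximal⇒no-larger : (∀ S′ → Nonseparable (induced S′) → Sub K S S′ → Sub K S′ S) → ¬ ∃ (Larger S)
  maximal⇒no-larger max (S′ , ns , sub , e , p , q) = true≢false (max S′ ns sub e p) q

  blockSet? : Decidable BlockSet
  blockSet? S = Fin.any? (λ e → S e Bool.≟ true) ×-dec nonseparable? S ×-dec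
    map′ no-larger⇒maximal maximal⇒no-larger (¬? (larger? S))

  blockSet-cong : S ≗ S′ → BlockSet S → BlockSet S′
  blockSet-cong {S} {S′} eq ((e , p) , ns , max) = (e , ≗⇒sub eq e p) ,
    nonseparable-cong {induced S} {induced S′} (induced-cong eq) ns ,
    λ T ns sub e p → ≗⇒sub eq e (max T ns (λ e s → sub e (≗⇒sub eq e s)) e p)

  card : ESet K → ℕ
  card S = Subset.∣ Vec.tabulate S ∣

  card-larger : Larger S S′ → card S < card S′
  card-larger {S} {S′} (_ , sub , e , p , q) = Subset.p⊂q⇒∣p∣<∣q∣
    ((λ {x} m → to S′ (sub x (from S m))) , e , to S′ p , λ m → true≢false (from S m) q)
    where
    to : ∀ T {x} → T x ≡ true → x Subset.∈ Vec.tabulate T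
    to T {x} p = Vec.lookup⇒[]= x _ (trans (Vec.lookup∘tabulate T x) p)
    from : ∀ T {x} → x Subset.∈ Vec.tabulate T → T x ≡ true
    from T {x} m = trans (sym (Vec.lookup∘tabulate T x)) (Vec.[]=⇒lookup m)

  -- A nonseparable set is enlarged as long as possible. `k` bounds the enlargements left: each
  -- raises the cardinality, which never exceeds `nE K`.
  blockSet-above : ∀ k → nE K ≤ card S ℕ.+ k → S e ≡ true → Nonseparable (induced S) → ∃ BlockSet
  blockSet-above {S} {e} k le p ns with larger? S
  ... | no ¬l = S , (e , p) , ns , no-larger⇒maximal ¬l
  blockSet-above {S} zero le p ns | yes (S′ , l) = contradiction
    (ℕ.<-≤-trans (card-larger {S} {S′} l) (Subset.∣p∣≤n (Vec.tabulate S′)))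
    (ℕ.≤⇒≯ (subst (nE K ≤_) (ℕ.+-identityʳ (card S)) le))
  blockSet-above {S} {e} (suc k) le p ns | yes (S′ , l@(ns′ , sub , _)) = blockSet-above {S′} k
    (ℕ.≤-trans (subst (nE K ≤_) (ℕ.+-suc (card S) k) le) (ℕ.+-monoˡ-≤ k (card-larger {S} {S′} l))) (sub e p) ns′

  single : E → ESet K
  single e g = ⌊ g Fin.≟ e ⌋

  single⁻ : ∀ g → single e g ≡ true → g ≡ e
  single⁻ {e} g = dec-true⁻ (g Fin.≟ e)

  single⁺ : single e e ≡ true
  single⁺ {e} = ⌊⌋-true (e Fin.≟ e) refl

  module _ (conK : ConnectedGraph K) (h₀ : E) where

    some-blockSet : ∃ BlockSet
    some-blockSet = blockSet-above {single h₀} (nE K) (ℕ.m≤n+m (nE K) _) (single⁺ {h₀})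
      (single-nonseparable (single⁻ {h₀}) (single⁺ {h₀}))

    incident : ∀ v → ∃ λ e → src e ≡ v ⊎ tgt e ≡ v
    incident v with proj₂ conK v (src h₀) tt tt
    ... | here _ = h₀ , inj₁ refl
    ... | step e _ _ (inj₁ (a , b)) _ = e , inj₁ a
    ... | step e _ _ (inj₂ (a , b)) _ = e , inj₂ b

    -- A block without edges would be a single vertex, contained in the nonseparable subgraph of any
    -- edge incident with it; maximality puts that edge into the block.
    block-has-edge : ∀ {B} → IsBlock K B → ∃ λ e → es B e ≡ true
    block-has-edge {B} ((((v , p) , con) , _) , max) with Fin.any? (λ e → es B e Bool.≟ true)
    ... | yes q = q
    ... | no none with incident v
    ...   | e , i = e , proj₂ (max (induced (single e)) le (single-nonseparable (single⁻ {e}) (single⁺ {e}))) e (single⁺ {e})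
      where
      le : SubgraphLE B (induced (single e))
      le = (λ u q → lem u (con v u p q)) , (λ g q → contradiction (g , q) none)
        where
        lem : ∀ u → Reach K (λ v → vs B v ≡ true) (λ e → es B e ≡ true) v u → vs (induced (single e)) u ≡ true
        lem u (here _) = touches⇒induced {single e} (e , single⁺ {e} , i)
        lem u (step g q _ _ _) = contradiction (g , q) none

    blockSet⇒block : BlockSet S → IsBlock K (induced S)
    blockSet⇒block {S} ((e , p) , ns , max) = ns , λ B′ le ns′ →
      let same = connected⇒induced {B = B′} (proj₁ ns′) (proj₂ le e p)
      in le-trans {B′} {induced (es B′)} {induced S} (same⇒le {B′} {induced (es B′)} same)
           (induced-mono (max (es B′) (nonseparable-cong {B′} {induced (es B′)} same ns′) (proj₂ le)))

    block⇒same : ∀ {B} → IsBlock K B → SameSubgraph B (induced (es B))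
    block⇒same {B} b = connected⇒induced {B = B} (proj₁ (proj₁ b)) (proj₂ (block-has-edge {B} b))

    block⇒blockSet : ∀ {B} → IsBlock K B → BlockSet (es B)
    block⇒blockSet {B} b@(ns , max) = block-has-edge {B} b ,
      nonseparable-cong {B} {induced (es B)} (block⇒same {B} b) ns ,
      λ S′ ns′ sub → proj₂ (max (induced S′) (le-trans {B} {induced (es B)} {induced S′}
        (same⇒le {B} {induced (es B)} (block⇒same {B} b)) (induced-mono sub)) ns′)

  restriction : (B : Subgraph K) → Σ Graph (Realizes K B)
  restriction B = graph (size VE) (size EE) (λ a → proj₁ (end₁ a) , proj₁ (end₂ a)) , record
    { ιV = at VE ; ιE = at EE
    ; ιV-inj = at-injective VE ; ιE-inj = at-injective EE
    ; ιV-in = at-sound VE ; ιE-in = at-sound EE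
    ; ιV-onto = at-complete VE ; ιE-onto = at-complete EE
    ; ends-ok = λ a → inj₁ (sym (proj₂ (end₁ a)) , sym (proj₂ (end₂ a))) }
    where
    open Enumeration
    VE : Enumeration (λ v → vs B v ≡ true)
    VE = enumerate λ v → vs B v Bool.≟ true
    EE : Enumeration (λ e → es B e ≡ true)
    EE = enumerate λ e → es B e Bool.≟ true
    end₁ : ∀ a → ∃ λ i → at VE i ≡ src (at EE a)
    end₁ a = at-complete VE _ (proj₁ (closed B _ (at-sound EE a)))
    end₂ : ∀ a → ∃ λ i → at VE i ≡ tgt (at EE a)
    end₂ a = at-complete VE _ (proj₂ (closed B _ (at-sound EE a)))

  -- The blocks are enumerated by the codes of their edge sets. A block set grown from `h₀` shows
  -- that their number is positive, as `combine` requires.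
  blockDecomposition : ConnectedGraph K → E → Σ ℕ λ r → BlockDecomposition K (suc r)
  blockDecomposition conK h₀ = nonempty (proj₁ (at-complete BE (encode S₀) S₀-coded)) decomposition
    where
    open Enumeration
    BE : Enumeration (BlockSet ∘ decode)
    BE = enumerate (blockSet? ∘ decode)
    S₀ = proj₁ (some-blockSet conK h₀)
    coded : ∀ {S} → BlockSet S → BlockSet (decode (encode S))
    coded {S} = blockSet-cong (sym ∘ decode-encode S)
    S₀-coded = coded (proj₂ (some-blockSet conK h₀))
    nonempty : ∀ {k} → Fin k → BlockDecomposition K k → Σ ℕ λ r → BlockDecomposition K (suc r)
    nonempty {suc k} _ d = k , d
    decomposition : BlockDecomposition K (size BE)
    decomposition = record
      { block = λ i → induced (decode (at BE i))
      ; isBlock = λ i → blockSet⇒block conK h₀ (at-sound BE i)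
      ; distinct = λ i j s → at-injective BE i j (decode-injective (proj₂ s))
      ; complete = λ B b →
          let i , eq = at-complete BE (encode (es B)) (coded (block⇒blockSet conK h₀ {B} b))
              S≗ = λ e → trans (sym (decode-encode (es B) e)) (cong (λ k → decode k e) (sym eq))
              sv , se = block⇒same conK h₀ {B} b
              sv′ , se′ = induced-cong {es B} {decode (at BE i)} S≗
          in i , (λ v → trans (sv v) (sv′ v)) , S≗
      ; graphOf = λ i → proj₁ (restriction (induced (decode (at BE i))))
      ; realizes = λ i → proj₂ (restriction (induced (decode (at BE i))))
      }

  module Partition {S E₁ E₂ : ESet K} (part : ∀ e → S e ≡ true → E₁ e ≡ true ⊎ E₂ e ≡ true)
    (glue-unique : ∀ {y z} → Touches E₁ y → Touches E₂ y → Touches E₁ z → Touches E₂ z → y ≡ z)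
    {VP : V → Set} where

    private
      ends-touch : ∀ {T x w} e → T e ≡ true → Joins (ends K e) x w → Touches T x × Touches T w
      ends-touch e p (inj₁ (a , b)) = (e , p , inj₁ a) , (e , p , inj₂ b)
      ends-touch e p (inj₂ (a , b)) = (e , p , inj₂ b) , (e , p , inj₁ a)

    -- The walk leads from `E₁` to `E₂`; the first vertex at which it has an edge of `E₂` ahead, or
    -- at the latest its end, is touched by both.
    glue-exists : ∀ {x y} → Reach K VP (λ e → S e ≡ true) x y → Touches E₁ x → Touches E₂ y →
      ∃ λ z → Touches E₁ z × Touches E₂ z
    glue-exists (here _) p q = _ , p , q
    glue-exists (step e s _ j r) p q with part e s
    ... | inj₁ e₁ = glue-exists r (proj₂ (ends-touch {E₁} e e₁ j)) q
    ... | inj₂ e₂ = _ , p , proj₁ (ends-touch {E₂} e e₂ j)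

    -- Excursions into E₂ leave and return through the glue vertex z, so they can be cut out.
    shortcut : ∀ {x y z} → Touches E₁ z → Touches E₂ z → Reach K VP (λ e → S e ≡ true) x y → Touches E₁ y →
      (Touches E₁ x → Reach K (Touches E₁) (λ e → E₁ e ≡ true) x y) ×
      (Touches E₂ x → Reach K (Touches E₁) (λ e → E₁ e ≡ true) z y)
    shortcut {z = z} z₁ z₂ (here _) q = here , λ p → subst (λ v → Reach K (Touches E₁) (λ e → E₁ e ≡ true) v _) (glue-unique q p z₁ z₂) (here q)
    shortcut {x} {y} {z} z₁ z₂ (step e s _ j r) q with part e s | shortcut z₁ z₂ r q
    ... | inj₁ e₁ | (f₁ , _) =
      (λ p → path) , λ p → subst (λ v → Reach K (Touches E₁) (λ e → E₁ e ≡ true) v y) (glue-unique (proj₁ touch) p z₁ z₂) path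
      where
      touch = ends-touch {E₁} e e₁ j
      path = step e e₁ (proj₁ touch) j (f₁ (proj₂ touch))
    ... | inj₂ e₂ | (_ , f₂) =
      (λ p → subst (λ v → Reach K (Touches E₁) (λ e → E₁ e ≡ true) v y) (glue-unique z₁ z₂ p (proj₁ touch)) (f₂ (proj₂ touch))) ,
      λ p → f₂ (proj₂ touch)
      where
      touch = ends-touch {E₂} e e₂ j

  -- A partition into nonempty parts with at most one common vertex suffices: connectedness of `S`
  -- supplies that vertex and, by cutting out excursions, the connectedness of both parts.
  partition⇒separation : ∀ {S E₁ E₂} → ConnectedSub (induced S) →
    (∀ e → S e ≡ true → (E₁ e ≡ true × E₂ e ≡ false) ⊎ (E₁ e ≡ false × E₂ e ≡ true)) →
    Sub K E₁ S → Sub K E₂ S → (∃ λ e → E₁ e ≡ true) → (∃ λ e → E₂ e ≡ true) →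
    (∀ {y z} → Touches E₁ y → Touches E₂ y → Touches E₁ z → Touches E₂ z → y ≡ z) →
    Separation (induced S)
  partition⇒separation {S} {E₁} {E₂} (_ , con) part sub₁ sub₂ (e₁ , p₁) (e₂ , p₂) unique =
    E₁ , E₂ , part , sub₁ , sub₂ , (e₁ , p₁) , (e₂ , p₂) ,
    ((src e₁ , e₁ , p₁ , inj₁ refl) , λ u v p q →
      proj₁ (Left.shortcut z₁ z₂ (con u v (in-S sub₁ p) (in-S sub₁ q)) q) p) ,
    ((src e₂ , e₂ , p₂ , inj₁ refl) , λ u v p q →
      proj₁ (Right.shortcut z₂ z₁ (con u v (in-S sub₂ p) (in-S sub₂ q)) q) p) ,
    (λ v p → cover (induced⇒touches {S} p)) ,
    z , z₁ , z₂ , λ y y₁ y₂ → unique y₁ y₂ z₁ z₂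
    where
    part′ : ∀ e → S e ≡ true → E₁ e ≡ true ⊎ E₂ e ≡ true
    part′ e s = [ inj₁ ∘ proj₁ , inj₂ ∘ proj₂ ]′ (part e s)
    in-S : ∀ {T v} → Sub K T S → Touches T v → vs (induced S) v ≡ true
    in-S {T} {v} sub t = touches⇒induced {S} (touches-mono sub v t)
    module Left = Partition {S} {E₁} {E₂} part′ unique {λ v → vs (induced S) v ≡ true}
    module Right = Partition {S} {E₂} {E₁} (λ e s → swap (part′ e s)) (λ a b c d → unique b a d c) {λ v → vs (induced S) v ≡ true}
    t₁ : Touches E₁ (src e₁)
    t₁ = e₁ , p₁ , inj₁ refl
    t₂ : Touches E₂ (src e₂)
    t₂ = e₂ , p₂ , inj₁ refl
    glue : ∃ λ z → Touches E₁ z × Touches E₂ z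
    glue = Left.glue-exists (con _ _ (in-S sub₁ t₁) (in-S sub₂ t₂)) t₁ t₂
    z = proj₁ glue
    z₁ = proj₁ (proj₂ glue)
    z₂ = proj₂ (proj₂ glue)
    cover : ∀ {v} → Touches S v → Touches E₁ v ⊎ Touches E₂ v
    cover (e , s , i) = [ (λ p → inj₁ (e , p , i)) , (λ p → inj₂ (e , p , i)) ]′ (part′ e s)

-- Two one-point gluings of the same pair of graphs have the same blocks

-- Two contractions are presented as quotients π, π′ of one vertex set V, so that they share the edge set
-- Fin m; side tells apart the two parts of which each is glued together.
module TwoQuotients {V : Set} {m : ℕ} (s t : Fin m → V) (side : V → Bool)
  (side-edge : ∀ a → side (s a) ≡ side (t a)) where

  Quotient : ∀ {n} → (V → Fin n) → Graph
  Quotient {n} π = graph n m (λ a → π (s a) , π (t a))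

  -- Only vertices of one side are compared; across the sides the two quotients may identify
  -- different pairs.
  Refines : ∀ {n n′} → (V → Fin n) → (V → Fin n′) → Set
  Refines π π′ = ∀ {u v} → side u ≡ side v → π u ≡ π v → π′ u ≡ π′ v

  -- All identifications across the sides take place at a single vertex of the quotient.
  OneGluing : ∀ {n} → (V → Fin n) → Set
  OneGluing π = ∀ {u v u′ v′} → side u ≡ true → side v ≡ false → side u′ ≡ true → side v′ ≡ false →
    π u ≡ π v → π u′ ≡ π v′ → π u ≡ π u′

  Sided : (Fin m → Bool) → Bool → Set
  Sided S b = ∀ e → S e ≡ true → side (s e) ≡ b

  module _ {n} (π : V → Fin n) where
    open Blocks (Quotient π)

    touch-lift : ∀ {S b v} → Sided S b → Touches S v → ∃ λ u → side u ≡ b × π u ≡ v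
    touch-lift sd (e , p , inj₁ q) = s e , sd e p , q
    touch-lift sd (e , p , inj₂ q) = t e , trans (sym (side-edge e)) (sd e p) , q

    -- Otherwise the edges of `S` on either side form two nonempty parts that meet at most at the
    -- glue vertex, which is a separation.
    nonseparable⇒sided : OneGluing π → ∀ {S} → Nonseparable (induced S) → ∃ λ b → Sided S b
    nonseparable⇒sided glue {S} (con , ¬sep)
      with Fin.any? (λ e → (S e Bool.≟ true) ×-dec (side (s e) Bool.≟ true))
         | Fin.any? (λ e → (S e Bool.≟ true) ×-dec (side (s e) Bool.≟ false))
    ... | no none | _ = false , λ e p → lem e p
      where
      lem : ∀ e → S e ≡ true → side (s e) ≡ false
      lem e p with side (s e) in eq
      ... | false = refl
      ... | true = contradiction (e , p , eq) none
    ... | yes _ | no none = true , λ e p → lem e p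
      where
      lem : ∀ e → S e ≡ true → side (s e) ≡ true
      lem e p with side (s e) in eq
      ... | true = refl
      ... | false = contradiction (e , p , eq) none
    ... | yes (e₁ , p₁ , q₁) | yes (e₂ , p₂ , q₂) = contradiction
      (partition⇒separation {S} {E₁} {E₂} con part (λ e → proj₁ ∘ ∧-true⁻) (λ e → proj₁ ∘ ∧-true⁻)
        (e₁ , ∧-true⁺ p₁ q₁) (e₂ , ∧-true⁺ p₂ (not-true⁺ q₂)) unique) ¬sep
      where
      E₁ E₂ : Fin m → Bool
      E₁ e = S e ∧ side (s e)
      E₂ e = S e ∧ not (side (s e))
      part : ∀ e → S e ≡ true → (E₁ e ≡ true × E₂ e ≡ false) ⊎ (E₁ e ≡ false × E₂ e ≡ true)
      part e p with S e | side (s e)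
      part e refl | true | true = inj₁ (refl , refl)
      part e refl | true | false = inj₂ (refl , refl)
      sd₁ : Sided E₁ true
      sd₁ e p = proj₂ (∧-true⁻ {S e} p)
      sd₂ : Sided E₂ false
      sd₂ e p = not-true⁻ (proj₂ (∧-true⁻ {S e} p))
      unique : ∀ {y z} → Touches E₁ y → Touches E₂ y → Touches E₁ z → Touches E₂ z → y ≡ z
      unique y₁ y₂ z₁ z₂ with touch-lift sd₁ y₁ | touch-lift sd₂ y₂ | touch-lift sd₁ z₁ | touch-lift sd₂ z₂
      ... | a , sa , refl | b , sb , πb | c , sc , refl | d , sd , πd = glue sa sb sc sd (sym πb) (sym πd)

  module Transfer {n n′} (π : V → Fin n) (π′ : V → Fin n′) (π⇒π′ : Refines π π′) where

    private
      module B = Blocks (Quotient π)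
      module B′ = Blocks (Quotient π′)

    side-tgt : ∀ {S b e} → Sided S b → S e ≡ true → side (t e) ≡ b
    side-tgt {e = e} sd p = trans (sym (side-edge e)) (sd e p)

    touches-transfer : ∀ {S b u} → Sided S b → side u ≡ b → B.Touches S (π u) → B′.Touches S (π′ u)
    touches-transfer sd su (e , p , inj₁ q) = e , p , inj₁ (π⇒π′ (trans (sd e p) (sym su)) q)
    touches-transfer {S} sd su (e , p , inj₂ q) = e , p , inj₂ (π⇒π′ (trans (side-tgt {S} sd p) (sym su)) q)

    -- The walk is followed through representatives in `V` on side `b`, where vertices identified by
    -- `π` are identified by `π′` as well.
    reach-transfer : ∀ {S b u v x y} → Sided S b → Reach (Quotient π) (B.Touches S) (λ e → S e ≡ true) x y →
      π u ≡ x → π v ≡ y → side u ≡ b → side v ≡ b →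
      Reach (Quotient π′) (B′.Touches S) (λ e → S e ≡ true) (π′ u) (π′ v)
    reach-transfer {S} sd (here p) refl q su sv =
      subst (Reach (Quotient π′) _ _ _) (π⇒π′ (trans su (sym sv)) (sym q)) (here (touches-transfer sd su p))
    reach-transfer {S} sd (step e p q (inj₁ (j , k)) r) refl v su sv =
      step e p (touches-transfer sd su q) (inj₁ (π⇒π′ (trans (sd e p) (sym su)) j , refl))
        (reach-transfer sd r k v (side-tgt {S} sd p) sv)
    reach-transfer {S} sd (step e p q (inj₂ (j , k)) r) refl v su sv =
      step e p (touches-transfer sd su q) (inj₂ (refl , π⇒π′ (trans (side-tgt {S} sd p) (sym su)) k))
        (reach-transfer sd r j v (sd e p) sv)

  module Both {n n′} (π : V → Fin n) (π′ : V → Fin n′) (π⇒π′ : Refines π π′) (π′⇒π : Refines π′ π) where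

    private
      module B = Blocks (Quotient π)
      module B′ = Blocks (Quotient π′)
      module To = Transfer π π′ π⇒π′
      module From = Transfer π′ π π′⇒π

    touches-lift : ∀ {S b v} → Sided S b → B′.Touches S v → ∃ λ u → side u ≡ b × π′ u ≡ v × B.Touches S (π u)
    touches-lift sd q with touch-lift π′ sd q
    ... | u , su , refl = u , su , refl , From.touches-transfer sd su q

    connects-transfer : ∀ {S b} → Sided S b → B.Connects S (B.Touches S) → B′.Connects S (B′.Touches S)
    connects-transfer sd ((v , q) , con) with touch-lift π sd q
    ... | u , su , refl = (π′ u , To.touches-transfer sd su q) , λ x y p q →
      let u , su , ux , tu = touches-lift sd p
          v , sv , vy , tv = touches-lift sd q
      in subst (λ x → Reach _ _ _ x y) ux (subst (Reach _ _ _ _) vy (To.reach-transfer sd (con _ _ tu tv) refl refl su sv))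

    separation-transfer : ∀ {S b} → Sided S b → Separation (B.induced S) → Separation (B′.induced S)
    separation-transfer {S} sd (E₁ , E₂ , part , sub₁ , sub₂ , ne₁ , ne₂ , c₁ , c₂ , cover , x , x₁ , x₂ , uniq)
      with touch-lift π (λ e p → sd e (sub₁ e p)) x₁
    ... | u , su , refl =
      E₁ , E₂ , part , sub₁ , sub₂ , ne₁ , ne₂ , connects-transfer sd₁ c₁ , connects-transfer sd₂ c₂ ,
      (λ v p → cover′ (B′.induced⇒touches {S} p)) ,
      π′ u , To.touches-transfer sd₁ su x₁ , To.touches-transfer sd₂ su x₂ , λ y y₁ y₂ →
        let w , sw , wy , tw = touches-lift sd₁ y₁
        in trans (sym wy) (π⇒π′ (trans sw (sym su))
             (uniq (π w) tw (From.touches-transfer sd₂ sw (subst (B′.Touches E₂) (sym wy) y₂))))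
      where
      sd₁ : Sided E₁ _
      sd₁ e p = sd e (sub₁ e p)
      sd₂ : Sided E₂ _
      sd₂ e p = sd e (sub₂ e p)
      cover′ : ∀ {v} → B′.Touches S v → B′.Touches E₁ v ⊎ B′.Touches E₂ v
      cover′ (e , p , i) = [ (λ (q , _) → inj₁ (e , q , i)) , (λ (_ , q) → inj₂ (e , q , i)) ]′ (part e p)

    -- The graph `J` and its edge map are kept; a vertex is lifted to side `b` and projected by
    -- `π′`.
    realizes-transfer : ∀ {S b J} → Sided S b → Realizes (Quotient π) (B.induced S) J → Realizes (Quotient π′) (B′.induced S) J
    realizes-transfer {S} {b} {J} sd r = record
      { ιV = π′ ∘ lift
      ; ιE = ιE
      ; ιV-inj = λ a a′ eq → ιV-inj a a′ (trans (sym (lift-π a)) (trans (π′⇒π (trans (lift-side a) (sym (lift-side a′))) eq) (lift-π a′)))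
      ; ιE-inj = ιE-inj
      ; ιV-in = λ a → B′.touches⇒induced {S} (To.touches-transfer sd (lift-side a)
          (subst (B.Touches S) (sym (lift-π a)) (B.induced⇒touches {S} (ιV-in a))))
      ; ιE-in = ιE-in
      ; ιV-onto = λ v p → onto (touches-lift sd (B′.induced⇒touches {S} p))
      ; ιE-onto = ιE-onto
      ; ends-ok = λ a → ends-lift a (ends-ok a)
      }
      where
      open Realizes r
      lifted : ∀ a → ∃ λ u → side u ≡ b × π u ≡ ιV a
      lifted a = touch-lift π sd (B.induced⇒touches {S} (ιV-in a))
      lift : Fin (nV J) → V
      lift a = proj₁ (lifted a)
      lift-side : ∀ a → side (lift a) ≡ b
      lift-side a = proj₁ (proj₂ (lifted a))
      lift-π : ∀ a → π (lift a) ≡ ιV a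
      lift-π a = proj₂ (proj₂ (lifted a))
      onto : ∀ {v} → (∃ λ u → side u ≡ b × π′ u ≡ v × B.Touches S (π u)) → ∃ λ a → π′ (lift a) ≡ v
      onto (u , su , refl , tu) with ιV-onto (π u) (B.touches⇒induced {S} tu)
      ... | a , eq = a , π⇒π′ (trans (lift-side a) (sym su)) (trans (lift-π a) eq)
      at-end : ∀ {u} a → side u ≡ b → π u ≡ ιV a → π′ u ≡ π′ (lift a)
      at-end a su eq = π⇒π′ (trans su (sym (lift-side a))) (trans eq (sym (lift-π a)))
      ends-lift : ∀ a → Joins (ends (Quotient π) (ιE a)) (ιV (proj₁ (ends J a))) (ιV (proj₂ (ends J a))) →
        Joins (ends (Quotient π′) (ιE a)) (π′ (lift (proj₁ (ends J a)))) (π′ (lift (proj₂ (ends J a))))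
      ends-lift a (inj₁ (p , q)) = inj₁ (at-end _ (sd _ (ιE-in a)) p , at-end _ (To.side-tgt {S} sd (ιE-in a)) q)
      ends-lift a (inj₂ (p , q)) = inj₂ (at-end _ (sd _ (ιE-in a)) p , at-end _ (To.side-tgt {S} sd (ιE-in a)) q)

  module Pivot {n n′} (π : V → Fin n) (π′ : V → Fin n′) (π⇒π′ : Refines π π′) (π′⇒π : Refines π′ π)
    (glue : OneGluing π) where

    private
      module B = Blocks (Quotient π)
      module B′ = Blocks (Quotient π′)
      module To = Both π π′ π⇒π′ π′⇒π
      module From = Both π′ π π′⇒π π⇒π′

    nonseparable-transfer : ∀ {S} → Nonseparable (B.induced S) → Nonseparable (B′.induced S)
    nonseparable-transfer {S} ns@(con , ¬sep) with nonseparable⇒sided π glue ns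
    ... | b , sd =
      B′.connects-map (λ _ → refl) (λ v → B′.touches⇒induced {S}) (λ v → B′.induced⇒touches {S})
        (To.connects-transfer sd (B.connects-map (λ _ → refl) (λ v → B.induced⇒touches {S}) (λ v → B.touches⇒induced {S}) con)) ,
      ¬sep ∘ From.separation-transfer sd

  module Decompositions {n n′} (π : V → Fin n) (π′ : V → Fin n′) (π⇒π′ : Refines π π′) (π′⇒π : Refines π′ π)
    (glue : OneGluing π) (glue′ : OneGluing π′)
    (con : ConnectedGraph (Quotient π)) (con′ : ConnectedGraph (Quotient π′)) (e₀ : Fin m) where

    private
      module B = Blocks (Quotient π)
      module B′ = Blocks (Quotient π′)
      module To = Pivot π π′ π⇒π′ π′⇒π glue
      module From = Pivot π′ π π′⇒π π⇒π′ glue′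

    blockSet-transfer : ∀ {S} → B.BlockSet S → B′.BlockSet S
    blockSet-transfer (ne , ns , max) = ne , To.nonseparable-transfer ns , λ S′ ns′ → max S′ (From.nonseparable-transfer ns′)

    blockSet-transfer⁻ : ∀ {S} → B′.BlockSet S → B.BlockSet S
    blockSet-transfer⁻ (ne , ns , max) = ne , From.nonseparable-transfer ns , λ S′ ns′ → max S′ (To.nonseparable-transfer ns′)

    -- Both the edge sets of the blocks and the graphs realizing them stay the same, so the block
    -- formula receives equal arguments for the two quotients.
    decomposition-transfer : ∀ {r} → (d : BlockDecomposition (Quotient π) r) →
      Σ (BlockDecomposition (Quotient π′) r) λ d′ → ∀ i → graphOf d′ i ≡ graphOf d i
    decomposition-transfer d = record
      { block = λ i → B′.induced (S i)
      ; isBlock = λ i → B′.blockSet⇒block con′ e₀ (blockSet-transfer (blockSet i))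
      ; distinct = λ i j (_ , se) → distinct d i j (same i j se)
      ; complete = λ B b →
          let bs = B′.block⇒blockSet con′ e₀ {B} b
              i , _ , se = complete d (B.induced (es B)) (B.blockSet⇒block con e₀ (blockSet-transfer⁻ bs))
              sv , _ = B′.block⇒same con′ e₀ {B} b
              sv′ , _ = B′.induced-cong {es B} {S i} se
          in i , (λ v → trans (sv v) (sv′ v)) , se
      ; graphOf = graphOf d
      ; realizes = λ i → Both.realizes-transfer π π′ π⇒π′ π′⇒π (proj₂ (nonseparable⇒sided π glue (proj₁ (proj₂ (blockSet i))))) (realizes′ i)
      } , λ i → refl
      where
      S : _ → Fin m → Bool
      S i = es (block d i)
      blockSet : ∀ i → B.BlockSet (S i)
      blockSet i = B.block⇒blockSet con e₀ {block d i} (isBlock d i)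
      same : ∀ i j → S i ≗ S j → SameSubgraph (block d i) (block d j)
      same i j se =
        let vi , _ = B.block⇒same con e₀ {block d i} (isBlock d i)
            vj , _ = B.block⇒same con e₀ {block d j} (isBlock d j)
            v , _ = B.induced-cong {S i} {S j} se
        in (λ x → trans (vi x) (trans (v x) (sym (vj x)))) , se
      realizes′ : ∀ i → Realizes (Quotient π) (B.induced (S i)) (graphOf d i)
      realizes′ i = record
        { ιV = ιV ; ιE = ιE ; ιV-inj = ιV-inj ; ιE-inj = ιE-inj
        ; ιV-in = λ a → trans (sym (sv _)) (ιV-in a) ; ιE-in = ιE-in
        ; ιV-onto = λ v p → ιV-onto v (trans (sv v) p) ; ιE-onto = ιE-onto ; ends-ok = ends-ok }
        where
        open Realizes (realizes d i)
        sv = proj₁ (B.block⇒same con e₀ {block d i} (isBlock d i))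

-- When two contractions have the same value of a block invariant

module Contractions {c ℓ} (𝓢 : Setoid c ℓ) (ψ : Graph → Setoid.Carrier 𝓢)
  (inv : IsBlockInvariant (Setoid.Carrier 𝓢) (Setoid._≈_ 𝓢) ψ)
  (G : Graph) (conG : ConnectedGraph G) (H : ESet G) where

  open Connectivity G
  open Setoid 𝓢 using (_≈_) renaming (reflexive to ≈-reflexive; sym to ≈-sym; trans to ≈-trans)
  open IsBlockInvariant inv
  open RealizesContraction

  In : ESet G → E → Set
  In C g = C g ≡ true

  joins-map : ∀ {A B : Set} (h : A → B) {a b u v} → Joins (a , b) u v → Joins (h a , h b) (h u) (h v)
  joins-map h (inj₁ (refl , refl)) = inj₁ (refl , refl)
  joins-map h (inj₂ (refl , refl)) = inj₂ (refl , refl)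

  joins-trans : ∀ {A : Set} {a b u v x y : A} → Joins (a , b) u v → Joins (u , v) x y → Joins (a , b) x y
  joins-trans (inj₁ (refl , refl)) j = j
  joins-trans (inj₂ (refl , refl)) (inj₁ (p , q)) = inj₂ (q , p)
  joins-trans (inj₂ (refl , refl)) (inj₂ (p , q)) = inj₁ (q , p)

  joins-sym : ∀ {A : Set} {a b u v : A} → Joins (a , b) u v → Joins (u , v) a b
  joins-sym (inj₁ (refl , refl)) = inj₁ (refl , refl)
  joins-sym (inj₂ (refl , refl)) = inj₂ (refl , refl)

  module _ {C C′ : ESet G} {K K′ : Graph} (R : RealizesContraction G H C K) (R′ : RealizesContraction G H C′ K′)
    (C⇒C′ : ∀ {u v} → Conn (In C) u v → Conn (In C′) u v) (C′⇒C : ∀ {u v} → Conn (In C′) u v → Conn (In C) u v) where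

    private
      fV : Fin (nV K) → Fin (nV K′)
      fV a = π R′ (proj₁ (π-onto R a))
      gV : Fin (nV K′) → Fin (nV K)
      gV a = π R (proj₁ (π-onto R′ a))
      fE : Fin (nE K) → Fin (nE K′)
      fE a = proj₁ (ε-onto R′ (ε R a) (ε-in R a))
      ε-fE : ∀ a → ε R′ (fE a) ≡ ε R a
      ε-fE a = proj₂ (ε-onto R′ (ε R a) (ε-in R a))
      gE : Fin (nE K′) → Fin (nE K)
      gE a = proj₁ (ε-onto R (ε R′ a) (ε-in R′ a))
      ε-gE : ∀ a → ε R (gE a) ≡ ε R′ a
      ε-gE a = proj₂ (ε-onto R (ε R′ a) (ε-in R′ a))
      fV-π : ∀ v → fV (π R v) ≡ π R′ v
      fV-π v = π-ker₂ R′ _ _ (C⇒C′ (π-ker₁ R _ _ (proj₂ (π-onto R (π R v)))))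
      gV-π : ∀ v → gV (π R′ v) ≡ π R v
      gV-π v = π-ker₂ R _ _ (C′⇒C (π-ker₁ R′ _ _ (proj₂ (π-onto R′ (π R′ v)))))

    -- Both graphs are quotients of `G` by the same relation, with the zero edges as edges. The
    -- vertex maps choose a preimage in `G` and project it to the other quotient.
    contraction-iso : Iso K K′
    contraction-iso = record
      { fV = fV ; gV = gV ; fE = fE ; gE = gE
      ; gfV = λ a → trans (gV-π _) (proj₂ (π-onto R a))
      ; fgV = λ a → trans (fV-π _) (proj₂ (π-onto R′ a))
      ; gfE = λ a → ε-inj R _ _ (trans (ε-gE (fE a)) (ε-fE a))
      ; fgE = λ a → ε-inj R′ _ _ (trans (ε-fE (gE a)) (ε-gE a))
      ; ends-pres = λ a → joins-trans (joins-trans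
          (subst (λ g → Joins (ends K′ (fE a)) (π R′ (src g)) (π R′ (tgt g))) (ε-fE a) (ends-ok R′ (fE a)))
          (inj₁ (sym (fV-π _) , sym (fV-π _))))
          (joins-map fV (joins-sym (ends-ok R a)))
      }

  contraction-connected : ∀ {C K} → RealizesContraction G H C K → Connected (λ g → In C g ⊎ In H g) → ConnectedGraph K
  contraction-connected {C} {K} R con = (π R (proj₁ (proj₁ conG)) , tt) , λ a b _ _ →
    let u , eu = π-onto R a
        v , ev = π-onto R b
    in subst (λ a → Reach K _ _ a b) eu (subst (Reach K _ _ _) ev (push (con u v)))
    where
    push : ∀ {u v} → Conn (λ g → In C g ⊎ In H g) u v → Reach K (λ _ → ⊤) (λ _ → ⊤) (π R u) (π R v)
    push (here _) = here tt
    push {v = v} (step {u} {w} g (inj₁ p) _ j r) =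
      subst (λ a → Reach K (λ _ → ⊤) (λ _ → ⊤) a (π R v)) (sym (π-ker₂ R u w (step g p tt j (here tt)))) (push r)
    push (step g (inj₂ p) _ j r) with ε-onto R g p
    ... | a , refl = step a tt tt (joins-trans (ends-ok R a) (joins-map (π R) j)) (push r)

  contraction-invariant : ∀ {C C′ K K′} → RealizesContraction G H C K → RealizesContraction G H C′ K′ →
    (∀ {u v} → Conn (In C) u v → Conn (In C′) u v) → (∀ {u v} → Conn (In C′) u v → Conn (In C) u v) →
    Connected (λ g → In C g ⊎ In H g) → Connected (λ g → In C′ g ⊎ In H g) → ψ K ≈ ψ K′
  contraction-invariant R R′ to from con con′ =
    iso-invariant _ _ (contraction-connected R con) (contraction-connected R′ con′) (contraction-iso R R′ to from)

  block-formula : ∀ {r K K′} → 1 ≤ r → ConnectedGraph K → ConnectedGraph K′ → (d : BlockDecomposition K r) →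
    (Σ (BlockDecomposition K′ r) λ d′ → ∀ i → graphOf d′ i ≡ graphOf d i) → ψ K ≈ ψ K′
  block-formula {r} le conK conK′ d (d′ , same) with combine r le
  ... | F , _ , F-cong , value = ≈-trans (value _ conK d)
    (≈-trans (F-cong _ _ λ i → ≈-reflexive (cong ψ (sym (same i)))) (≈-sym (value _ conK′ d′)))

  module Exchange {N P : E → Set} (P? : Decidable P) (N⊆P : ∀ g → N g → P g) (H⊆P : ∀ g → In H g → P g)
    {e : E} (P-e : ¬ Spanned P e) (P-connected : ∀ {u} → Conn P u (src e) ⊎ Conn P u (tgt e)) where

    -- `P` has exactly two components, that of `src e` and that of `tgt e`; `side` distinguishes
    -- them.
    side : V → Bool
    side v = ⌊ conn? P? v (src e) ⌋

    side-cong : ∀ {u v} → Conn P u v → side u ≡ side v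
    side-cong {u} {v} r = true-⇔⇒≡
      (λ p → ⌊⌋-true (conn? P? v (src e)) (conn-trans (conn-sym r) (dec-true⁻ (conn? P? u (src e)) p)))
      (λ p → ⌊⌋-true (conn? P? u (src e)) (conn-trans r (dec-true⁻ (conn? P? v (src e)) p)))

    same-side⇒conn : ∀ {u v} → side u ≡ side v → Conn P u v
    same-side⇒conn {u} {v} eq with conn? P? u (src e) | conn? P? v (src e)
    ... | yes p | yes q = conn-trans p (conn-sym q)
    ... | no p | no q = conn-trans (far p) (conn-sym (far q))
      where
      far : ∀ {x} → ¬ Conn P x (src e) → Conn P x (tgt e)
      far {x} n = [ (λ c → contradiction c n) , (λ c → c) ]′ (P-connected {x})

    module _ {C : ESet G} {f : E} (C-split : ∀ g → In C g → g ≡ f ⊎ N g) (N⊆C : ∀ g → N g → In C g) (P-f : ¬ Spanned P f) where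

      -- A walk that needs `f` ends in the other component of `P`, for otherwise `P` would span `f`.
      same-side : ∀ {u v} → side u ≡ side v → Conn (In C) u v → Conn N u v
      same-side eq r with conn-split C-split r
      ... | inj₁ n = n
      ... | inj₂ (inj₁ (a , b)) = contradiction
        (conn-trans (conn-sym (conn-mono N⊆P a)) (conn-trans (same-side⇒conn eq) (conn-sym (conn-mono N⊆P b)))) P-f
      ... | inj₂ (inj₂ (a , b)) = contradiction
        (conn-sym (conn-trans (conn-sym (conn-mono N⊆P a)) (conn-trans (same-side⇒conn eq) (conn-sym (conn-mono N⊆P b))))) P-f

      crossing : ∀ {u v} → side u ≡ true → side v ≡ false → Conn (In C) u v → Conn N u (src f) ⊎ Conn N u (tgt f)
      crossing su sv r with conn-split C-split r
      ... | inj₁ n = ⊥-elim (true≢false su (trans (side-cong (conn-mono N⊆P n)) sv))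
      ... | inj₂ (inj₁ (a , _)) = inj₁ a
      ... | inj₂ (inj₂ (a , _)) = inj₂ a

      -- Every crossing uses `f`, so `u` and `u′` both reach an end of `f` within `N`. It is the
      -- same end, since `u` and `u′` lie in one component of `P`.
      gluing : ∀ {u v u′ v′} → side u ≡ true → side v ≡ false → side u′ ≡ true → side v′ ≡ false →
        Conn (In C) u v → Conn (In C) u′ v′ → Conn (In C) u u′
      gluing {u} {u′ = u′} su sv su′ sv′ r r′ = conn-mono N⊆C (go (crossing su sv r) (crossing su′ sv′ r′))
        where
        u~u′ : Conn P u u′
        u~u′ = same-side⇒conn (trans su (sym su′))
        go : Conn N u (src f) ⊎ Conn N u (tgt f) → Conn N u′ (src f) ⊎ Conn N u′ (tgt f) → Conn N u u′
        go (inj₁ a) (inj₁ b) = conn-trans a (conn-sym b)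
        go (inj₂ a) (inj₂ b) = conn-trans a (conn-sym b)
        go (inj₁ a) (inj₂ b) = contradiction
          (conn-trans (conn-sym (conn-mono N⊆P a)) (conn-trans u~u′ (conn-mono N⊆P b))) P-f
        go (inj₂ a) (inj₁ b) = contradiction
          (conn-trans (conn-sym (conn-mono N⊆P b)) (conn-trans (conn-sym u~u′) (conn-mono N⊆P a))) P-f

  -- C and C′ arise from N by adding e and f.  Each of e, f joins the two components of N ∪ H, so the
  -- two contractions glue the same pair of graphs at a vertex and have the same blocks.
  twin-invariant : ∀ {N P : E → Set} {C C′ K K′ e f} → Decidable P → (∀ g → N g → P g) → (∀ g → In H g → P g) →
    (∀ g → In C g ⊎ In H g → g ≡ e ⊎ P g) →
    (∀ g → In C g → g ≡ e ⊎ N g) → (∀ g → N g → In C g) → ¬ Spanned P e →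
    (∀ g → In C′ g → g ≡ f ⊎ N g) → (∀ g → N g → In C′ g) → ¬ Spanned P f →
    Connected (λ g → In C g ⊎ In H g) → Connected (λ g → In C′ g ⊎ In H g) →
    RealizesContraction G H C K → RealizesContraction G H C′ K′ → ψ K ≈ ψ K′
  twin-invariant {N} {P} {C} {C′} {K} {K′} {e} {f} P? N⊆P H⊆P CH-split C-split N⊆C P-e C′-split N⊆C′ P-f con con′ R R′ =
    go (nE K) refl
    where
    P-connected : ∀ {u} → Conn P u (src e) ⊎ Conn P u (tgt e)
    P-connected {u} with conn-split CH-split (con u (src e))
    ... | inj₁ c = inj₁ c
    ... | inj₂ (inj₁ (c , _)) = inj₁ c
    ... | inj₂ (inj₂ (c , _)) = inj₂ c
    open Exchange {N} {P} P? N⊆P H⊆P {e} P-e P-connected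
    module TQ = TwoQuotients (src ∘ ε R) (tgt ∘ ε R) side (λ a → side-cong (edge⇒spanned (H⊆P _ (ε-in R a))))
    -- Both contractions are rebuilt with the edge map of `R`, so that they have literally the same
    -- edges.
    requotient : ∀ {D L} → RealizesContraction G H D L → Σ Graph (RealizesContraction G H D)
    requotient S = TQ.Quotient (π S) , record
      { π = π S ; π-onto = π-onto S ; π-ker₁ = π-ker₁ S ; π-ker₂ = π-ker₂ S
      ; ε = ε R ; ε-inj = ε-inj R ; ε-in = ε-in R ; ε-onto = ε-onto R ; ends-ok = λ a → inj₁ (refl , refl) }
    Q = proj₂ (requotient R)
    Q′ = proj₂ (requotient R′)
    refine : TQ.Refines (π R) (π R′)
    refine eq p = π-ker₂ R′ _ _ (conn-mono N⊆C′ (same-side {C} C-split N⊆C P-e eq (π-ker₁ R _ _ p)))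
    refine′ : TQ.Refines (π R′) (π R)
    refine′ eq p = π-ker₂ R _ _ (conn-mono N⊆C (same-side {C′} C′-split N⊆C′ P-f eq (π-ker₁ R′ _ _ p)))
    glue : TQ.OneGluing (π R)
    glue a b c d p q = π-ker₂ R _ _ (gluing {C} C-split N⊆C P-e a b c d (π-ker₁ R _ _ p) (π-ker₁ R _ _ q))
    glue′ : TQ.OneGluing (π R′)
    glue′ a b c d p q = π-ker₂ R′ _ _ (gluing {C′} C′-split N⊆C′ P-f a b c d (π-ker₁ R′ _ _ p) (π-ker₁ R′ _ _ q))
    no-zero-edges : nE K ≡ 0 → ∀ {D u v} → Connected (λ g → In D g ⊎ In H g) → Conn (In D) u v
    no-zero-edges eq {D} {u} {v} con = conn-mono
      (λ g → [ (λ p → p) , (λ p → ⊥-elim (Fin0 (subst Fin eq (proj₁ (ε-onto R g p))))) ]′) (con u v)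
      where
      Fin0 : Fin 0 → ⊥
      Fin0 ()
    go : ∀ m → nE K ≡ m → ψ K ≈ ψ K′
    -- Without zero edges both contracted sets connect all of `G`, so both contractions are single
    -- vertices.
    go zero eq = contraction-invariant R R′ (λ _ → no-zero-edges eq con′) (λ _ → no-zero-edges eq con) con con′
    go (suc m) eq = ≈-trans (contraction-invariant R Q (λ c → c) (λ c → c) con con)
      (≈-trans same-blocks (contraction-invariant Q′ R′ (λ c → c) (λ c → c) con′ con′))
      where
      e₀ : Fin (nE K)
      e₀ = subst Fin (sym eq) zero
      conQ = contraction-connected Q con
      conQ′ = contraction-connected Q′ con′
      open TQ.Decompositions (π R) (π R′) refine refine′ glue glue′ conQ conQ′ e₀
      same-blocks : ψ (proj₁ (requotient R)) ≈ ψ (proj₁ (requotient R′))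
      same-blocks = transfer (Blocks.blockDecomposition (TQ.Quotient (π R)) conQ e₀)
        where
        transfer : (Σ ℕ λ r → BlockDecomposition (TQ.Quotient (π R)) (suc r)) → ψ (TQ.Quotient (π R)) ≈ ψ (TQ.Quotient (π R′))
        transfer (r , d) = block-formula {suc r} (s≤s z≤n) conQ conQ′ d (decomposition-transfer d)

-- The polynomial ring and its quotient by the ideal

module Polynomials {c ℓ a} (R : CommutativeRing c ℓ) (Λ : Set a) where
  open CommutativeRing R using (0#; 1#)
  open Poly R Λ

  polynomialRing : CommutativeRing (c ⊔ a) (c ⊔ ℓ ⊔ a)
  polynomialRing = record
    { Carrier = Expr ; _≈_ = _≋_ ; _+_ = _⊕_ ; _*_ = _⊗_ ; -_ = ⊖_ ; 0# = con 0# ; 1# = con 1#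
    ; isCommutativeRing = record
      { isRing = record
        { +-isAbelianGroup = record
          { isGroup = record
            { isMonoid = record
              { isSemigroup = record
                { isMagma = record
                  { isEquivalence = record { refl = ≋-refl ; sym = ≋-sym ; trans = ≋-trans }
                  ; ∙-cong = ⊕-cong }
                ; assoc = ⊕-assoc }
              ; identity = ⊕-idˡ , λ p → ≋-trans (⊕-comm p _) (⊕-idˡ p) }
            ; inverse = ⊖-invˡ , λ p → ≋-trans (⊕-comm p _) (⊖-invˡ p)
            ; ⁻¹-cong = ⊖-cong }
          ; comm = ⊕-comm }
        ; *-cong = ⊗-cong
        ; *-assoc = ⊗-assoc
        ; *-identity = ⊗-idˡ , λ p → ≋-trans (⊗-comm p _) (⊗-idˡ p)
        ; distrib = distribˡ , λ p q r → ≋-trans (⊗-comm _ p) (≋-trans (distribˡ p q r) (⊕-cong (⊗-comm p q) (⊗-comm p r))) }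
      ; *-comm = ⊗-comm } }

  module Quotient {i} (I : Ideal i) where
    private module P = CommutativeRing polynomialRing
    open SetoidReasoning P.setoid
    open NaturalSolver P.commutativeSemiring using (solve; _:=_; _:+_; _:*_)
    open AbelianGroupProperties P.+-abelianGroup using (⁻¹-∙-comm)
    open RingProperties P.ring using (-1*x≈-x)

    -- Naming the difference `m` instead of using `p ⊝ q` lets the congruence laws be checked by the
    -- semiring solver; `≈ᴵ⇒member` and `member⇒≈ᴵ` translate.
    _≈ᴵ_ : Expr → Expr → Set (c ⊔ ℓ ⊔ a ⊔ i)
    p ≈ᴵ q = ∃ λ m → member I m × p ≋ q ⊕ m

    ≋⇒≈ᴵ : ∀ {p q} → p ≋ q → p ≈ᴵ q
    ≋⇒≈ᴵ {p} {q} eq = con 0# , member-0 I , ≋-trans eq (≋-sym (P.+-identityʳ q))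

    member-neg : ∀ {m} → member I m → member I (⊖ m)
    member-neg {m} p = member-resp I (-1*x≈-x m) (member-* I _ p)

    ≈ᴵ-sym : ∀ {p q} → p ≈ᴵ q → q ≈ᴵ p
    ≈ᴵ-sym {p} {q} (m , mI , eq) = ⊖ m , member-neg mI , (begin
      q              ≈⟨ P.+-identityʳ q ⟨
      q ⊕ con 0#     ≈⟨ P.+-congˡ (P.-‿inverseʳ m) ⟨
      q ⊕ (m ⊕ ⊖ m)  ≈⟨ P.+-assoc q m (⊖ m) ⟨
      (q ⊕ m) ⊕ ⊖ m  ≈⟨ P.+-congʳ eq ⟨
      p ⊕ ⊖ m        ∎)

    ≈ᴵ-trans : ∀ {p q r} → p ≈ᴵ q → q ≈ᴵ r → p ≈ᴵ r
    ≈ᴵ-trans {p} {q} {r} (m , mI , eq) (k , kI , eq′) = k ⊕ m , member-+ I kI mI ,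
      ≋-trans eq (≋-trans (P.+-congʳ eq′) (P.+-assoc r k m))

    quotientRing : CommutativeRing (c ⊔ a) (c ⊔ ℓ ⊔ a ⊔ i)
    quotientRing = record
      { Carrier = Expr ; _≈_ = _≈ᴵ_ ; _+_ = _⊕_ ; _*_ = _⊗_ ; -_ = ⊖_ ; 0# = con 0# ; 1# = con 1#
      ; isCommutativeRing = record
        { isRing = record
          { +-isAbelianGroup = record
            { isGroup = record
              { isMonoid = record
                { isSemigroup = record
                  { isMagma = record
                    { isEquivalence = record { refl = ≋⇒≈ᴵ ≋-refl ; sym = ≈ᴵ-sym ; trans = ≈ᴵ-trans }
                    ; ∙-cong = λ {p} {p′} {q} {q′} (m , mI , eq) (k , kI , eq′) → m ⊕ k , member-+ I mI kI ,
                        ≋-trans (⊕-cong eq eq′)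
                          (solve 4 (λ p m q k → (p :+ m) :+ (q :+ k) := (p :+ q) :+ (m :+ k)) ≋-refl p′ m q′ k) }
                  ; assoc = λ p q r → ≋⇒≈ᴵ (⊕-assoc p q r) }
                ; identity = (λ p → ≋⇒≈ᴵ (P.+-identityˡ p)) , λ p → ≋⇒≈ᴵ (P.+-identityʳ p) }
              ; inverse = (λ p → ≋⇒≈ᴵ (P.-‿inverseˡ p)) , λ p → ≋⇒≈ᴵ (P.-‿inverseʳ p)
              ; ⁻¹-cong = λ {p} {q} (m , mI , eq) → ⊖ m , member-neg mI ,
                  ≋-trans (⊖-cong eq) (≋-sym (⁻¹-∙-comm q m)) }
            ; comm = λ p q → ≋⇒≈ᴵ (⊕-comm p q) }
          ; *-cong = λ {p} {p′} {q} {q′} (m , mI , eq) (k , kI , eq′) → (p′ ⊗ k ⊕ q′ ⊗ m) ⊕ k ⊗ m ,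
              member-+ I (member-+ I (member-* I p′ kI) (member-* I q′ mI)) (member-* I k mI) ,
              ≋-trans (⊗-cong eq eq′)
                (solve 4 (λ p m q k → (p :+ m) :* (q :+ k) := (p :* q) :+ ((p :* k :+ q :* m) :+ k :* m)) ≋-refl p′ m q′ k)
          ; *-assoc = λ p q r → ≋⇒≈ᴵ (⊗-assoc p q r)
          ; *-identity = (λ p → ≋⇒≈ᴵ (P.*-identityˡ p)) , λ p → ≋⇒≈ᴵ (P.*-identityʳ p)
          ; distrib = (λ p q r → ≋⇒≈ᴵ (P.distribˡ p q r)) , λ p q r → ≋⇒≈ᴵ (P.distribʳ p q r) }
        ; *-comm = λ p q → ≋⇒≈ᴵ (⊗-comm p q) } }

    ≈ᴵ⇒member : ∀ {p q} → p ≈ᴵ q → member I (p ⊝ q)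
    ≈ᴵ⇒member {p} {q} (m , mI , eq) = member-resp I (begin
      m              ≈⟨ P.+-identityʳ m ⟨
      m ⊕ con 0#     ≈⟨ P.+-congˡ (P.-‿inverseʳ q) ⟨
      m ⊕ (q ⊕ ⊖ q)  ≈⟨ P.+-assoc m q (⊖ q) ⟨
      (m ⊕ q) ⊕ ⊖ q  ≈⟨ P.+-congʳ (⊕-comm m q) ⟩
      (q ⊕ m) ⊕ ⊖ q  ≈⟨ P.+-congʳ eq ⟨
      p ⊝ q          ∎) mI

    member⇒≈ᴵ : ∀ {p q} → member I (p ⊝ q) → p ≈ᴵ q
    member⇒≈ᴵ {p} {q} mI = p ⊝ q , mI , (begin
      p              ≈⟨ P.+-identityʳ p ⟨
      p ⊕ con 0#     ≈⟨ P.+-congˡ (P.-‿inverseˡ q) ⟨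
      p ⊕ (⊖ q ⊕ q)  ≈⟨ P.+-assoc p (⊖ q) q ⟨
      (p ⊝ q) ⊕ q    ≈⟨ ⊕-comm _ q ⟩
      q ⊕ (p ⊝ q)    ∎)

module _ {q ℓq} (Q : CommutativeRing q ℓq) where
  open CommutativeRing Q
    using (_≈_; _+_; _-_; -_; setoid; commutativeSemiring; +-assoc; +-congˡ; +-congʳ; +-identityʳ; -‿inverseˡ)
    renaming (refl to ≈-refl; trans to ≈-trans)
  open SetoidReasoning setoid
  open NaturalSolver commutativeSemiring using (solve; _:=_; _:+_)
  private
    cancel : ∀ x y → (x - y) + y ≈ x
    cancel x y = ≈-trans (+-assoc x (- y) y) (≈-trans (+-congˡ (-‿inverseˡ y)) (+-identityʳ x))

  difference⇒sum : ∀ {a b c d} → a - b ≈ c - d → a + d ≈ c + b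
  difference⇒sum {a} {b} {c} {d} eq = begin
    a + d              ≈⟨ +-congʳ (cancel a b) ⟨
    ((a - b) + b) + d  ≈⟨ +-congʳ (+-congʳ eq) ⟩
    ((c - d) + b) + d  ≈⟨ solve 3 (λ x b d → (x :+ b) :+ d := (x :+ d) :+ b) ≈-refl (c - d) b d ⟩
    ((c - d) + d) + b  ≈⟨ +-congʳ (cancel c d) ⟩
    c + b              ∎

  sum⇒difference : ∀ {a b c d} → a + d ≈ c + b → a - b ≈ c - d
  sum⇒difference {a} {b} {c} {d} eq = begin
    a - b                    ≈⟨ cancel (a - b) d ⟨
    ((a - b) - d) + d        ≈⟨ solve 4 (λ a b d d′ → ((a :+ b) :+ d) :+ d′ := (a :+ d′) :+ (b :+ d)) ≈-refl a (- b) (- d) d ⟩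
    (a + d) + (- b + - d)    ≈⟨ +-congʳ eq ⟩
    (c + b) + (- b + - d)    ≈⟨ solve 4 (λ c b b′ d → (c :+ b) :+ (b′ :+ d) := ((c :+ d) :+ b′) :+ b) ≈-refl c b (- b) (- d) ⟩
    ((c - d) - b) + b        ≈⟨ cancel (c - d) b ⟩
    c - d                    ∎

-- From (b) to (a): the regular edges by decreasing label, and the comparison of two labelings

module SortedEdges (G : Graph) (H : ESet G) where

  regularEdges : List (Fin (nE G))
  regularEdges = filter (λ g → H g Bool.≟ false) (allFin _)

  byLabel : (Fin (nE G) → ℕ) → DecTotalOrder _ _ _
  byLabel φ = On.decTotalOrder (Flip.decTotalOrder ℕ.≤-decTotalOrder) φ

  descending : (Fin (nE G) → ℕ) → List (Fin (nE G))
  descending φ = Sort.sort (byLabel φ) regularEdges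

  descending-↭ : ∀ φ → descending φ ↭ regularEdges
  descending-↭ φ = Sort.sort-↭ (byLabel φ) regularEdges

  ∈-descending⁻ : ∀ φ {g} → g ∈ descending φ → H g ≡ false
  ∈-descending⁻ φ m = proj₂ (∈-filter⁻ (λ g → H g Bool.≟ false) {xs = allFin _} (∈-resp-↭ (descending-↭ φ) m))

  ∈-descending⁺ : ∀ φ g → H g ≡ false → g ∈ descending φ
  ∈-descending⁺ φ g p = ∈-resp-↭ (↭-sym (descending-↭ φ)) (∈-filter⁺ (λ g → H g Bool.≟ false) (∈-allFin g) p)

  descending-unique : ∀ φ → Unique (descending φ)
  descending-unique φ = PermSetoid.Unique-resp-↭ (≡.setoid _) (↭⇒↭ₛ (↭-sym (descending-↭ φ)))
    (Unique.filter⁺ (λ g → H g Bool.≟ false) (Unique.allFin⁺ _))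

  descending-sorted : ∀ φ → ProperLabeling G H φ → AllPairs (λ e h → φ h < φ e) (descending φ)
  descending-sorted φ (_ , _ , inj) = strict (∈-descending⁻ φ)
    (Sorted⇒AllPairs (DecTotalOrder.totalOrder (byLabel φ)) (Sort.sort-↗ (byLabel φ) regularEdges)) (descending-unique φ)
    where
    strict : ∀ {l} → (∀ {g} → g ∈ l → H g ≡ false) → AllPairs (λ e h → φ h ≤ φ e) l → Unique l → AllPairs (λ e h → φ h < φ e) l
    strict reg [] [] = []
    strict reg (le ∷ ps) (ne ∷ u) =
      All.tabulate (λ m → ℕ.≤∧≢⇒< (All.lookup le m) λ eq → All.lookup ne m (sym (inj _ _ (reg (there m)) (reg (here refl)) eq)))
      ∷ strict (reg ∘ there) ps u

module _ {c ℓ a i} (R : CommutativeRing c ℓ) (Λ : Set a) (I : Poly.Ideal R Λ i) where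
  open Poly R Λ
  open Polynomials R Λ
  open Polynomials.Quotient R Λ I
  private module R = CommutativeRing R

  -- `weight` computes only once `h` is known; this extracts the color of a regular edge without
  -- matching on `H e` in the later computations.
  weight-color : ∀ h (col : h ≡ false → Λ) → h ≡ false → Σ Λ λ l → ∀ s → weight h col s ≡ var (kindOf s) l
  weight-color false col p = col refl , λ s → refl

  weight-zero : ∀ h (col : h ≡ false → Λ) → h ≢ false → ∀ {s} → weight h col s ≡ con R.1#
  weight-zero true col p = refl
  weight-zero false col p = contradiction refl p

  module _ (G : Graph) (conG : ConnectedGraph G) (H : ESet G)
    (col : (e : Fin (nE G)) → H e ≡ false → Λ)
    (ψ : Graph → R.Carrier) (inv : IsBlockInvariant R.Carrier R._≈_ ψ) where

    open Connectivity G
    open SortedEdges G H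
    open Contractions R.setoid ψ inv G conG H
    open CommutativeRing quotientRing using (_≈_; setoid; semiring; *-congˡ; *-congʳ; *-cong; *-identityˡ)
      renaming (refl to ≈-refl; sym to ≈-sym; trans to ≈-trans; reflexive to ≈-reflexive)
    open SetoidReasoning setoid
    open Sum semiring using (sum; sum-cong-≋)

    private
      w : E → Status → Expr
      w e s = weight (H e) (col e) s

    open Expansion G H quotientRing w

    ∑≡sum : ∀ {m} (f : Fin m → Expr) → ∑ f ≡ sum f
    ∑≡sum {zero} f = refl
    ∑≡sum {suc m} f = cong (f zero ⊕_) (∑≡sum (f ∘ suc))

    ∏-tabulate : ∀ (s : E → Status) {m} (g : Fin m → E) → ∏ (λ j → w (g j) (s (g j))) ≡ weights s (tabulate g)
    ∏-tabulate s {zero} g = refl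
    ∏-tabulate s {suc m} g = cong (w (g zero) (s (g zero)) ⊗_) (∏-tabulate s (g ∘ suc))

    weights-filter : ∀ s l → weights s l ≈ weights s (filter (λ g → H g Bool.≟ false) l)
    weights-filter s [] = ≈-refl
    weights-filter s (e ∷ l) = go (H e Bool.≟ false)
      where
      go : Dec (H e ≡ false) → weights s (e ∷ l) ≈ weights s (filter (λ g → H g Bool.≟ false) (e ∷ l))
      go (yes p) = ≈-trans (*-congˡ {w e (s e)} (weights-filter s l))
        (≈-reflexive (cong (weights s) (sym (filter-accept (λ g → H g Bool.≟ false) p))))
      go (no p) = ≈-trans (*-cong (≈-reflexive (weight-zero (H e) (col e) p)) (weights-filter s l))
        (≈-trans (*-identityˡ _)
          (≈-reflexive (cong (weights s) (sym (filter-reject (λ g → H g Bool.≟ false) p)))))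

    ∏≈weights : ∀ φ (s : E → Status) → ∏ (λ e → w e (s e)) ≈ weights s (descending φ)
    ∏≈weights φ s = begin
      ∏ (λ e → w e (s e))          ≡⟨ ∏-tabulate s id ⟩
      weights s (allFin _)         ≈⟨ weights-filter s (allFin _) ⟩
      weights s regularEdges       ≈⟨ weights-↭ s (↭-sym (descending-↭ φ)) ⟩
      weights s (descending φ)     ∎

    module Evaluation {φ} (proper : ProperLabeling G H φ) (T : TutteData G H φ) where

      open StateSum G H quotientRing w conG (count T) (cset T) (cset-contracting T) φ
        (λ i → status (term T i)) (λ i → status-ok (term T i)) (λ i → con (ψ (contracted (term T i)))) public

      value : ∀ {X} → Feasible [] X → ∃ λ i → (∀ g → cset T i g ≡ mem X g) × Ψ X ≈ con (ψ (contracted (term T i)))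
      value = leaf-value (cset-distinct T) (cset-complete T)

      tutte≈Z : tutte col ψ T ≈ Z Ψ (descending φ) []
      tutte≈Z = begin
        tutte col ψ T                             ≡⟨ ∑≡sum _ ⟩
        sum (λ i → termValue col ψ (term T i))    ≈⟨ sum-cong-≋ (λ i → *-congʳ (∏≈weights φ (status (term T i)))) ⟩
        restricted (descending φ) (λ _ → true)    ≈⟨ restricted-Z (all-select (descending-sorted φ proper) (∈-descending⁻ φ) (∈-descending⁺ φ)) ⟩
        Z Ψ (descending φ) []                     ∎

      cset-sound : ∀ {X j} → (∀ g → cset T j g ≡ mem X g) → ∀ g → In (cset T j) g → g ∈ X
      cset-sound {X} eq g p = dec-true⁻ (mem? X g) (trans (sym (eq g)) p)

      cset-full : ∀ {X j} → (∀ g → cset T j g ≡ mem X g) → ∀ g → g ∈ X → In (cset T j) g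
      cset-full {X} eq g m = trans (eq g) (⌊⌋-true (mem? X g) m)

      cset-connected : ∀ j → Connected (λ g → In (cset T j) g ⊎ In H g)
      cset-connected j = CircuitsCocycles.contracting⇒connected G {H} {cset T j} conG (cset-contracting T j)

      twin-invariance : TwinInvariant Ψ
      twin-invariance {X} {X′} {N} {e} {f} F F′ t t′ with value F | value F′
      ... | j , eq , val | j′ , eq′ , val′ = ≈-trans val (≈-trans (≋⇒≈ᴵ (con-cong
        (twin-invariant {N = _∈ N} {P = Avail [] N} (avail? [] N) (λ g m → inj₂ (inj₁ m)) (λ g → inj₁)
          (λ g → [ [ inj₁ , inj₂ ∘ inj₂ ∘ inj₁ ]′ ∘ split eq t g , inj₂ ∘ inj₁ ]′)
          (split eq t) (λ g m → cset-full {X} eq g (Twin.from t g m)) (Twin.coloop t)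
          (split eq′ t′) (λ g m → cset-full {X′} eq′ g (Twin.from t′ g m)) (Twin.coloop t′)
          (cset-connected j) (cset-connected j′)
          (TermData.realizes (term T j)) (TermData.realizes (term T j′)))))
        (≈-sym val′))
        where
        split : ∀ {X e j} → (∀ g → cset T j g ≡ mem X g) → Twin [] N X e → ∀ g → In (cset T j) g → g ≡ e ⊎ g ∈ N
        split {X} {e} {j} eq t g p = Twin.to t g (cset-sound {X} {j} eq g p)

    evaluations-agree : ∀ {φ φ′} (p : ProperLabeling G H φ) (p′ : ProperLabeling G H φ′) T T′ →
      Agree (Evaluation.Ψ p T) (Evaluation.Ψ p′ T′)
    evaluations-agree p p′ T T′ {X} {X′} F F′ s s′ with Evaluation.value p T F | Evaluation.value p′ T′ F′
    ... | j , eq , val | j′ , eq′ , val′ = ≈-trans val (≈-trans (≋⇒≈ᴵ (con-cong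
      (contraction-invariant (TermData.realizes (term T j)) (TermData.realizes (term T′ j′))
        (conn-bind λ g q → conn-mono (Evaluation.cset-full p′ T′ {X′} eq′) (s g (Evaluation.cset-sound p T {X} eq g q)))
        (conn-bind λ g q → conn-mono (Evaluation.cset-full p T {X} eq) (s′ g (Evaluation.cset-sound p′ T′ {X′} eq′ g q)))
        (Evaluation.cset-connected p T j) (Evaluation.cset-connected p′ T′ j′))))
      (≈-sym val′))

    feasible-start : ∀ φ → Feasible (descending φ) []
    feasible-start φ = record
      { X-regular = λ () ; l-regular = ∈-descending⁻ φ ; acyclic = []
      ; connected = λ u v → conn-mono (λ g _ → available g) (proj₂ conG u v tt tt) }
      where
      available : ∀ g → Avail (descending φ) [] g
      available g with H g in eq
      ... | true = inj₁ refl
      ... | false = inj₂ (inj₂ (∈-descending⁺ φ g eq))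

    -- The order of the edges is changed first, with the leaf values of `T`; in the new order these
    -- are then replaced by the leaf values of `T′`.
    tutte-invariant : CondB I → ∀ {φ φ′} → ProperLabeling G H φ → ProperLabeling G H φ′ →
      (T : TutteData G H φ) (T′ : TutteData G H φ′) → tutte col ψ T ≈ tutte col ψ T′
    tutte-invariant condB {φ} {φ′} p p′ T T′ = begin
      tutte col ψ T                                ≈⟨ Evaluation.tutte≈Z p T ⟩
      Z (Evaluation.Ψ p T) (descending φ) []       ≈⟨ Z-↭ (evaluations-agree p p T T) (Evaluation.twin-invariance p T) first second
                                                        (↭-trans (descending-↭ φ) (↭-sym (descending-↭ φ′))) (feasible-start φ) ⟩
      Z (Evaluation.Ψ p T) (descending φ′) []      ≈⟨ Z-span (evaluations-agree p p′ T T′) (feasible-start φ′) (feasible-start φ′) (λ _ ()) (λ _ ()) ⟩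
      Z (Evaluation.Ψ p′ T′) (descending φ′) []    ≈⟨ Evaluation.tutte≈Z p′ T′ ⟨
      tutte col ψ T′                               ∎
      where
      first : ∀ e f → H e ≡ false → H f ≡ false →
        w e intAct ⊗ w f extInact ⊕ w e extAct ⊗ w f intInact ≈ w e intInact ⊗ w f extAct ⊕ w e extInact ⊗ w f intAct
      first e f he hf with weight-color (H e) (col e) he | weight-color (H f) (col f) hf
      ... | l , el | m , em
        rewrite el intAct | el extAct | el intInact | el extInact | em intAct | em extAct | em intInact | em extInact =
        difference⇒sum quotientRing (member⇒≈ᴵ (proj₁ (condB l m)))
      second : ∀ e f → H e ≡ false → H f ≡ false →
        w e intInact ⊗ w f extAct ⊕ w e extInact ⊗ w f intInact ≈ w e intInact ⊗ w f extInact ⊕ w e extAct ⊗ w f intInact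
      second e f he hf with weight-color (H e) (col e) he | weight-color (H f) (col f) hf
      ... | l , el | m , em
        rewrite el extAct | el intInact | el extInact | em extAct | em intInact | em extInact =
        difference⇒sum quotientRing (member⇒≈ᴵ (proj₂ (condB l m)))

  condB⇒condA : CondB I → CondA I
  condB⇒condA condB G conG H col ψ inv φ φ′ p p′ T T′ =
    ≈ᴵ⇒member (tutte-invariant G conG H col ψ inv condB p p′ T T′)

-- From (a) to (b): two parallel regular edges with `k` parallel zero edges

-- k = 0 yields the first relation of (b); k = 1, where the empty set is contracting as well, the second.
module Dipole (k : ℕ) where

  dipole : Graph
  dipole = graph 2 (2 ℕ.+ k) (λ _ → zero , suc zero)

  open Connectivity dipole
  open CircuitsCocycles dipole

  zeroEdges : ESet dipole
  zeroEdges zero = false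
  zeroEdges (suc zero) = false
  zeroEdges (suc (suc _)) = true

  label : ℕ → ℕ → E → ℕ
  label a b zero = a
  label a b (suc zero) = b
  label a b (suc (suc _)) = 0

  label-proper : ∀ {a b} → 0 < a → 0 < b → a ≢ b → ProperLabeling dipole zeroEdges (label a b)
  label-proper {a} {b} 0<a 0<b a≢b = zeros , positive , injective
    where
    zeros : ∀ e → zeroEdges e ≡ true → label a b e ≡ 0
    zeros (suc (suc _)) _ = refl
    positive : ∀ e → zeroEdges e ≡ false → 0 < label a b e
    positive zero _ = 0<a
    positive (suc zero) _ = 0<b
    injective : ∀ e f → zeroEdges e ≡ false → zeroEdges f ≡ false → label a b e ≡ label a b f → e ≡ f
    injective zero zero _ _ _ = refl
    injective zero (suc zero) _ _ eq = contradiction eq a≢b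
    injective (suc zero) zero _ _ eq = contradiction (sym eq) a≢b
    injective (suc zero) (suc zero) _ _ _ = refl

  spanning : ∀ {P : E → Set} e → P e → Connected P
  spanning e p zero zero = conn-refl
  spanning e p zero (suc zero) = edge⇒spanned {e = e} p
  spanning e p (suc zero) zero = edge⇒spannedʳ {e = e} p
  spanning e p (suc zero) (suc zero) = conn-refl

  no-edges : ∀ {P : E → Set} {u v} → (∀ g → ¬ P g) → Conn P u v → u ≡ v
  no-edges none (here _) = refl
  no-edges none (step g p _ _ _) = contradiction p (none g)

  dipole-connected : ConnectedGraph dipole
  dipole-connected = (zero , tt) , λ u v _ _ → spanning zero tt u v

  -- A circuit inside `C` could use only the edge `e`, hence would have length one, and the dipole
  -- has no loops.
  contracting-small : ∀ {C e} → (∀ g → C g ≡ true → zeroEdges g ≡ false) → (∀ g → C g ≡ true → g ≡ e) →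
    Connected (λ g → C g ≡ true ⊎ zeroEdges g ≡ true) → IsContracting dipole zeroEdges C
  contracting-small {C} {e} reg only con = connected⇒contracting {zeroEdges} {C} dipole-connected reg no-circuit con
    where
    no-circuit : ¬ (Σ (Circuit dipole) λ γ → ∀ i → C (edg γ i) ≡ true)
    no-circuit (γ , on) with no-edges {λ _ → ⊥} (λ _ ()) (circuit⇒spanned γ zero λ j j≢0 →
      j≢0 (edg-inj γ j zero (trans (only _ (on j)) (sym (only _ (on zero))))))
    ... | ()

  not-both : ∀ {C} → IsContracting dipole zeroEdges C → C zero ≡ true → C (suc zero) ≡ true → ⊥
  not-both {C} c p q = contracting⇒acyclic {zeroEdges} {C} c p (edge⇒spanned {e = suc zero} (q , λ ()))

  loops : Graph
  loops = graph 1 k (λ _ → zero , zero)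

  contract-edge : ∀ {C} e → C e ≡ true → RealizesContraction dipole zeroEdges C loops
  contract-edge e p = record
    { π = λ _ → zero
    ; π-onto = λ { zero → zero , refl }
    ; π-ker₁ = λ u v _ → spanning e p u v
    ; π-ker₂ = λ _ _ _ → refl
    ; ε = λ a → suc (suc a)
    ; ε-inj = λ a b eq → Fin.suc-injective (Fin.suc-injective eq)
    ; ε-in = λ _ → refl
    ; ε-onto = λ { (suc (suc a)) _ → a , refl }
    ; ends-ok = λ _ → inj₁ (refl , refl) }

  links : Graph
  links = graph 2 k (λ _ → zero , suc zero)

  first second neither : ESet dipole
  first zero = true
  first (suc _) = false
  second (suc zero) = true
  second zero = false
  second (suc (suc _)) = false
  neither _ = false

  first-contracting : IsContracting dipole zeroEdges first
  first-contracting = contracting-small {first} {zero} (λ { zero _ → refl }) (λ { zero _ → refl })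
    (spanning zero (inj₁ refl))

  second-contracting : IsContracting dipole zeroEdges second
  second-contracting = contracting-small {second} {suc zero} (λ { (suc zero) _ → refl }) (λ { (suc zero) _ → refl })
    (spanning (suc zero) (inj₁ refl))

  contract-nothing : RealizesContraction dipole zeroEdges neither links
  contract-nothing = record
    { π = id
    ; π-onto = λ v → v , refl
    ; π-ker₁ = λ { u v refl → conn-refl }
    ; π-ker₂ = λ u v → no-edges λ _ ()
    ; ε = λ a → suc (suc a)
    ; ε-inj = λ a b eq → Fin.suc-injective (Fin.suc-injective eq)
    ; ε-in = λ _ → refl
    ; ε-onto = λ { (suc (suc a)) _ → a , refl }
    ; ends-ok = λ _ → inj₁ (refl , refl) }

  classify : ∀ {C} → IsContracting dipole zeroEdges C →
    (∀ e → C e ≡ first e) ⊎ (∀ e → C e ≡ second e) ⊎ (∀ e → C e ≡ neither e)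
  classify {C} c = go (C zero) (C (suc zero)) refl refl
    where
    avoids : ∀ a → C (suc (suc a)) ≡ false
    avoids a = ¬-not λ r → true≢false refl (proj₁ c _ r)
    go : ∀ p q → C zero ≡ p → C (suc zero) ≡ q →
      (∀ e → C e ≡ first e) ⊎ (∀ e → C e ≡ second e) ⊎ (∀ e → C e ≡ neither e)
    go true true p q = ⊥-elim (not-both {C} c p q)
    go true false p q = inj₁ λ { zero → p ; (suc zero) → q ; (suc (suc a)) → avoids a }
    go false true p q = inj₂ (inj₁ λ { zero → p ; (suc zero) → q ; (suc (suc a)) → avoids a })
    go false false p q = inj₂ (inj₂ λ { zero → p ; (suc zero) → q ; (suc (suc a)) → avoids a })

module _ {c ℓ a i} (R : CommutativeRing c ℓ) (Λ : Set a) (I : Poly.Ideal R Λ i) where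
  open Poly R Λ
  open Polynomials R Λ
  open Polynomials.Quotient R Λ I
  private
    module R = CommutativeRing R
    module Q = CommutativeRing quotientRing

  constant-invariant : IsBlockInvariant R.Carrier R._≈_ (λ _ → R.1#)
  constant-invariant = record
    { iso-invariant = λ _ _ _ _ _ → R.refl
    ; combine = λ n _ → (λ _ → R.1#) , (λ _ _ → R.refl) , (λ _ _ _ → R.refl) , λ _ _ _ → R.refl }

  termOf : ∀ k (let open Dipole k) φ C {K} → RealizesContraction dipole zeroEdges C K → TermData dipole zeroEdges φ C
  termOf k φ C {K} r = record
    { status = CircuitsCocycles.statusOf dipole {zeroEdges} {C} φ
    ; status-ok = CircuitsCocycles.statusOf-ok dipole {zeroEdges} {C} φ dipole-connected
    ; contracted = K
    ; realizes = r }
    where open Dipole k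

  color : ∀ k → Λ → Λ → (e : Fin (2 ℕ.+ k)) → Dipole.zeroEdges k e ≡ false → Λ
  color k l m zero _ = l
  color k l m (suc _) _ = m

  module _ where
    open Dipole 0
    open Connectivity dipole

    twoEdgeData : ∀ φ → TutteData dipole zeroEdges φ
    twoEdgeData φ = record
      { count = 2
      ; cset = λ { zero → first ; (suc zero) → second }
      ; cset-contracting = λ { zero → first-contracting ; (suc zero) → second-contracting }
      ; cset-distinct = λ { zero zero _ → refl ; (suc zero) (suc zero) _ → refl
                          ; zero (suc zero) eq → contradiction (eq zero) λ ()
                          ; (suc zero) zero eq → contradiction (eq zero) λ () }
      ; cset-complete = λ C c → [ (λ p → zero , p) , [ (λ p → suc zero , p) , (λ p → ⊥-elim (nonempty C c p)) ]′ ]′ (classify {C} c)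
      ; term = λ { zero → termOf 0 φ first (contract-edge zero refl)
                 ; (suc zero) → termOf 0 φ second (contract-edge (suc zero) refl) } }
      where
      nonempty : ∀ C → IsContracting dipole zeroEdges C → (∀ e → C e ≡ neither e) → ⊥
      nonempty C c p with no-edges (λ { g (inj₁ q) → true≢false q (p g) ; zero (inj₂ ()) ; (suc zero) (inj₂ ()) })
        (CircuitsCocycles.contracting⇒connected dipole {zeroEdges} {C} dipole-connected c zero (suc zero))
      ... | ()

  module _ where
    open Dipole 1
    open Connectivity dipole

    threeEdgeData : ∀ φ → TutteData dipole zeroEdges φ
    threeEdgeData φ = record
      { count = 3
      ; cset = λ { zero → first ; (suc zero) → second ; (suc (suc zero)) → neither }
      ; cset-contracting = λ { zero → first-contracting ; (suc zero) → second-contracting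
                             ; (suc (suc zero)) → contracting-small {neither} {zero} (λ _ ()) (λ _ ())
                                 (spanning (suc (suc zero)) (inj₂ refl)) }
      ; cset-distinct = λ { zero zero _ → refl ; (suc zero) (suc zero) _ → refl ; (suc (suc zero)) (suc (suc zero)) _ → refl
                          ; zero (suc zero) eq → contradiction (eq zero) λ ()
                          ; zero (suc (suc zero)) eq → contradiction (eq zero) λ ()
                          ; (suc zero) zero eq → contradiction (eq zero) λ ()
                          ; (suc zero) (suc (suc zero)) eq → contradiction (eq (suc zero)) λ ()
                          ; (suc (suc zero)) zero eq → contradiction (eq zero) λ ()
                          ; (suc (suc zero)) (suc zero) eq → contradiction (eq (suc zero)) λ () }
      ; cset-complete = λ C c → [ (λ p → zero , p) , [ (λ p → suc zero , p) , (λ p → suc (suc zero) , p) ]′ ]′ (classify {C} c)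
      ; term = λ { zero → termOf 1 φ first (contract-edge zero refl)
                 ; (suc zero) → termOf 1 φ second (contract-edge (suc zero) refl)
                 ; (suc (suc zero)) → termOf 1 φ neither contract-nothing } }

  private
    open Q using (_≈_)

    term₂ : ∀ p q → (p ⊗ (q ⊗ con R.1#)) ⊗ con R.1# ≈ p ⊗ q
    term₂ p q = Q.trans (Q.*-identityʳ _) (Q.*-congˡ (Q.*-identityʳ q))

    term₃ : ∀ p q → (p ⊗ (q ⊗ (con R.1# ⊗ con R.1#))) ⊗ con R.1# ≈ p ⊗ q
    term₃ p q = Q.trans (Q.*-identityʳ _) (Q.*-congˡ (Q.trans (Q.*-congˡ (Q.*-identityʳ _)) (Q.*-identityʳ q)))

  module _ (condA : CondA I) where

    labelings-agree : ∀ k (let open Dipole k) (l m : Λ) (d : ∀ φ → TutteData dipole zeroEdges φ) →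
      tutte (color k l m) (λ _ → R.1#) (d (label 1 2)) ≈ tutte (color k l m) (λ _ → R.1#) (d (label 2 1))
    labelings-agree k l m d = member⇒≈ᴵ (condA dipole dipole-connected zeroEdges (color k l m) (λ _ → R.1#) constant-invariant
      (label 1 2) (label 2 1) (label-proper (s≤s z≤n) (s≤s z≤n) λ ()) (label-proper (s≤s z≤n) (s≤s z≤n) λ ()) (d (label 1 2)) (d (label 2 1)))
      where open Dipole k

    two-edges : ∀ l m → (var kX l ⊗ var ky m) ⊕ (var kY l ⊗ var kx m) ≈ (var kx l ⊗ var kY m) ⊕ (var ky l ⊗ var kX m)
    -- `statusOf` decides all activities by evaluation, so the summands of `tutte` unify with the
    -- arguments of `sum₂`. With labels 1 and 2 the edge of color `l` is the smaller one.
    two-edges l m = Q.trans (Q.sym (sum₂ _ _ _ _)) (Q.trans (labelings-agree 0 l m twoEdgeData) (sum₂ _ _ _ _))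
      where
      sum₂ : ∀ p q r s → (p ⊗ (q ⊗ con R.1#)) ⊗ con R.1# ⊕ ((r ⊗ (s ⊗ con R.1#)) ⊗ con R.1# ⊕ con R.0#) ≈ p ⊗ q ⊕ r ⊗ s
      sum₂ p q r s = Q.+-cong (term₂ p q) (Q.trans (Q.+-identityʳ _) (term₂ r s))

    three-edges : ∀ l m → (var kx l ⊗ var ky m) ⊕ (var kY l ⊗ var kx m) ≈ (var kx l ⊗ var kY m) ⊕ (var ky l ⊗ var kx m)
    -- The cancelled term comes from the empty contracting set: both regular edges are deleted and
    -- externally inactive under either labeling.
    three-edges l m = +-cancelʳ (var ky l ⊗ var ky m) _ _
      (Q.trans (Q.sym (sum₃ _ _ _ _ _ _)) (Q.trans (labelings-agree 1 l m threeEdgeData) (sum₃ _ _ _ _ _ _)))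
      where
      open GroupProperties Q.+-group using () renaming (∙-cancelʳ to +-cancelʳ)
      sum₃ : ∀ p q r s u v → let one = con R.1# in
        (p ⊗ (q ⊗ (one ⊗ one))) ⊗ one ⊕ ((r ⊗ (s ⊗ (one ⊗ one))) ⊗ one ⊕ ((u ⊗ (v ⊗ (one ⊗ one))) ⊗ one ⊕ con R.0#)) ≈
        (p ⊗ q ⊕ r ⊗ s) ⊕ u ⊗ v
      sum₃ p q r s u v = Q.trans (Q.+-cong (term₃ p q) (Q.+-cong (term₃ r s) (Q.trans (Q.+-identityʳ _) (term₃ u v))))
        (Q.sym (Q.+-assoc _ _ _))

    condA⇒condB : CondB I
    condA⇒condB l m =
      ≈ᴵ⇒member (sum⇒difference quotientRing (two-edges l m)) ,
      ≈ᴵ⇒member (sum⇒difference quotientRing (Q.sym (three-edges l m)))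

theorem3p16 : ∀ {c ℓ a i} (R : CommutativeRing c ℓ) → IsIntegralDomain R →
    (Λ : Set a) → (I : Poly.Ideal R Λ i) →
    (Poly.CondA R Λ I → Poly.CondB R Λ I) × (Poly.CondB R Λ I → Poly.CondA R Λ I)
theorem3p16 R _ Λ I = condA⇒condB R Λ I , condB⇒condA R Λ I
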